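{- Let $p\ge5$ be a prime and let $E\in\mathbb{F}_p$, $E\neq0$. The Vieta graph of the quartic $x^2+y^2+z^2+t^2=2Exyzt$ over $\mathbb{F}_p$ satisfies the following. (a) If $p\equiv3\pmod 4$: there are $p^3+5p-1$ vertices in total; there are $4(p^2-4p+3)$ vertices of degree $3$, $0$ of degree $2$, $0$ of degree $1$, and $1$ of degree $0$. (b) If $p\equiv1\pmod 4$: there are $p^3-7p-1+8\sigma(E)A_2(p)\cdot p$ vertices in total; there are $4\big(p^2-14p+45+4\sigma(2E)(A_2(p)^2-2p+9)\big)$ vertices of degree $3$, $6\big(6p-22+4\sigma(2E)(p-5)\big)$ of degree $2$, $32\big(1+\sigma(2E)\big)$ of degree $1$, and $1$ of degree $0$.
   Context: $\sigma:\mathbb{F}_p\to\{ -1,0,1\}\subset\mathbb{Z}$ denotes the quadratic character: $\sigma(a)=1$ if $a$ is a nonzero square, $\sigma(a)=-1$ if $a$ is a non-square, $\sigma(0)=0$. For a prime $p\equiv1\pmod 4$, $A_2(p)$ is the integer $A$ determined by writing $p=A^2+B^2$ with $A,B\in\mathbb{Z}$ and $A\equiv-1\pmod 4$. The Vieta graph of $x^2+y^2+z^2+t^2=2Exyzt$ is the finite simple graph whose vertices are the solutions $(x,y,z,t)\in\mathbb{F}_p^4$, where two distinct vertices are joined by an edge whenever one is a Vieta flip of the other. The Vieta flips of $(x,y,z,t)$ are $(2Eyzt-x,y,z,t)$, $(x,2Exzt-y,z,t)$, $(x,y,2Exyt-z,t)$, $(x,y,z,2Exyz-t)$. -}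

module Defs where

open import Data.Bool.Base using (if_then_else_)
open import Data.Fin.Base using (Fin; toℕ)
open import Data.Fin.Properties using (any?) renaming (_≟_ to _≟ᶠ_)
open import Data.Integer.Base as ℤ using (ℤ; 0ℤ; 1ℤ; -1ℤ)
open import Data.Integer.Divisibility.Signed as ℤ using ()
open import Data.List.Base
  using (List; []; _∷_; length; filter; allFin; cartesianProduct)
open import Data.List.Membership.Propositional using (_∈_)
import Data.List.Membership.DecPropositional as DecMembership
open import Data.List.Relation.Unary.Unique.Propositional using (Unique)
open import Data.List.Relation.Unary.Unique.Propositional.Properties
  using (filter⁺; allFin⁺; cartesianProduct⁺)
open import Data.Nat.Base as ℕ using (ℕ; NonZero)
open import Data.Nat.DivMod using (_mod_)
open import Data.Nat.Properties using () renaming (_≟_ to _≟ⁿ_)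
open import Data.Product.Base using (∃; _×_; _,_)
open import Data.Product.Properties using (≡-dec)
open import Data.Sum.Base using (_⊎_; swap)
open import Level using (0ℓ)
open import Relation.Binary.Core using (Rel)
open import Relation.Binary.Definitions
  using (Decidable; DecidableEquality; Symmetric; Irreflexive)
open import Relation.Binary.PropositionalEquality using (_≡_; _≢_; ≢-sym)
open import Relation.Nullary.Decidable
  using (Dec; does; ¬?; _×-dec_; _⊎-dec_)

-- The vertex set is the set of elements of the duplicate-free list `vertices`;
-- `Adj` matters only between elements of that list.
record FiniteSimpleGraph : Set₁ where
  field
    Carrier  : Set
    vertices : List Carrier
    unique   : Unique vertices
    Adj      : Rel Carrier 0ℓ
    adj?     : Decidable Adj
    symm     : Symmetric Adj
    irrefl   : Irreflexive _≡_ Adj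

  order : ℕ
  order = length vertices

  degree : Carrier → ℕ
  degree v = length (filter (adj? v) vertices)

  #ofDegree : ℕ → ℕ
  #ofDegree d = length (filter (λ v → degree v ≟ⁿ d) vertices)

open FiniteSimpleGraph public using (order; degree; #ofDegree)

-- The ring ℤ/p on canonical representatives; it is the field 𝔽_p for p prime.
𝔽 : ℕ → Set
𝔽 p = Fin p

module _ {p : ℕ} .{{_ : NonZero p}} where

  infixl 6 _+ₚ_ _-ₚ_
  infixl 7 _*ₚ_

  residue : ℕ → 𝔽 p
  residue n = n mod p

  _+ₚ_ _*ₚ_ _-ₚ_ : 𝔽 p → 𝔽 p → 𝔽 p
  a +ₚ b = residue (toℕ a ℕ.+ toℕ b)
  a *ₚ b = residue (toℕ a ℕ.* toℕ b)
  -- Truncation never occurs in the subtraction, since toℕ b < p.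
  a -ₚ b = residue (toℕ a ℕ.+ (p ℕ.∸ toℕ b))

  IsSquare : 𝔽 p → Set
  IsSquare a = ∃ λ (b : 𝔽 p) → b *ₚ b ≡ a

  isSquare? : (a : 𝔽 p) → Dec (IsSquare a)
  isSquare? a = any? λ b → b *ₚ b ≟ᶠ a

  σ : 𝔽 p → ℤ
  σ a = if does (a ≟ᶠ residue 0) then 0ℤ
        else if does (isSquare? a) then 1ℤ
        else -1ℤ

-- For a prime p ≡ 1 (mod 4) exactly one integer A satisfies this, namely A₂(p):
-- p = A² + B² fixes the odd square A², and the congruence fixes the sign of A.
IsA₂ : ℕ → ℤ → Set
IsA₂ p A =
  (∃ λ (B : ℤ) → ℤ.+ p ≡ A ℤ.* A ℤ.+ B ℤ.* B) × (ℤ.+ 4 ℤ.∣ A ℤ.- -1ℤ)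

Quad : ℕ → Set
Quad p = 𝔽 p × 𝔽 p × 𝔽 p × 𝔽 p

_≟Q_ : ∀ {p} → DecidableEquality (Quad p)
_≟Q_ = ≡-dec _≟ᶠ_ (≡-dec _≟ᶠ_ (≡-dec _≟ᶠ_ _≟ᶠ_))

allQuads : ∀ p → List (Quad p)
allQuads p = cartesianProduct (allFin p) (cartesianProduct (allFin p)
               (cartesianProduct (allFin p) (allFin p)))

allQuads-unique : ∀ p → Unique (allQuads p)
allQuads-unique p =
  cartesianProduct⁺ (allFin⁺ p) (cartesianProduct⁺ (allFin⁺ p)
    (cartesianProduct⁺ (allFin⁺ p) (allFin⁺ p)))

module _ {p : ℕ} .{{_ : NonZero p}} (E : 𝔽 p) where

  IsSolution : Quad p → Set
  IsSolution (x , y , z , t) =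
    x *ₚ x +ₚ y *ₚ y +ₚ z *ₚ z +ₚ t *ₚ t ≡ residue 2 *ₚ E *ₚ x *ₚ y *ₚ z *ₚ t

  isSolution? : (v : Quad p) → Dec (IsSolution v)
  isSolution? (x , y , z , t) = _ ≟ᶠ _

  flips : Quad p → List (Quad p)
  flips (x , y , z , t) =
      (residue 2 *ₚ E *ₚ y *ₚ z *ₚ t -ₚ x , y , z , t)
    ∷ (x , residue 2 *ₚ E *ₚ x *ₚ z *ₚ t -ₚ y , z , t)
    ∷ (x , y , residue 2 *ₚ E *ₚ x *ₚ y *ₚ t -ₚ z , t)
    ∷ (x , y , z , residue 2 *ₚ E *ₚ x *ₚ y *ₚ z -ₚ t)
    ∷ []

  VietaAdj : Rel (Quad p) 0ℓ
  VietaAdj v w = v ≢ w × (w ∈ flips v ⊎ v ∈ flips w)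

  vietaGraph : FiniteSimpleGraph
  vietaGraph = record
    { Carrier  = Quad p
    ; vertices = filter isSolution? (allQuads p)
    ; unique   = filter⁺ isSolution? (allQuads-unique p)
    ; Adj      = VietaAdj
    ; adj?     = λ v w → ¬? (v ≟Q w) ×-dec (w ∈? flips v ⊎-dec v ∈? flips w)
    ; symm     = λ (v≢w , flip) → ≢-sym v≢w , swap flip
    ; irrefl   = λ v≡w (v≢w , _) → v≢w v≡w
    }
    where open DecMembership (_≟Q_ {p}) using (_∈?_)

{-# OPTIONS --safe #-}
module Submission where

open import Defs
open import Data.Nat.Base using (ℕ; NonZero; _≥_; _%_)
open import Data.Nat.Primality using (Prime)
open import Data.Integer.Base using (ℤ; +_; 1ℤ; _+_; _*_; _-_; _^_)
open import Data.Product.Base using (_×_)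
open import Relation.Binary.PropositionalEquality using (_≡_; _≢_)

open import Algebra.Bundles using (CommutativeRing)
import Algebra.Properties.Semiring.Mult.TCOptimised as Mult
import Algebra.Properties.Semiring.Sum as SemiringSum
import Algebra.Solver.Ring as RingSolver
open import Algebra.Solver.Ring.AlmostCommutativeRing
  using (fromCommutativeRing; _-Raw-AlmostCommutative⟶_)
import Algebra.Structures as Structures
open import Data.Bool.Base using (true; false; if_then_else_; _∧_)
open import Data.Empty using (⊥-elim)
open import Data.Fin.Base using (Fin; zero; suc; toℕ)
open import Data.Fin.Permutation using (permutation)
open import Data.Fin.Properties
  using (any?; suc-injective; toℕ-injective; toℕ-fromℕ<; toℕ<n) renaming (_≟_ to _≟ᶠ_)
open import Data.Integer.Base as ℤ using (-[1+_]; 0ℤ; -1ℤ; -_; ∣_∣; _≤_; +≤+; -≤+)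
open import Data.Integer.Divisibility.Signed using () renaming (divides to dividesℤ)
import Data.Integer.Properties as ℤP
open import Data.Integer.Tactic.RingSolver using (solve-∀)
open import Data.List.Base
  using (List; []; _∷_; _++_; length; filter; map; tabulate; allFin; cartesianProduct)
open import Data.List.Membership.Propositional using (_∈_)
open import Data.List.Relation.Unary.All using (All; []; _∷_)
open import Data.List.Relation.Unary.AllPairs using (AllPairs; []; _∷_)
open import Data.List.Relation.Unary.Any using (here; there)
open import Data.Maybe.Base using (Maybe; just; nothing)
open import Data.Nat.Base as ℕ using ()
open import Data.Nat.Coprimality using (prime⇒coprime; coprime-Bézout)
open import Data.Nat.DivMod
  using (m%n<n; m<n⇒m%n≡m; %-distribˡ-+; %-distribˡ-*; n%n≡0; m*n%n≡0; m≡m%n+[m/n]*n)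
open import Data.Nat.Divisibility using (_∣_; divides; ∣⇒≤)
open import Data.Nat.GCD using (module Bézout)
open import Data.Nat.Primality using (euclidsLemma; prime⇒nonZero)
import Data.Nat.Properties as ℕP
open import Data.Product.Base using (_,_; proj₁; proj₂; ∃)
open import Data.Sum.Base using (_⊎_; inj₁; inj₂; [_,_]′)
open import Function.Base using (_∘_)
open import Level using (0ℓ)
open import Relation.Binary.Definitions using (DecidableEquality; tri<; tri≈; tri>)
open import Relation.Binary.PropositionalEquality
  using (refl; sym; trans; cong; cong₂; subst; subst₂; isEquivalence; module ≡-Reasoning)
open import Relation.Nullary using (¬_)
open import Relation.Nullary.Decidable
  using (Dec; yes; no; does; ¬?; _×-dec_; dec-true; dec-false; map′)
open import Relation.Unary using (Decidable)

-- Let χ be the quadratic character, c = 2E and η = χ(-1). The equation is quadratic in t, so it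
-- has 1 + χ(discriminant) solutions t for given x, y, z, and the sum over z has a closed form
-- because ∑ χ(a z² + b) does. A flip fixes its coordinate x iff 2x = c y z t, and a vertex has
-- degree 4 minus the number of its fixed coordinates; by inclusion–exclusion and the symmetry of
-- the equation it suffices to count the solutions in which one, two, three or four given
-- coordinates are fixed. What remains are the sums T(a) = ∑ χ(u) χ(u² + a), and only T(1) matters.
-- If η = -1, its summands cancel in pairs ±u. If η = 1, the second moment of T gives Jacobsthal's
-- identity T(1)² + T(n)² = 4p for a nonsquare n, grouping u with -u and ±u⁻¹ shows that
-- T(1) ≡ -2 mod 8, and the uniqueness of the representation p = A² + B² yields T(1) = 2A.

-- In the order, T enters only through two loci in the (x, y)-plane: x² + y² = 0 and (c x y)² = 4.
-- On either one the other expression is c² x⁴ + 4 up to sign and nonzero squares, and its character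
-- sum is -1 + χ(c) T(4). Substitution gives T(t² a) = χ(t) T(a), so T(4) and, for η = 1, T(-4)
-- reduce to T(1). From T(4) = χ(2) T(1) comes a χ(2) that cancels the one in χ(c), so the order
-- involves σ(E). If i² = -1, then -4 = (2i)² and 2i = (1 + i)², so T(-4) = T(1) without a sign, and
-- the degree counts keep σ(2E) = χ(c). There T occurs as the product T(1) T(-4), the origin of A².
-- The two loci meet in 4 (1 + σ(2E)) points if η = 1. If η = -1, then x² + y² = 0 forces x = y = 0,
-- the loci are disjoint, and the origin is the only solution with two or more fixed coordinates.
-- The obstacle is the sign of A: Jacobsthal's identity sees only squares. The congruence modulo 8
-- places T(1)/2 in the class -1 modulo 4, which is the normalisation of A₂(p).

module Sum = SemiringSum (CommutativeRing.semiring ℤP.+-*-commutativeRing)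

private variable
  n : ℕ
  Φ Ψ Θ Ξ Ω X Y : Set

-- Indicators and finite sums

abstract
  -- Abstract, so that goals keep `𝟙` folded however its decision procedure computes; `𝟙-if` is the
  -- only access to its value, and `exactly` evaluates closed instances through it.
  𝟙 : Dec Φ → ℤ
  𝟙 Φ? = if does Φ? then 1ℤ else 0ℤ

  𝟙-if : (Φ? : Dec Φ) → 𝟙 Φ? ≡ (if does Φ? then 1ℤ else 0ℤ)
  𝟙-if Φ? = refl

𝟙-yes : (Φ? : Dec Φ) → Φ → 𝟙 Φ? ≡ 1ℤ
𝟙-yes Φ? p = trans (𝟙-if Φ?) (cong (if_then 1ℤ else 0ℤ) (dec-true Φ? p))

𝟙-no : (Φ? : Dec Φ) → ¬ Φ → 𝟙 Φ? ≡ 0ℤ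
𝟙-no Φ? ¬p = trans (𝟙-if Φ?) (cong (if_then 1ℤ else 0ℤ) (dec-false Φ? ¬p))

𝟙-cong : (Φ? : Dec Φ) (Ψ? : Dec Ψ) → (Φ → Ψ) → (Ψ → Φ) → 𝟙 Φ? ≡ 𝟙 Ψ?
𝟙-cong Φ? Ψ? f g with Φ?
... | yes p = trans (𝟙-yes (yes p) p) (sym (𝟙-yes Ψ? (f p)))
... | no ¬p = trans (𝟙-no (no ¬p) ¬p) (sym (𝟙-no Ψ? (¬p ∘ g)))

𝟙-*-cong : (Φ? : Dec Φ) {a b : ℤ} → (Φ → a ≡ b) → 𝟙 Φ? * a ≡ 𝟙 Φ? * b
𝟙-*-cong Φ? {a} {b} eq with Φ?
... | yes p = cong (𝟙 (yes p) *_) (eq p)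
... | no ¬p = trans (cong (_* a) (𝟙-no (no ¬p) ¬p)) (sym (cong (_* b) (𝟙-no (no ¬p) ¬p)))

𝟙-× : (Φ? : Dec Φ) (Ψ? : Dec Ψ) → 𝟙 (Φ? ×-dec Ψ?) ≡ 𝟙 Φ? * 𝟙 Ψ?
𝟙-× Φ? Ψ? = begin
  𝟙 (Φ? ×-dec Ψ?)           ≡⟨ 𝟙-if _ ⟩
  (if does Φ? ∧ does Ψ? then 1ℤ else 0ℤ) ≡⟨ lemma (does Φ?) (does Ψ?) ⟩
  (if does Φ? then 1ℤ else 0ℤ) * (if does Ψ? then 1ℤ else 0ℤ)
                            ≡⟨ cong₂ _*_ (𝟙-if Φ?) (𝟙-if Ψ?) ⟨
  𝟙 Φ? * 𝟙 Ψ?               ∎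
  where
  open ≡-Reasoning
  lemma : ∀ a b → (if a ∧ b then 1ℤ else 0ℤ) ≡ (if a then 1ℤ else 0ℤ) * (if b then 1ℤ else 0ℤ)
  lemma false _     = refl
  lemma true  false = refl
  lemma true  true  = refl

abstract
  ∑ : (Fin n → ℤ) → ℤ
  ∑ = Sum.sum

  ∑-cong : {f g : Fin n → ℤ} → (∀ x → f x ≡ g x) → ∑ f ≡ ∑ g
  ∑-cong = Sum.sum-cong-≗

  ∑-comm : ∀ {m n} (f : Fin m → Fin n → ℤ) → ∑ (λ x → ∑ (f x)) ≡ ∑ (λ y → ∑ λ x → f x y)
  ∑-comm = Sum.∑-comm

  ∑-+ : (f g : Fin n → ℤ) → ∑ (λ x → f x + g x) ≡ ∑ f + ∑ g
  ∑-+ = Sum.∑-distrib-+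

  ∑-*ˡ : ∀ k (f : Fin n → ℤ) → ∑ (λ x → k * f x) ≡ k * ∑ f
  ∑-*ˡ k f = sym (Sum.*-distribˡ-sum k f)

  ∑-*ʳ : ∀ k (f : Fin n → ℤ) → ∑ (λ x → f x * k) ≡ ∑ f * k
  ∑-*ʳ k f = sym (Sum.*-distribʳ-sum k f)

  ∑-const : ∀ n k → ∑ {n} (λ _ → k) ≡ + n * k
  ∑-const ℕ.zero k = refl
  ∑-const (ℕ.suc n) k = trans (cong (λ s → k + s) (∑-const n k)) (sym (ℤP.suc-* (+ n) k))

  ∑-∷ : (f : Fin (ℕ.suc n) → ℤ) → ∑ f ≡ f zero + ∑ (f ∘ suc)
  ∑-∷ f = refl

  ∑-[] : (f : Fin 0 → ℤ) → ∑ f ≡ 0ℤ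
  ∑-[] f = refl

  ∑-reindex : (g h : Fin n → Fin n) → (∀ x → g (h x) ≡ x) → (∀ x → h (g x) ≡ x) →
              (f : Fin n → ℤ) → ∑ (f ∘ g) ≡ ∑ f
  ∑-reindex g h gh hg f = sym (Sum.sum-permute f (permutation g h gh hg))

∑-cong₂ : ∀ {m} {f g : Fin n → Fin m → ℤ} → (∀ x y → f x y ≡ g x y) →
          ∑ (λ x → ∑ (f x)) ≡ ∑ (λ x → ∑ (g x))
∑-cong₂ eq = ∑-cong λ x → ∑-cong (eq x)

∑-neg : (f : Fin n → ℤ) → ∑ (λ x → - f x) ≡ - ∑ f
∑-neg f = trans (∑-cong λ x → sym (ℤP.-1*i≡-i (f x))) (trans (∑-*ˡ -1ℤ f) (ℤP.-1*i≡-i (∑ f)))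

∑-minus : (f g : Fin n → ℤ) → ∑ (λ x → f x - g x) ≡ ∑ f - ∑ g
∑-minus f g = trans (∑-+ f (λ x → - g x)) (cong (λ s → ∑ f + s) (∑-neg g))

∑-zero : {f : Fin n → ℤ} → (∀ x → f x ≡ 0ℤ) → ∑ f ≡ 0ℤ
∑-zero {n} eq = trans (∑-cong eq) (trans (∑-const n 0ℤ) (ℤP.*-zeroʳ (+ n)))

∑-δ : (a : Fin n) (f : Fin n → ℤ) → ∑ (λ x → 𝟙 (x ≟ᶠ a) * f x) ≡ f a
∑-δ zero f = begin
  ∑ (λ x → 𝟙 (x ≟ᶠ zero) * f x)
    ≡⟨ ∑-∷ _ ⟩
  𝟙 (zero ≟ᶠ zero) * f zero + ∑ (λ x → 𝟙 (suc x ≟ᶠ zero) * f (suc x))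
    ≡⟨ cong₂ _+_ (trans (cong (_* f zero) (𝟙-yes (zero ≟ᶠ zero) refl)) (ℤP.*-identityˡ (f zero)))
                 (∑-zero λ x → cong (_* f (suc x)) (𝟙-no (suc x ≟ᶠ zero) λ ())) ⟩
  f zero + 0ℤ
    ≡⟨ ℤP.+-identityʳ (f zero) ⟩
  f zero ∎
  where open ≡-Reasoning
∑-δ (suc a) f = begin
  ∑ (λ x → 𝟙 (x ≟ᶠ suc a) * f x)
    ≡⟨ ∑-∷ _ ⟩
  𝟙 (zero ≟ᶠ suc a) * f zero + ∑ (λ x → 𝟙 (suc x ≟ᶠ suc a) * f (suc x))
    ≡⟨ cong₂ _+_ (cong (_* f zero) (𝟙-no (zero ≟ᶠ suc a) λ ()))
         (∑-cong λ x → cong (_* f (suc x)) (𝟙-cong (suc x ≟ᶠ suc a) (x ≟ᶠ a) suc-injective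
             (cong suc))) ⟩
  0ℤ + ∑ (λ x → 𝟙 (x ≟ᶠ a) * f (suc x))
    ≡⟨ ℤP.+-identityˡ _ ⟩
  ∑ (λ x → 𝟙 (x ≟ᶠ a) * f (suc x))
    ≡⟨ ∑-δ a (f ∘ suc) ⟩
  f (suc a) ∎
  where open ≡-Reasoning

∑-nonpositive : {f : Fin n → ℤ} → (∀ x → f x ≤ 0ℤ) → ∑ f ≤ 0ℤ
∑-nonpositive {ℕ.zero}  {f} f≤0 = ℤP.≤-reflexive (∑-[] f)
∑-nonpositive {ℕ.suc n} {f} f≤0 = subst (_≤ 0ℤ) (sym (∑-∷ f))
  (ℤP.+-mono-≤ (f≤0 zero) (∑-nonpositive (f≤0 ∘ suc)))

∑-nonpositive-zero : (f : Fin n → ℤ) → (∀ x → f x ≤ 0ℤ) → ∑ f ≡ 0ℤ → ∀ x → f x ≡ 0ℤ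
∑-nonpositive-zero {ℕ.suc n} f f≤0 ∑f≡0 = λ
  { zero    → f0≡0
  ; (suc x) → ∑-nonpositive-zero (f ∘ suc) (f≤0 ∘ suc)
      (trans (sym (ℤP.+-identityˡ _)) (trans (cong (_+ ∑ (f ∘ suc)) (sym f0≡0)) ∑f≡0′)) x }
  where
  ∑f≡0′ : f zero + ∑ (f ∘ suc) ≡ 0ℤ
  ∑f≡0′ = trans (sym (∑-∷ f)) ∑f≡0
  f0≡0 : f zero ≡ 0ℤ
  f0≡0 = ℤP.≤-antisym (f≤0 zero)
    (subst₂ _≤_ ∑f≡0′ (ℤP.+-identityʳ _)
      (ℤP.+-monoʳ-≤ (f zero) (∑-nonpositive (f≤0 ∘ suc))))

trichotomy : ∀ a b → 𝟙 (a ℕP.<? b) + 𝟙 (b ℕP.<? a) + 𝟙 (a ℕP.≟ b) ≡ 1ℤ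
trichotomy a b with ℕP.<-cmp a b
... | tri< a<b a≢b b≮a rewrite 𝟙-yes (a ℕP.<? b) a<b | 𝟙-no (b ℕP.<? a) b≮a | 𝟙-no (a ℕP.≟ b) a≢b = refl
... | tri≈ a≮b a≡b b≮a rewrite 𝟙-no (a ℕP.<? b) a≮b | 𝟙-no (b ℕP.<? a) b≮a | 𝟙-yes (a ℕP.≟ b) a≡b = refl
... | tri> a≮b a≢b b<a rewrite 𝟙-no (a ℕP.<? b) a≮b | 𝟙-yes (b ℕP.<? a) b<a | 𝟙-no (a ℕP.≟ b) a≢b = refl

-- `key` selects one point of each orbit on which it separates x from `φ x`; the other point
-- contributes the same, whence the factor 2. Ties go to the last sum, so `key` may fail to be
-- injective: `∑-quarter` exploits this with a key that a second involution preserves.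
∑-halve : (φ : Fin n → Fin n) → (∀ x → φ (φ x) ≡ x) → (key : Fin n → ℕ) →
          (f : Fin n → ℤ) → (∀ x → f (φ x) ≡ f x) →
          ∑ f ≡ + 2 * ∑ (λ x → 𝟙 (key x ℕP.<? key (φ x)) * f x)
              + ∑ (λ x → 𝟙 (key x ℕP.≟ key (φ x)) * f x)
∑-halve φ φφ key f fφ = begin
  ∑ f
    ≡⟨ ∑-cong (λ x → trans (sym (ℤP.*-identityˡ (f x)))
         (trans (cong (_* f x) (sym (trichotomy (key x) (key (φ x)))))
             (distrib (lt x) (gt x) (eq x) (f x)))) ⟩
  ∑ (λ x → lt x * f x + gt x * f x + eq x * f x)
    ≡⟨ trans (∑-+ _ _) (cong (_+ ∑ (λ x → eq x * f x)) (∑-+ _ _)) ⟩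
  ∑ (λ x → lt x * f x) + ∑ (λ x → gt x * f x) + ∑ (λ x → eq x * f x)
    ≡⟨ cong (λ s → ∑ (λ x → lt x * f x) + s + ∑ (λ x → eq x * f x)) flip ⟩
  ∑ (λ x → lt x * f x) + ∑ (λ x → lt x * f x) + ∑ (λ x → eq x * f x)
    ≡⟨ cong (_+ ∑ (λ x → eq x * f x)) (double (∑ (λ x → lt x * f x))) ⟩
  + 2 * ∑ (λ x → lt x * f x) + ∑ (λ x → eq x * f x) ∎
  where
  open ≡-Reasoning
  lt gt eq : Fin _ → ℤ
  lt x = 𝟙 (key x ℕP.<? key (φ x))
  gt x = 𝟙 (key (φ x) ℕP.<? key x)
  eq x = 𝟙 (key x ℕP.≟ key (φ x))
  distrib : ∀ a b c d → (a + b + c) * d ≡ a * d + b * d + c * d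
  distrib = solve-∀
  double : ∀ a → a + a ≡ + 2 * a
  double = solve-∀
  flip : ∑ (λ x → gt x * f x) ≡ ∑ (λ x → lt x * f x)
  flip = trans
    (∑-cong λ x → cong₂ _*_ (cong (λ y → 𝟙 (key (φ x) ℕP.<? key y)) (sym (φφ x))) (sym (fφ x)))
    (∑-reindex φ φ φφ φφ (λ x → lt x * f x))

∑-δ-one : (a : Fin n) → ∑ (λ x → 𝟙 (x ≟ᶠ a)) ≡ 1ℤ
∑-δ-one a = trans (∑-cong λ x → sym (ℤP.*-identityʳ _)) (∑-δ a λ _ → 1ℤ)

+-cancelˡ-≡ : ∀ i j k → i + j ≡ i + k → j ≡ k
+-cancelˡ-≡ i j k eq = trans (lem i j) (trans (cong (λ s → - i + s) eq) (sym (lem i k)))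
  where
  lem : ∀ i j → j ≡ - i + (i + j)
  lem = solve-∀

-- Conditions are exchanged as a system: in the applications an equation becomes equivalent to its
-- replacement only in the presence of the others.
𝟙-*-⇔ : {Φ Ψ Θ Ξ : Set} (Φ? : Dec Φ) (Ψ? : Dec Ψ) (Θ? : Dec Θ) (Ξ? : Dec Ξ) →
         (Φ → Ψ → Θ × Ξ) → (Θ → Ξ → Φ × Ψ) → 𝟙 Φ? * 𝟙 Ψ? ≡ 𝟙 Θ? * 𝟙 Ξ?
𝟙-*-⇔ Φ? Ψ? Θ? Ξ? f g = trans (sym (𝟙-× Φ? Ψ?))
  (trans (𝟙-cong _ _ (λ (p , q) → f p q) (λ (r , s) → g r s)) (𝟙-× Θ? Ξ?))

∑-𝟙-const : {Φ : Fin n → Set} (Φ? : ∀ y → Dec (Φ y)) {f : Fin n → ℤ} (v : ℤ) → (∀ y → Φ y → f y ≡ v) →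
            ∑ (λ y → 𝟙 (Φ? y) * f y) ≡ ∑ (λ y → 𝟙 (Φ? y)) * v
∑-𝟙-const Φ? v eq = trans (∑-cong λ y → 𝟙-*-cong (Φ? y) (eq y)) (∑-*ʳ v _)

∑-one : ∀ n → ∑ {n} (λ _ → 1ℤ) ≡ + n
∑-one n = trans (∑-const n 1ℤ) (ℤP.*-identityʳ (+ n))

∑²-+ : ∀ {m} (f g : Fin m → Fin n → ℤ) →
       ∑ (λ x → ∑ λ y → f x y + g x y) ≡ ∑ (λ x → ∑ (f x)) + ∑ (λ x → ∑ (g x))
∑²-+ f g = trans (∑-cong λ x → ∑-+ (f x) (g x)) (∑-+ _ _)

∑²-minus : ∀ {m} (f g : Fin m → Fin n → ℤ) →
           ∑ (λ x → ∑ λ y → f x y - g x y) ≡ ∑ (λ x → ∑ (f x)) - ∑ (λ x → ∑ (g x))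
∑²-minus f g = trans (∑-cong λ x → ∑-minus (f x) (g x)) (∑-minus _ _)

∑²-* : ∀ {m} k (f : Fin m → Fin n → ℤ) →
       ∑ (λ x → ∑ λ y → k * f x y) ≡ k * ∑ (λ x → ∑ (f x))
∑²-* k f = trans (∑-cong λ x → ∑-*ˡ k (f x)) (∑-*ˡ k _)

𝟙-⇔³ : {Φ Ψ Θ Ξ Ω : Set} (Φ? : Dec Φ) (Ψ? : Dec Ψ) (Θ? : Dec Θ) (Ξ? : Dec Ξ) (Ω? : Dec Ω) →
        (Φ → Ψ → Θ → Ξ × Ω) → (Ξ → Ω → Φ × Ψ × Θ) → 𝟙 Φ? * 𝟙 Ψ? * 𝟙 Θ? ≡ 𝟙 Ξ? * 𝟙 Ω?
𝟙-⇔³ Φ? Ψ? Θ? Ξ? Ω? f g = trans (cong (_* 𝟙 Θ?) (sym (𝟙-× Φ? Ψ?)))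
  (𝟙-*-⇔ (Φ? ×-dec Ψ?) Θ? Ξ? Ω? (λ (p , q) → f p q) (λ s u → let (p , q , r) = g s u in (p , q) , r))

∑-*-one : ∀ k {f : Fin n → ℤ} → ∑ f ≡ 1ℤ → ∑ (λ x → k * f x) ≡ k
∑-*-one k {f} eq = trans (∑-*ˡ k f) (trans (cong (k *_) eq) (ℤP.*-identityʳ k))

∑⁴ : (Fin n → Fin n → Fin n → Fin n → ℤ) → ℤ
∑⁴ f = ∑ λ x → ∑ λ y → ∑ λ z → ∑ λ t → f x y z t

∑⁴-cong : {f g : Fin n → Fin n → Fin n → Fin n → ℤ} → (∀ x y z t → f x y z t ≡ g x y z t) → ∑⁴ f ≡ ∑⁴ g
∑⁴-cong eq = ∑-cong₂ λ x y → ∑-cong₂ λ z t → eq x y z t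

∑⁴-+ : (f g : Fin n → Fin n → Fin n → Fin n → ℤ) →
       ∑⁴ (λ x y z t → f x y z t + g x y z t) ≡ ∑⁴ f + ∑⁴ g
∑⁴-+ f g = trans (∑-cong₂ λ x y → ∑²-+ (f x y) (g x y)) (∑²-+ _ _)

∑⁴-* : ∀ k (f : Fin n → Fin n → Fin n → Fin n → ℤ) → ∑⁴ (λ x y z t → k * f x y z t) ≡ k * ∑⁴ f
∑⁴-* k f = trans (∑-cong₂ λ x y → ∑²-* k (f x y)) (∑²-* k _)

-- Finite fields of odd order

-- The carrier is `Fin q`, so that `∑` ranges over it and equality is decidable; the operations stay
-- abstract, so the character sums rest on these axioms and not on arithmetic of residues.
record FiniteField (q : ℕ) : Set where
  infixl 6 _⊕_
  infixl 7 _⊙_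
  infix  8 ⊖_
  field
    _⊕_ _⊙_ : Fin q → Fin q → Fin q
    ⊖_ _⁻¹ : Fin q → Fin q
    0# 1# : Fin q
    isCommutativeRing : Structures.IsCommutativeRing _≡_ _⊕_ _⊙_ ⊖_ 0# 1#
    ⁻¹-inverse : ∀ {a} → a ≢ 0# → a ⊙ a ⁻¹ ≡ 1#
    -- With this convention inversion is an involution of the whole field.
    ⁻¹-zero : 0# ⁻¹ ≡ 0#
    1≢0 : 1# ≢ 0#
    2≢0 : 1# ⊕ 1# ≢ 0#

-- The solver compares integer coefficients only, so what it proves holds in every commutative ring;
-- facts special to a field or to given elements enter as hypotheses through `by-hyp`.
module IntegerSolver (R : CommutativeRing 0ℓ 0ℓ) where
  open CommutativeRing R renaming (_+_ to _⊕_; _*_ to _⊙_; -_ to ⊖_; refl to ≈-refl; sym to ≈-sym; trans to ≈-trans)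
  open Mult semiring using (×1-homo-*; ×-homo-+) renaming (_×_ to _×′_)
  open import Algebra.Properties.Ring ring
  open import Algebra.Properties.AbelianGroup +-abelianGroup using (⁻¹-∙-comm)
  open import Relation.Binary.Reasoning.Setoid setoid

  -- The optimised multiple makes `ι (+ 2)` and `ι (+ 4)` compute to `1# ⊕ 1#` and
  -- `1# ⊕ 1# ⊕ 1# ⊕ 1#`, so that solver constants match `2#` and `4#` definitionally.
  ι : ℤ → Carrier
  ι (+ n)    = n ×′ 1#
  ι -[1+ n ] = ⊖ (ℕ.suc n ×′ 1#)

  private
    ι-neg : ∀ i → ι (- i) ≈ ⊖ ι i
    ι-neg (+ ℕ.zero)  = ≈-sym -0#≈0#
    ι-neg (+ ℕ.suc n) = ≈-refl
    ι-neg -[1+ n ]    = ≈-sym (-‿involutive _)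

    ι-⊖ : ∀ m n → ι (m ℤ.⊖ n) ≈ ι (+ m) ⊕ ⊖ ι (+ n)
    ι-⊖ m ℕ.zero = ≈-sym (≈-trans (+-congˡ -0#≈0#) (+-identityʳ _))
    ι-⊖ ℕ.zero (ℕ.suc n) = ≈-sym (+-identityˡ _)
    ι-⊖ (ℕ.suc m) (ℕ.suc n) = begin
      ι (ℕ.suc m ℤ.⊖ ℕ.suc n)      ≡⟨ cong ι (ℤP.[1+m]⊖[1+n]≡m⊖n m n) ⟩
      ι (m ℤ.⊖ n)                  ≈⟨ ι-⊖ m n ⟩
      ι (+ m) ⊕ ⊖ ι (+ n)          ≈⟨ +-congʳ (+-identityˡ _) ⟨
      (0# ⊕ ι (+ m)) ⊕ ⊖ ι (+ n)   ≈⟨ +-congʳ (+-congʳ (-‿inverseʳ 1#)) ⟨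
      ((1# ⊕ ⊖ 1#) ⊕ ι (+ m)) ⊕ ⊖ ι (+ n) ≈⟨ +-congʳ (≈-trans (+-assoc _ _ _)
          (≈-trans (+-congˡ (+-comm _ _)) (≈-sym (+-assoc _ _ _)))) ⟩
      ((1# ⊕ ι (+ m)) ⊕ ⊖ 1#) ⊕ ⊖ ι (+ n) ≈⟨ +-assoc _ _ _ ⟩
      (1# ⊕ ι (+ m)) ⊕ (⊖ 1# ⊕ ⊖ ι (+ n)) ≈⟨ +-congˡ (⁻¹-∙-comm _ _) ⟩
      (1# ⊕ ι (+ m)) ⊕ ⊖ (1# ⊕ ι (+ n)) ≈⟨ +-cong (×-homo-+ 1# 1 m) (-‿cong (×-homo-+ 1# 1 n)) ⟨
      ι (+ ℕ.suc m) ⊕ ⊖ ι (+ ℕ.suc n) ∎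

    ι-+ : ∀ i j → ι (i + j) ≈ ι i ⊕ ι j
    ι-+ (+ m) (+ n) = ×-homo-+ 1# m n
    ι-+ (+ m) -[1+ n ] = ι-⊖ m (ℕ.suc n)
    ι-+ -[1+ m ] (+ n) = ≈-trans (ι-⊖ n (ℕ.suc m)) (+-comm _ _)
    ι-+ -[1+ m ] -[1+ n ] = ≈-trans
      (-‿cong (≈-trans (reflexive (cong (λ k → ι (+ ℕ.suc k)) (sym (ℕP.+-suc m n))))
          (×-homo-+ 1# (ℕ.suc m) (ℕ.suc n))))
      (≈-sym (⁻¹-∙-comm _ _))

    ι-+*+ : ∀ m n → ι (+ m * + n) ≈ ι (+ m) ⊙ ι (+ n)
    ι-+*+ m n = ≈-trans (reflexive (cong ι (sym (ℤP.pos-* m n)))) (×1-homo-* m n)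

    ι-* : ∀ i j → ι (i * j) ≈ ι i ⊙ ι j
    ι-* (+ m) (+ n) = ι-+*+ m n
    ι-* (+ m) -[1+ n ] = ≈-trans (reflexive (cong ι (sym (ℤP.neg-distribʳ-* (+ m) (+ ℕ.suc n)))))
      (≈-trans (ι-neg (+ m * + ℕ.suc n)) (≈-trans (-‿cong (ι-+*+ m (ℕ.suc n))) (-‿distribʳ-* _ _)))
    ι-* -[1+ m ] (+ n) = ≈-trans (reflexive (cong ι (sym (ℤP.neg-distribˡ-* (+ ℕ.suc m) (+ n)))))
      (≈-trans (ι-neg (+ ℕ.suc m * + n)) (≈-trans (-‿cong (ι-+*+ (ℕ.suc m) n)) (-‿distribˡ-* _ _)))
    ι-* -[1+ m ] -[1+ n ] = ≈-trans (ι-+*+ (ℕ.suc m) (ℕ.suc n))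
      (≈-trans (≈-sym (-‿involutive _)) (≈-trans (-‿cong (-‿distribˡ-* _ _)) (-‿distribʳ-* _ _)))

    morphism : CommutativeRing.rawRing ℤP.+-*-commutativeRing -Raw-AlmostCommutative⟶
        fromCommutativeRing R
    morphism = record
      { ⟦_⟧    = ι
      ; +-homo = ι-+
      ; *-homo = ι-*
      ; -‿homo = ι-neg
      ; 0-homo = ≈-refl
      ; 1-homo = ≈-refl
      }

    _≟ι_ : (i j : ℤ) → Maybe (ι i ≈ ι j)
    i ≟ι j with i ℤP.≟ j
    ... | yes eq = just (reflexive (cong ι eq))
    ... | no _   = nothing

  open RingSolver _ (fromCommutativeRing R) morphism _≟ι_ public
    using (solve; con; _:+_; _:*_; :-_; _:-_; _:=_)

-- Rules out a field with one element, so that q - 1 can be cancelled in `T1²+Tn²`.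
pred≢0 : ∀ {n} {i j : Fin n} → i ≢ j → + n - 1ℤ ≢ 0ℤ
pred≢0 {n} {i} {j} i≢j n-1≡0 = i≢j (unique n (ℤP.+-injective (trans (lem (+ n)) (cong (_+ 1ℤ) n-1≡0)))
    i j)
  where
  lem : ∀ n → n ≡ n - 1ℤ + 1ℤ
  lem = solve-∀
  unique : ∀ n → n ≡ 1 → (i j : Fin n) → i ≡ j
  unique .1 refl zero zero = refl

module CharacterSums {q : ℕ} (K : FiniteField q) where
  open FiniteField K public

  commutativeRing : CommutativeRing 0ℓ 0ℓ
  commutativeRing = record { isCommutativeRing = isCommutativeRing }

  open CommutativeRing commutativeRing public using ()
    renaming ( +-identityˡ to ⊕-identityˡ; +-identityʳ to ⊕-identityʳ; -‿inverseʳ to ⊖-inverseʳ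
             ; *-identityˡ to ⊙-identityˡ; *-identityʳ to ⊙-identityʳ; zeroˡ to ⊙-zeroˡ; zeroʳ to
                 ⊙-zeroʳ
             ; *-assoc to ⊙-assoc; *-comm to ⊙-comm; +-comm to ⊕-comm)
  open IntegerSolver commutativeRing public
  open ≡-Reasoning

  F : Set
  F = Fin q

  private variable
    a b c t x y l r κ l′ r′ κ′ : F

  2# 4# : F
  2# = 1# ⊕ 1#
  4# = 1# ⊕ 1# ⊕ 1# ⊕ 1#

  -- To derive x ≡ y from hypotheses, one gives the coefficients of a linear combination of them;
  -- the solver then checks an identity without hypotheses.
  by-hyp : l ≡ r → x ≡ y ⊕ κ ⊙ (l ⊕ ⊖ r) → x ≡ y
  by-hyp {l} {y = y} {κ = κ} refl eq = trans eq
    (solve 3 (λ y κ l → y :+ κ :* (l :+ :- l) := y) refl y κ l)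

  by-hyps : l ≡ r → l′ ≡ r′ → x ≡ y ⊕ κ ⊙ (l ⊕ ⊖ r) ⊕ κ′ ⊙ (l′ ⊕ ⊖ r′) → x ≡ y
  by-hyps h h′ eq = by-hyp h (by-hyp h′ eq)

  ⊙-cancelˡ : a ≢ 0# → a ⊙ x ≡ a ⊙ y → x ≡ y
  ⊙-cancelˡ {a} {x} {y} a≢0 eq = by-hyps (⁻¹-inverse a≢0) eq
    (solve 4 (λ a a⁻¹ x y → x := y :+ (y :- x) :* (a :* a⁻¹ :+ :- con 1ℤ) :+ a⁻¹
        :* (a :* x :+ :- (a :* y)))
      refl a (a ⁻¹) x y)

  ⊙-zero : a ⊙ b ≡ 0# → a ≡ 0# ⊎ b ≡ 0#
  ⊙-zero {a} {b} ab≡0 with a ≟ᶠ 0#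
  ... | yes a≡0 = inj₁ a≡0
  ... | no a≢0 = inj₂ (⊙-cancelˡ a≢0 (trans ab≡0 (sym (⊙-zeroʳ a))))

  ⊙-nonzero : a ≢ 0# → b ≢ 0# → a ⊙ b ≢ 0#
  ⊙-nonzero a≢0 b≢0 ab≡0 = [ a≢0 , b≢0 ]′ (⊙-zero ab≡0)

  square-zero : x ⊙ x ≡ 0# → x ≡ 0#
  square-zero x²≡0 = [ (λ z → z) , (λ z → z) ]′ (⊙-zero x²≡0)

  4≢0 : 4# ≢ 0#
  4≢0 4≡0 = ⊙-nonzero 2≢0 2≢0 (trans (solve 0 (con (+ 2) :* con (+ 2) := con (+ 4)) refl) 4≡0)

  ⁻¹-nonzero : a ≢ 0# → a ⁻¹ ≢ 0#
  ⁻¹-nonzero {a} a≢0 a⁻¹≡0 = 1≢0 (trans (sym (⁻¹-inverse a≢0)) (trans (cong (a ⊙_) a⁻¹≡0) (⊙-zeroʳ a)))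

  ⁻¹-involutive : ∀ a → a ⁻¹ ⁻¹ ≡ a
  ⁻¹-involutive a with a ≟ᶠ 0#
  ... | yes refl = trans (cong _⁻¹ ⁻¹-zero) ⁻¹-zero
  ... | no a≢0 = ⊙-cancelˡ (⁻¹-nonzero a≢0)
    (trans (⁻¹-inverse (⁻¹-nonzero a≢0)) (sym (trans (⊙-comm _ _) (⁻¹-inverse a≢0))))

  ⊖-involutive : ∀ a → ⊖ (⊖ a) ≡ a
  ⊖-involutive = solve 1 (λ a → :- (:- a) := a) refl

  ⊖-nonzero : a ≢ 0# → ⊖ a ≢ 0#
  ⊖-nonzero {a} a≢0 eq = a≢0 (by-hyp eq (solve 1 (λ a → a := con 0ℤ :+ :- con 1ℤ
      :* (:- a :+ :- con 0ℤ)) refl a))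

  square-≡ : x ⊙ x ≡ y ⊙ y → x ≡ y ⊎ x ≡ ⊖ y
  square-≡ {x} {y} eq with ⊙-zero {x ⊕ ⊖ y} {x ⊕ y}
    (by-hyp eq (solve 2 (λ x y → (x :- y) :* (x :+ y) := con 0ℤ :+ con 1ℤ :* (x :* x :+ :- (y :* y)))
        refl x y))
  ... | inj₁ eq′ = inj₁ (by-hyp eq′ (solve 2 (λ x y → x := y :+ con 1ℤ :* ((x :- y) :+ :- con 0ℤ))
      refl x y))
  ... | inj₂ eq′ = inj₂ (by-hyp eq′ (solve 2 (λ x y → x := :- y :+ con 1ℤ :* ((x :+ y) :+ :- con 0ℤ))
      refl x y))

  ≡⊖⇒≡0 : x ≡ ⊖ x → x ≡ 0#
  ≡⊖⇒≡0 {x} eq = ⊙-cancelˡ 2≢0 (by-hyp eq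
    (solve 1 (λ x → con (+ 2) :* x := con (+ 2) :* con 0ℤ :+ con 1ℤ :* (x :+ :- (:- x))) refl x))

  -- Sums over the field and the quadratic character.

  ∑-translate : ∀ a (f : F → ℤ) → ∑ (λ x → f (x ⊕ a)) ≡ ∑ f
  ∑-translate a = ∑-reindex (_⊕ a) (_⊕ ⊖ a)
    (λ x → solve 2 (λ a x → x :+ :- a :+ a := x) refl a x)
    (λ x → solve 2 (λ a x → x :+ a :+ :- a := x) refl a x)

  ∑-scale : a ≢ 0# → (f : F → ℤ) → ∑ (λ x → f (a ⊙ x)) ≡ ∑ f
  ∑-scale {a} a≢0 = ∑-reindex (a ⊙_) (a ⁻¹ ⊙_)
    (λ x → by-hyp (⁻¹-inverse a≢0)
      (solve 3 (λ a b x → a :* (b :* x) := x :+ x :* (a :* b :+ :- con 1ℤ)) refl a (a ⁻¹) x))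
    (λ x → by-hyp (⁻¹-inverse a≢0)
      (solve 3 (λ a b x → b :* (a :* x) := x :+ x :* (a :* b :+ :- con 1ℤ)) refl a (a ⁻¹) x))

  ∑-affine : a ≢ 0# → ∀ b (f : F → ℤ) → ∑ (λ x → f (a ⊙ x ⊕ b)) ≡ ∑ f
  ∑-affine a≢0 b f = trans (∑-scale a≢0 (λ x → f (x ⊕ b))) (∑-translate b f)

  -- Indexing by the value lets a match on `χ a` together with `χ-view a` replace `χ a` by a numeral
  -- and supply the reason for it.
  data χView (a : F) : ℤ → Set where
    zero      : a ≡ 0# → χView a 0ℤ
    square    : ∀ b → b ≢ 0# → a ≡ b ⊙ b → χView a 1ℤ
    nonsquare : a ≢ 0# → (∀ b → b ⊙ b ≢ a) → χView a -1ℤ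

  abstract
    -- The nested conditional copies that of `σ`, so that `χ-if` identifies the two characters over
    -- the prime field.
    χ : F → ℤ
    χ a = if does (a ≟ᶠ 0#) then 0ℤ else if does (any? λ b → b ⊙ b ≟ᶠ a) then 1ℤ else -1ℤ

    χ-if : ∀ a → χ a ≡ (if does (a ≟ᶠ 0#) then 0ℤ else if does (any? λ b → b ⊙ b ≟ᶠ a) then 1ℤ else -1ℤ)
    χ-if a = refl

    χ-view : ∀ a → χView a (χ a)
    χ-view a with a ≟ᶠ 0# | any? (λ b → b ⊙ b ≟ᶠ a)
    ... | yes a≡0 | _ = zero a≡0
    ... | no a≢0 | yes (b , eq) = square b (λ { refl → a≢0 (trans (sym eq) (⊙-zeroˡ 0#)) }) (sym eq)
    ... | no a≢0 | no ¬sq = nonsquare a≢0 (λ b eq → ¬sq (b , eq))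

  χ-zero : a ≡ 0# → χ a ≡ 0ℤ
  χ-zero {a} a≡0 with χ a | χ-view a
  ... | _ | zero _ = refl
  ... | _ | square b b≢0 a≡b² = ⊥-elim (⊙-nonzero b≢0 b≢0 (trans (sym a≡b²) a≡0))
  ... | _ | nonsquare a≢0 _ = ⊥-elim (a≢0 a≡0)

  χ-square : b ≢ 0# → a ≡ b ⊙ b → χ a ≡ 1ℤ
  χ-square {b} {a} b≢0 a≡b² with χ a | χ-view a
  ... | _ | zero a≡0 = ⊥-elim (⊙-nonzero b≢0 b≢0 (trans (sym a≡b²) a≡0))
  ... | _ | square _ _ _ = refl
  ... | _ | nonsquare _ ¬sq = ⊥-elim (¬sq b (sym a≡b²))

  χ-nonsquare : a ≢ 0# → (∀ b → b ⊙ b ≢ a) → χ a ≡ -1ℤ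
  χ-nonsquare {a} a≢0 ¬sq with χ a | χ-view a
  ... | _ | zero a≡0 = ⊥-elim (a≢0 a≡0)
  ... | _ | square b _ eq = ⊥-elim (¬sq b (sym eq))
  ... | _ | nonsquare _ _ = refl

  χ-≤1 : ∀ a → χ a ≤ 1ℤ
  χ-≤1 a with χ a | χ-view a
  ... | _ | zero _ = +≤+ ℕ.z≤n
  ... | _ | square _ _ _ = ℤP.≤-refl
  ... | _ | nonsquare _ _ = -≤+

  δ₀ : F → ℤ
  δ₀ a = 𝟙 (a ≟ᶠ 0#)

  χ²≡1-δ₀ : ∀ a → χ a * χ a ≡ 1ℤ - δ₀ a
  χ²≡1-δ₀ a with χ a | χ-view a
  ... | _ | zero a≡0 = sym (cong (λ s → 1ℤ - s) (𝟙-yes (a ≟ᶠ 0#) a≡0))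
  ... | _ | square b b≢0 a≡b² = sym (cong (λ s → 1ℤ - s) (𝟙-no (a ≟ᶠ 0#) λ a≡0 → ⊙-nonzero b≢0 b≢0
      (trans (sym a≡b²) a≡0)))
  ... | _ | nonsquare a≢0 _ = sym (cong (λ s → 1ℤ - s) (𝟙-no (a ≟ᶠ 0#) a≢0))

  𝟙-square : b ≢ 0# → ∀ x → 𝟙 (x ⊙ x ≟ᶠ b ⊙ b) ≡ 𝟙 (x ≟ᶠ b) + 𝟙 (x ≟ᶠ ⊖ b)
  𝟙-square {b} b≢0 x with x ≟ᶠ b | x ≟ᶠ ⊖ b
  ... | yes refl | yes x≡⊖x = ⊥-elim (b≢0 (≡⊖⇒≡0 x≡⊖x))
  ... | yes refl | no ne = trans (𝟙-yes (x ⊙ x ≟ᶠ x ⊙ x) refl)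
      (sym (cong₂ _+_ (𝟙-yes (yes refl) refl) (𝟙-no (no ne) ne)))
  ... | no ne | yes eq = trans (𝟙-yes (x ⊙ x ≟ᶠ b ⊙ b) (trans (cong₂ _⊙_ eq eq)
      (solve 1 (λ b → :- b :* :- b := b :* b) refl b)))
                             (sym (cong₂ _+_ (𝟙-no (no ne) ne) (𝟙-yes (yes eq) eq)))
  ... | no ne | no ne′ = trans (𝟙-no (x ⊙ x ≟ᶠ b ⊙ b) λ eq → [ ne , ne′ ]′ (square-≡ eq))
                             (sym (cong₂ _+_ (𝟙-no (no ne) ne) (𝟙-no (no ne′) ne′)))

  ∑-roots : ∀ a → ∑ (λ x → 𝟙 (x ⊙ x ≟ᶠ a)) ≡ 1ℤ + χ a
  ∑-roots a with χ a | χ-view a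
  ... | _ | zero refl = trans (∑-cong λ x → 𝟙-cong _ (x ≟ᶠ 0#) square-zero (λ { refl → ⊙-zeroˡ 0# }))
      (∑-δ-one 0#)
  ... | _ | square b b≢0 refl = trans (∑-cong (𝟙-square b≢0))
    (trans (∑-+ (λ x → 𝟙 (x ≟ᶠ b)) _) (cong₂ _+_ (∑-δ-one b) (∑-δ-one (⊖ b))))
  ... | _ | nonsquare _ ¬sq = ∑-zero λ x → 𝟙-no (x ⊙ x ≟ᶠ a) (¬sq x)

  -- Each u has `1 + χ u` square roots, so grouping the x by u = x² weights `f u` by this number.
  -- This is how quartics in x become quadratics in u.
  ∑-square : (f : F → ℤ) → ∑ (λ x → f (x ⊙ x)) ≡ ∑ (λ u → (1ℤ + χ u) * f u)
  ∑-square f = begin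
    ∑ (λ x → f (x ⊙ x))
      ≡⟨ ∑-cong (λ x → sym (∑-δ (x ⊙ x) f)) ⟩
    ∑ (λ x → ∑ λ u → 𝟙 (u ≟ᶠ x ⊙ x) * f u)
      ≡⟨ ∑-comm _ ⟩
    ∑ (λ u → ∑ λ x → 𝟙 (u ≟ᶠ x ⊙ x) * f u)
      ≡⟨ ∑-cong (λ u → trans (∑-*ʳ (f u) _) (cong (_* f u)
           (trans (∑-cong λ x → 𝟙-cong _ (x ⊙ x ≟ᶠ u) sym sym) (∑-roots u)))) ⟩
    ∑ (λ u → (1ℤ + χ u) * f u) ∎

  -- `∑-square` for the constant 1 counts the field as ∑ 1 + ∑ χ; the second summand must vanish.
  ∑χ≡0 : ∑ χ ≡ 0ℤ
  ∑χ≡0 = +-cancelˡ-≡ (∑ {q} λ _ → 1ℤ) _ _ (begin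
    ∑ {q} (λ _ → 1ℤ) + ∑ χ               ≡⟨ ∑-+ _ _ ⟨
    ∑ (λ u → 1ℤ + χ u)                   ≡⟨ ∑-cong (λ u → ℤP.*-identityʳ (1ℤ + χ u)) ⟨
    ∑ (λ u → (1ℤ + χ u) * 1ℤ)            ≡⟨ ∑-square (λ _ → 1ℤ) ⟨
    ∑ {q} (λ _ → 1ℤ)                     ≡⟨ ℤP.+-identityʳ _ ⟨
    ∑ {q} (λ _ → 1ℤ) + 0ℤ ∎)

  χ-square-⊙ : c ≢ 0# → ∀ b → χ (c ⊙ c ⊙ b) ≡ χ b
  χ-square-⊙ {c} c≢0 b with χ b | χ-view b
  ... | _ | zero refl = χ-zero (⊙-zeroʳ _)
  ... | _ | square d d≢0 refl = χ-square (⊙-nonzero c≢0 d≢0)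
    (solve 2 (λ c d → c :* c :* (d :* d) := c :* d :* (c :* d)) refl c d)
  ... | _ | nonsquare b≢0 ¬sq = χ-nonsquare (⊙-nonzero (⊙-nonzero c≢0 c≢0) b≢0) λ d d²≡c²b →
    ¬sq (d ⊙ c ⁻¹) (⊙-cancelˡ (⊙-nonzero c≢0 c≢0) (by-hyps (⁻¹-inverse c≢0) d²≡c²b
      (solve 4 (λ c c⁻¹ d b → c :* c :* (d :* c⁻¹ :* (d :* c⁻¹)) := c :* c :* b
         :+ d :* d :* (c :* c⁻¹ :+ con 1ℤ) :* (c :* c⁻¹ :+ :- con 1ℤ) :+ con 1ℤ
             :* (d :* d :+ :- (c :* c :* b)))
         refl c (c ⁻¹) d b)))

  -- For a nonsquare a, the terms χ (a b) + χ b sum to zero over b and none is positive.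
  χ-⊙ : ∀ a b → χ (a ⊙ b) ≡ χ a * χ b
  χ-⊙ a b with χ a | χ-view a
  ... | _ | zero refl = χ-zero (⊙-zeroˡ b)
  ... | _ | square c c≢0 refl = trans (χ-square-⊙ c≢0 b) (sym (ℤP.*-identityˡ (χ b)))
  ... | _ | nonsquare a≢0 ¬sq = trans (move (χ (a ⊙ b)) (χ b) (∑-nonpositive-zero g g≤0 ∑g≡0 b))
      (sym (ℤP.-1*i≡-i (χ b)))
    where
    move : ∀ m n → m + n ≡ 0ℤ → m ≡ - n
    move m n eq = trans (lem m n) (trans (cong (_- n) eq) (ℤP.+-identityˡ (- n)))
      where
      lem : ∀ m n → m ≡ m + n - n
      lem = solve-∀
    g : F → ℤ
    g b = χ (a ⊙ b) + χ b
    ∑g≡0 : ∑ g ≡ 0ℤ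
    ∑g≡0 = trans (∑-+ _ _) (cong₂ _+_ (trans (∑-scale a≢0 χ) ∑χ≡0) ∑χ≡0)
    χ[ac²]≡-1 : c ≢ 0# → χ (a ⊙ (c ⊙ c)) ≡ -1ℤ
    χ[ac²]≡-1 c≢0 = trans (cong χ (⊙-comm _ _)) (trans (χ-square-⊙ c≢0 a) (χ-nonsquare a≢0 ¬sq))
    g≤0 : ∀ b → g b ≤ 0ℤ
    g≤0 b with χ b | χ-view b
    ... | _ | zero refl = ℤP.≤-reflexive (cong (_+ 0ℤ) (χ-zero (⊙-zeroʳ a)))
    ... | _ | square c c≢0 refl = ℤP.≤-reflexive (cong (_+ 1ℤ) (χ[ac²]≡-1 c≢0))
    ... | _ | nonsquare _ _ = ℤP.+-monoˡ-≤ -1ℤ (χ-≤1 (a ⊙ b))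

  χ-one : χ 1# ≡ 1ℤ
  χ-one = χ-square 1≢0 (sym (⊙-identityˡ 1#))

  χ-four : χ 4# ≡ 1ℤ
  χ-four = χ-square 2≢0 (solve 0 (con (+ 4) := con (+ 2) :* con (+ 2)) refl)

  ∑-linear : a ≢ 0# → ∀ b → ∑ (λ x → 𝟙 (a ⊙ x ≟ᶠ b)) ≡ 1ℤ
  ∑-linear a≢0 b = trans (∑-scale a≢0 (λ y → 𝟙 (y ≟ᶠ b))) (∑-δ-one b)

  ∑-δ₀ : (f : F → ℤ) → ∑ (λ x → δ₀ x * f x) ≡ f 0#
  ∑-δ₀ = ∑-δ 0#

  ∑χ² : ∑ (λ x → χ x * χ x) ≡ + q - 1ℤ
  ∑χ² = trans (∑-cong χ²≡1-δ₀) (trans (∑-minus _ _)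
    (cong₂ _-_ (trans (∑-const q 1ℤ) (ℤP.*-identityʳ (+ q))) (∑-δ-one 0#)))

  -- The substitution u = r + t turns u² = t² + k into r (2 t + r) = k, which is linear in t.
  ∑χ-square-shift-nonzero : ∀ {k} → k ≢ 0# → ∑ (λ t → χ (t ⊙ t ⊕ k)) ≡ -1ℤ
  ∑χ-square-shift-nonzero {k} k≢0 = +-cancelˡ-≡ (+ q) _ _ (begin
    + q + ∑ (λ t → χ (t ⊙ t ⊕ k))
      ≡⟨ cong (_+ ∑ λ t → χ (t ⊙ t ⊕ k)) (trans (∑-const q 1ℤ) (ℤP.*-identityʳ (+ q))) ⟨
    ∑ {q} (λ _ → 1ℤ) + ∑ (λ t → χ (t ⊙ t ⊕ k))
      ≡⟨ ∑-+ _ _ ⟨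
    ∑ (λ t → 1ℤ + χ (t ⊙ t ⊕ k))
      ≡⟨ ∑-cong (λ t → trans (sym (∑-roots (t ⊙ t ⊕ k))) (sym
          (∑-translate t λ u → 𝟙 (u ⊙ u ≟ᶠ t ⊙ t ⊕ k)))) ⟩
    ∑ (λ t → ∑ λ r → 𝟙 ((r ⊕ t) ⊙ (r ⊕ t) ≟ᶠ t ⊙ t ⊕ k))
      ≡⟨ ∑-comm _ ⟩
    ∑ (λ r → ∑ λ t → 𝟙 ((r ⊕ t) ⊙ (r ⊕ t) ≟ᶠ t ⊙ t ⊕ k))
      ≡⟨ ∑-cong inner ⟩
    ∑ (λ r → 1ℤ - δ₀ r)
      ≡⟨ trans (∑-minus _ _) (cong₂ _-_ (trans (∑-const q 1ℤ) (ℤP.*-identityʳ (+ q))) (∑-δ-one 0#)) ⟩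
    + q - 1ℤ ∎)
    where
    inner : ∀ r → ∑ (λ t → 𝟙 ((r ⊕ t) ⊙ (r ⊕ t) ≟ᶠ t ⊙ t ⊕ k)) ≡ 1ℤ - δ₀ r
    inner r with r ≟ᶠ 0#
    ... | yes refl = trans
      (∑-zero λ t → 𝟙-no _ λ eq → k≢0 (sym (by-hyp eq
        (solve 2 (λ t k → con 0ℤ := k :+ con 1ℤ :* ((con 0ℤ :+ t) :* (con 0ℤ :+ t)
            :+ :- (t :* t :+ k))) refl t k))))
      (sym (cong (λ s → 1ℤ - s) (𝟙-yes (yes refl) refl)))
    ... | no r≢0 = trans
      (∑-cong λ t → 𝟙-cong _ (2# ⊙ r ⊙ t ≟ᶠ k ⊕ ⊖ (r ⊙ r))
        (λ eq → by-hyp eq (solve 3 (λ r t k → con (+ 2) :* r :* t := (k :+ :- (r :* r)) :+ con 1ℤ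
            :* ((r :+ t) :* (r :+ t) :+ :- (t :* t :+ k))) refl r t k))
        (λ eq → by-hyp eq (solve 3 (λ r t k → (r :+ t) :* (r :+ t) := (t :* t :+ k) :+ con 1ℤ
            :* (con (+ 2) :* r :* t :+ :- (k :+ :- (r :* r)))) refl r t k)))
      (trans (∑-linear (⊙-nonzero 2≢0 r≢0) _) (sym (cong (λ s → 1ℤ - s) (𝟙-no (no r≢0) r≢0))))

  ∑χ-square-shift : ∀ k → ∑ (λ t → χ (t ⊙ t ⊕ k)) ≡ -1ℤ + + q * δ₀ k
  ∑χ-square-shift k with k ≟ᶠ 0#
  ... | yes refl = begin
    ∑ (λ t → χ (t ⊙ t ⊕ 0#)) ≡⟨ ∑-cong (λ t → trans (cong χ (⊕-identityʳ (t ⊙ t))) (χ-⊙ t t)) ⟩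
    ∑ (λ t → χ t * χ t)      ≡⟨ ∑χ² ⟩
    + q - 1ℤ                 ≡⟨ lem (+ q) ⟩
    -1ℤ + + q * 1ℤ           ≡⟨ cong (λ s → -1ℤ + + q * s) (𝟙-yes (yes refl) refl) ⟨
    -1ℤ + + q * 𝟙 (yes refl) ∎
    where
    lem : ∀ n → n - 1ℤ ≡ -1ℤ + n * 1ℤ
    lem = solve-∀
  ... | no k≢0 = trans (∑χ-square-shift-nonzero k≢0)
    (sym (trans (cong (λ s → -1ℤ + + q * s) (𝟙-no (no k≢0) k≢0))
        (cong (λ s → -1ℤ + s) (ℤP.*-zeroʳ (+ q)))))

  δ₀-⊙ : a ≢ 0# → ∀ b → δ₀ (a ⊙ b) ≡ δ₀ b
  δ₀-⊙ a≢0 b = 𝟙-cong _ _ (λ eq → [ (λ a≡0 → ⊥-elim (a≢0 a≡0)) , (λ b≡0 → b≡0) ]′ (⊙-zero eq)) (λ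
      { refl → ⊙-zeroʳ _ })

  δ₀-yes : a ≡ 0# → δ₀ a ≡ 1ℤ
  δ₀-yes = 𝟙-yes (_ ≟ᶠ 0#)

  δ₀-no : a ≢ 0# → δ₀ a ≡ 0ℤ
  δ₀-no = 𝟙-no (_ ≟ᶠ 0#)

  -- The term with `δ₀ b` corrects the case of a multiple of t², the term with `δ₀ a` that of a
  -- constant summand. One formula has to cover all cases because a and b will be `disc x y` and a
  -- multiple of `sq x y`, which vanish at some points.
  ∑χ-quadratic : ∀ a b → ∑ (λ t → χ (a ⊙ (t ⊙ t) ⊕ b)) ≡ - χ a + + q * (χ a * δ₀ b) + + q * (χ b * δ₀ a)
  ∑χ-quadratic a b with a ≟ᶠ 0#
  ... | yes a≡0 = begin
    ∑ (λ t → χ (a ⊙ (t ⊙ t) ⊕ b)) ≡⟨ ∑-cong (λ t → cong χ (trans (cong (λ s → s ⊙ (t ⊙ t) ⊕ b) a≡0)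
                                      (trans (cong (_⊕ b) (⊙-zeroˡ (t ⊙ t))) (⊕-identityˡ b)))) ⟩
    ∑ {q} (λ _ → χ b)             ≡⟨ ∑-const q (χ b) ⟩
    + q * χ b                     ≡⟨ lem (+ q) (χ b) (δ₀ b) ⟩
    - 0ℤ + + q * (0ℤ * δ₀ b) + + q * (χ b * 1ℤ)
      ≡⟨ cong₂ (λ s d → - s + + q * (s * δ₀ b) + + q * (χ b * d)) (χ-zero a≡0) (𝟙-yes (yes a≡0) a≡0) ⟨
    - χ a + + q * (χ a * δ₀ b) + + q * (χ b * 𝟙 (yes a≡0)) ∎
    where
    lem : ∀ n m d → n * m ≡ - 0ℤ + n * (0ℤ * d) + n * (m * 1ℤ)
    lem = solve-∀
  ... | no a≢0 = begin
    ∑ (λ t → χ (a ⊙ (t ⊙ t) ⊕ b))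
      ≡⟨ ∑-cong (λ t → trans (cong χ (by-hyp (⁻¹-inverse a≢0)
           (solve 4 (λ a a⁻¹ b t → a :* (t :* t) :+ b := a :* (t :* t :+ a⁻¹ :* b) :+ :- b
               :* (a :* a⁻¹ :+ :- con 1ℤ)) refl a (a ⁻¹) b t)))
           (χ-⊙ a (t ⊙ t ⊕ a ⁻¹ ⊙ b))) ⟩
    ∑ (λ t → χ a * χ (t ⊙ t ⊕ a ⁻¹ ⊙ b))
      ≡⟨ trans (∑-*ˡ (χ a) _) (cong (χ a *_) (∑χ-square-shift (a ⁻¹ ⊙ b))) ⟩
    χ a * (-1ℤ + + q * δ₀ (a ⁻¹ ⊙ b))
      ≡⟨ cong (λ s → χ a * (-1ℤ + + q * s)) (δ₀-⊙ (⁻¹-nonzero a≢0) b) ⟩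
    χ a * (-1ℤ + + q * δ₀ b)
      ≡⟨ lem (χ a) (+ q) (χ b) (δ₀ b) ⟩
    - χ a + + q * (χ a * δ₀ b) + + q * (χ b * 0ℤ)
      ≡⟨ cong (λ d → - χ a + + q * (χ a * δ₀ b) + + q * (χ b * d)) (𝟙-no (no a≢0) a≢0) ⟨
    - χ a + + q * (χ a * δ₀ b) + + q * (χ b * 𝟙 (no a≢0)) ∎
    where
    lem : ∀ s n m d → s * (-1ℤ + n * d) ≡ - s + n * (s * d) + n * (m * 0ℤ)
    lem = solve-∀

  -- Completing the square: 4 a (a + k) = (2 a + k)² - k², and χ ignores the factor 4.
  ∑χ-product-shift : ∀ k → ∑ (λ a → χ a * χ (a ⊕ k)) ≡ -1ℤ + + q * δ₀ k
  ∑χ-product-shift k = begin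
    ∑ (λ a → χ a * χ (a ⊕ k))
      ≡⟨ ∑-cong (λ a → trans (sym (χ-⊙ a (a ⊕ k))) (trans (sym (χ-square-⊙ 2≢0 (a ⊙ (a ⊕ k)))) (cong χ
           (solve 2 (λ a k → con (+ 2) :* con (+ 2) :* (a :* (a :+ k)) := (con (+ 2) :* a :+ k)
               :* (con (+ 2) :* a :+ k) :+ :- k :* k) refl a k)))) ⟩
    ∑ (λ a → χ ((2# ⊙ a ⊕ k) ⊙ (2# ⊙ a ⊕ k) ⊕ (⊖ k) ⊙ k))
      ≡⟨ ∑-affine 2≢0 k (λ t → χ (t ⊙ t ⊕ (⊖ k) ⊙ k)) ⟩
    ∑ (λ t → χ (t ⊙ t ⊕ (⊖ k) ⊙ k))
      ≡⟨ ∑χ-square-shift ((⊖ k) ⊙ k) ⟩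
    -1ℤ + + q * δ₀ ((⊖ k) ⊙ k)
      ≡⟨ cong (λ s → -1ℤ + + q * s) (𝟙-cong _ (k ≟ᶠ 0#)
           (λ eq → square-zero (by-hyp eq (solve 1 (λ k → k :* k := con 0ℤ :+ :- con 1ℤ
               :* (:- k :* k :+ :- con 0ℤ)) refl k)))
           (λ { refl → ⊙-zeroʳ _ })) ⟩
    -1ℤ + + q * δ₀ k ∎

  -- For a ≠ 0, multiplication by a turns the equation into (a z)² = a b, which has `1 + χ (a ⊙ b)`
  -- roots; for a = 0 either every z is a root or none is.
  ∑-pure-quadratic : ∀ a b → ∑ (λ z → 𝟙 (a ⊙ (z ⊙ z) ≟ᶠ b)) ≡ 1ℤ - δ₀ a + χ (a ⊙ b) + + q
      * (δ₀ a * δ₀ b)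
  ∑-pure-quadratic a b with a ≟ᶠ 0#
  ... | yes refl = begin
    ∑ (λ z → 𝟙 (0# ⊙ (z ⊙ z) ≟ᶠ b))
      ≡⟨ ∑-cong (λ z → 𝟙-cong _ (b ≟ᶠ 0#) (λ eq → trans (sym eq) (⊙-zeroˡ _)) (λ eq →
          trans (⊙-zeroˡ _) (sym eq))) ⟩
    ∑ {q} (λ _ → δ₀ b)
      ≡⟨ ∑-const q (δ₀ b) ⟩
    + q * δ₀ b
      ≡⟨ lem (+ q) (δ₀ b) ⟩
    1ℤ - 1ℤ + 0ℤ + + q * (1ℤ * δ₀ b)
      ≡⟨ cong₂ (λ d s → 1ℤ - d + s + + q * (d * δ₀ b)) (𝟙-yes (yes refl) refl) (χ-zero (⊙-zeroˡ b)) ⟨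
    1ℤ - 𝟙 (yes refl) + χ (0# ⊙ b) + + q * (𝟙 (yes refl) * δ₀ b) ∎
    where
    lem : ∀ n d → n * d ≡ 1ℤ - 1ℤ + 0ℤ + n * (1ℤ * d)
    lem = solve-∀
  ... | no a≢0 = begin
    ∑ (λ z → 𝟙 (a ⊙ (z ⊙ z) ≟ᶠ b))
      ≡⟨ ∑-cong (λ z → 𝟙-cong _ (a ⊙ z ⊙ (a ⊙ z) ≟ᶠ a ⊙ b)
           (λ eq → by-hyp eq (solve 3 (λ a z b → a :* z :* (a :* z) := a :* b :+ a
               :* (a :* (z :* z) :+ :- b)) refl a z b))
           (λ eq → ⊙-cancelˡ a≢0 (by-hyp eq (solve 3 (λ a z b → a :* (a :* (z :* z)) := a :* b
               :+ con 1ℤ :* (a :* z :* (a :* z) :+ :- (a :* b))) refl a z b)))) ⟩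
    ∑ (λ z → 𝟙 (a ⊙ z ⊙ (a ⊙ z) ≟ᶠ a ⊙ b))
      ≡⟨ ∑-scale a≢0 (λ z → 𝟙 (z ⊙ z ≟ᶠ a ⊙ b)) ⟩
    ∑ (λ z → 𝟙 (z ⊙ z ≟ᶠ a ⊙ b))
      ≡⟨ ∑-roots (a ⊙ b) ⟩
    1ℤ + χ (a ⊙ b)
      ≡⟨ lem (+ q) (δ₀ b) (χ (a ⊙ b)) ⟩
    1ℤ - 0ℤ + χ (a ⊙ b) + + q * (0ℤ * δ₀ b)
      ≡⟨ cong (λ d → 1ℤ - d + χ (a ⊙ b) + + q * (d * δ₀ b)) (𝟙-no (no a≢0) a≢0) ⟨
    1ℤ - 𝟙 (no a≢0) + χ (a ⊙ b) + + q * (𝟙 (no a≢0) * δ₀ b) ∎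
    where
    lem : ∀ n d s → 1ℤ + s ≡ 1ℤ - 0ℤ + s + n * (0ℤ * d)
    lem = solve-∀

  -- Completing the square: four times the equation reads (2 t - k)² = k² - 4 s.
  ∑-monic-quadratic : ∀ k s → ∑ (λ t → 𝟙 (s ⊕ t ⊙ t ≟ᶠ k ⊙ t)) ≡ 1ℤ + χ (k ⊙ k ⊕ ⊖ (4# ⊙ s))
  ∑-monic-quadratic k s = begin
    ∑ (λ t → 𝟙 (s ⊕ t ⊙ t ≟ᶠ k ⊙ t))
      ≡⟨ ∑-cong (λ t → 𝟙-cong _ ((2# ⊙ t ⊕ ⊖ k) ⊙ (2# ⊙ t ⊕ ⊖ k) ≟ᶠ k ⊙ k ⊕ ⊖ (4# ⊙ s))
           (λ eq → by-hyp eq (solve 3 (λ k s t → (con (+ 2) :* t :+ :- k) :* (con (+ 2) :* t :+ :- k)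
              := (k :* k :+ :- (con (+ 4) :* s)) :+ con (+ 4) :* ((s :+ t :* t) :+ :- (k :* t)))
                  refl k s t))
           (λ eq → ⊙-cancelˡ 4≢0 (by-hyp eq (solve 3 (λ k s t → con (+ 4) :* (s :+ t :* t)
              := con (+ 4) :* (k :* t) :+ con 1ℤ :* ((con (+ 2) :* t :+ :- k)
                  :* (con (+ 2) :* t :+ :- k) :+ :- (k :* k :+ :- (con (+ 4) :* s)))) refl k s t)))) ⟩
    ∑ (λ t → 𝟙 ((2# ⊙ t ⊕ ⊖ k) ⊙ (2# ⊙ t ⊕ ⊖ k) ≟ᶠ k ⊙ k ⊕ ⊖ (4# ⊙ s)))
      ≡⟨ ∑-affine 2≢0 (⊖ k) (λ t → 𝟙 (t ⊙ t ≟ᶠ k ⊙ k ⊕ ⊖ (4# ⊙ s))) ⟩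
    ∑ (λ t → 𝟙 (t ⊙ t ≟ᶠ k ⊙ k ⊕ ⊖ (4# ⊙ s)))
      ≡⟨ ∑-roots _ ⟩
    1ℤ + χ (k ⊙ k ⊕ ⊖ (4# ⊙ s)) ∎

  -- The sums T(a) and Jacobsthal's identity.

  η : ℤ
  η = χ (⊖ 1#)

  χ-⊖ : ∀ a → χ (⊖ a) ≡ η * χ a
  χ-⊖ a = trans (cong χ (solve 1 (λ a → :- a := :- con 1ℤ :* a) refl a)) (χ-⊙ (⊖ 1#) a)

  χ-square² : a ≢ 0# → χ a * χ a ≡ 1ℤ
  χ-square² {a} a≢0 = trans (χ²≡1-δ₀ a) (cong (λ s → 1ℤ - s) (δ₀-no a≢0))

  χ-cube : ∀ a → χ a * (χ a * χ a) ≡ χ a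
  χ-cube a with χ a | χ-view a
  ... | _ | zero _ = refl
  ... | _ | square _ _ _ = refl
  ... | _ | nonsquare _ _ = refl

  -- A Jacobsthal sum: χ of u³ + a u summed over u, the character sum attached to the curve v² = u³
  -- + a u.
  T : F → ℤ
  T a = ∑ λ u → χ u * χ (u ⊙ u ⊕ a)

  -- Substituting t u for u draws χ t from the first factor and t², invisible to χ, from the second.
  -- Up to sign, T thus depends only on the class of its argument modulo nonzero squares.
  T-square-⊙ : t ≢ 0# → ∀ a → T (t ⊙ t ⊙ a) ≡ χ t * T a
  T-square-⊙ {t} t≢0 a = begin
    ∑ (λ u → χ u * χ (u ⊙ u ⊕ t ⊙ t ⊙ a))
      ≡⟨ ∑-scale t≢0 (λ u → χ u * χ (u ⊙ u ⊕ t ⊙ t ⊙ a)) ⟨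
    ∑ (λ u → χ (t ⊙ u) * χ (t ⊙ u ⊙ (t ⊙ u) ⊕ t ⊙ t ⊙ a))
      ≡⟨ ∑-cong (λ u → trans (cong₂ _*_ (χ-⊙ t u)
           (trans (cong χ (solve 3 (λ t u a → t :* u :* (t :* u) :+ t :* t :* a := t :* t
               :* (u :* u :+ a)) refl t u a)) (χ-square-⊙ t≢0 (u ⊙ u ⊕ a))))
           (ℤP.*-assoc (χ t) (χ u) (χ (u ⊙ u ⊕ a)))) ⟩
    ∑ (λ u → χ t * (χ u * χ (u ⊙ u ⊕ a)))
      ≡⟨ ∑-*ˡ (χ t) _ ⟩
    χ t * T a ∎

  T-zero : T 0# ≡ 0ℤ
  T-zero = trans (∑-cong λ u → trans (cong (χ u *_) (trans (cong χ (⊕-identityʳ (u ⊙ u))) (χ-⊙ u u)))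
      (χ-cube u)) ∑χ≡0

  T-square : ∀ w → T (w ⊙ w) ≡ χ w * T 1#
  T-square w with w ≟ᶠ 0#
  ... | yes refl = trans (cong T (⊙-zeroˡ 0#)) (trans T-zero
      (sym (trans (cong (_* T 1#) (χ-zero refl)) (ℤP.*-zeroˡ (T 1#)))))
  ... | no w≢0 = trans (cong T (sym (⊙-identityʳ (w ⊙ w)))) (T-square-⊙ w≢0 1#)

  T-odd : η ≡ -1ℤ → ∀ a → T a ≡ 0ℤ
  T-odd η≡-1 a = lem (T a) (begin
    T a ≡⟨ cong T (solve 1 (λ a → a := :- con 1ℤ :* :- con 1ℤ :* a) refl a) ⟩
    T ((⊖ 1#) ⊙ (⊖ 1#) ⊙ a) ≡⟨ T-square-⊙ (⊖-nonzero 1≢0) a ⟩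
    η * T a ≡⟨ trans (cong (_* T a) η≡-1) (ℤP.-1*i≡-i (T a)) ⟩
    - T a ∎)
    where
    lem : ∀ i → i ≡ - i → i ≡ 0ℤ
    lem (+ ℕ.zero) _ = refl
    lem (+ ℕ.suc n) ()
    lem -[1+ n ] ()

  -- Of two inserted factors `χ c`, whose product is 1, one combines with `χ u`, so that the
  -- remaining summand depends on `c ⊙ u` only.
  ∑-scaled-T : c ≢ 0# → ∀ b → ∑ (λ u → χ u * χ (c ⊙ c ⊙ (u ⊙ u) ⊕ b)) ≡ χ c * T b
  ∑-scaled-T {c} c≢0 b = begin
    ∑ (λ u → χ u * χ (c ⊙ c ⊙ (u ⊙ u) ⊕ b))
      ≡⟨ ∑-cong (λ u → begin
           χ u * χ (c ⊙ c ⊙ (u ⊙ u) ⊕ b)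
             ≡⟨ ℤP.*-identityˡ _ ⟨
           1ℤ * (χ u * χ (c ⊙ c ⊙ (u ⊙ u) ⊕ b))
             ≡⟨ cong (_* (χ u * χ (c ⊙ c ⊙ (u ⊙ u) ⊕ b))) (χ-square² c≢0) ⟨
           χ c * χ c * (χ u * χ (c ⊙ c ⊙ (u ⊙ u) ⊕ b))
             ≡⟨ lem (χ c) (χ u) _ ⟩
           χ c * (χ c * χ u * χ (c ⊙ c ⊙ (u ⊙ u) ⊕ b))
             ≡⟨ cong₂ (λ r s → χ c * (r * χ s)) (sym (χ-⊙ c u))
                  (solve 3 (λ c u b → c :* c :* (u :* u) :+ b := c :* u :* (c :* u) :+ b) refl c u b) ⟩
           χ c * (χ (c ⊙ u) * χ (c ⊙ u ⊙ (c ⊙ u) ⊕ b)) ∎) ⟩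
    ∑ (λ u → χ c * (χ (c ⊙ u) * χ (c ⊙ u ⊙ (c ⊙ u) ⊕ b)))
      ≡⟨ ∑-*ˡ (χ c) _ ⟩
    χ c * ∑ (λ u → χ (c ⊙ u) * χ (c ⊙ u ⊙ (c ⊙ u) ⊕ b))
      ≡⟨ cong (χ c *_) (∑-scale c≢0 (λ u → χ u * χ (u ⊙ u ⊕ b))) ⟩
    χ c * T b ∎
    where
    lem : ∀ r s t → r * r * (s * t) ≡ r * (r * s * t)
    lem = solve-∀

  T-four : T 4# ≡ χ 2# * T 1#
  T-four = trans (cong T (solve 0 (con (+ 4) := con (+ 2) :* con (+ 2)) refl)) (T-square 2#)

  -- The square is (1 + i)² = 2 i, and 1 + i is nonzero because (1 + i)(1 - i) = 2.
  χ-2i : ∀ i → i ⊙ i ≡ ⊖ 1# → χ (2# ⊙ i) ≡ 1ℤ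
  χ-2i i i²≡-1 = χ-square {b = 1# ⊕ i} 1+i≢0 (by-hyp i²≡-1 (solve 1 (λ i → con (+ 2) :* i
      := (con 1ℤ :+ i) :* (con 1ℤ :+ i) :+ :- con 1ℤ :* (i :* i :+ :- (:- con 1ℤ))) refl i))
    where
    1+i≢0 : 1# ⊕ i ≢ 0#
    1+i≢0 eq = 2≢0 (by-hyps i²≡-1 eq (solve 1 (λ i → con (+ 2) := con 0ℤ
      :+ con 1ℤ :* (i :* i :+ :- (:- con 1ℤ)) :+ (con 1ℤ :+ :- i) :* ((con 1ℤ :+ i) :+ :- con 0ℤ))
          refl i))

  -- Here -4 = (2 i)², and χ (2 i) = 1, so `T-square` introduces no sign.
  T-⊖four : ∀ i → i ⊙ i ≡ ⊖ 1# → T (⊖ 4#) ≡ T 1#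
  T-⊖four i i²≡-1 = trans (cong T (by-hyp i²≡-1 (solve
      1 (λ i → :- con (+ 4) := con (+ 2) :* i :* (con (+ 2) :* i) :+ :- con (+ 4)
      :* (i :* i :+ :- (:- con 1ℤ))) refl i)))
    (trans (T-square (2# ⊙ i)) (trans (cong (_* T 1#) (χ-2i i i²≡-1)) (ℤP.*-identityˡ (T 1#))))

  q-1≢0 : + q - 1ℤ ≢ 0ℤ
  q-1≢0 = pred≢0 1≢0

  ∑-*-∑ : (f g : F → ℤ) → ∑ f * ∑ g ≡ ∑ (λ v → ∑ λ w → f v * g w)
  ∑-*-∑ f g = trans (sym (∑-*ʳ (∑ g) f)) (∑-cong λ v → sym (∑-*ˡ (f v) g))

  -- For v ≠ 0 the roots w = v and w = -v contribute `χ v` and `η * χ v`; for v = 0 both sides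
  -- vanish.
  𝟙-square-χ : ∀ v → ∑ (λ w → 𝟙 (w ⊙ w ≟ᶠ v ⊙ v) * χ w) ≡ (1ℤ + η) * χ v
  𝟙-square-χ v with v ≟ᶠ 0#
  ... | yes refl = trans (∑-𝟙-const (λ w → w ⊙ w ≟ᶠ 0# ⊙ 0#) 0ℤ λ w eq → χ-zero
      (square-zero (trans eq (⊙-zeroˡ 0#))))
    (trans (ℤP.*-zeroʳ (∑ λ w → 𝟙 (w ⊙ w ≟ᶠ 0# ⊙ 0#))) (sym
        (trans (cong ((1ℤ + η) *_) (χ-zero refl)) (ℤP.*-zeroʳ (1ℤ + η)))))
  ... | no v≢0 = begin
    ∑ (λ w → 𝟙 (w ⊙ w ≟ᶠ v ⊙ v) * χ w)
      ≡⟨ trans (∑-cong λ w → trans (cong (_* χ w) (𝟙-square v≢0 w))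
          (ℤP.*-distribʳ-+ (χ w) (𝟙 (w ≟ᶠ v)) (𝟙 (w ≟ᶠ ⊖ v)))) (∑-+ _ _) ⟩
    ∑ (λ w → 𝟙 (w ≟ᶠ v) * χ w) + ∑ (λ w → 𝟙 (w ≟ᶠ ⊖ v) * χ w)
      ≡⟨ cong₂ _+_ (∑-δ v χ) (trans (∑-δ (⊖ v) χ) (χ-⊖ v)) ⟩
    χ v + η * χ v
      ≡⟨ lem (χ v) η ⟩
    (1ℤ + η) * χ v ∎
    where
    lem : ∀ s e → s + e * s ≡ (1ℤ + e) * s
    lem = solve-∀

  -- With the square expanded over v and w, the sum over a correlates two shifted characters: it is
  -- q - 1 if w² = v² and -1 otherwise. The constant -1 contributes a multiple of (∑ χ)² = 0, so
  -- only w = ±v survives.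
  ∑-T² : ∑ (λ a → T a * T a) ≡ + q * ((1ℤ + η) * (+ q - 1ℤ))
  ∑-T² = begin
    ∑ (λ a → T a * T a)
      ≡⟨ ∑-cong (λ a → ∑-*-∑ (λ v → χ v * χ (v ⊙ v ⊕ a)) (λ w → χ w * χ (w ⊙ w ⊕ a))) ⟩
    ∑ (λ a → ∑ λ v → ∑ λ w → χ v * χ (v ⊙ v ⊕ a) * (χ w * χ (w ⊙ w ⊕ a)))
      ≡⟨ trans (∑-comm _) (∑-cong λ v → ∑-comm _) ⟩
    ∑ (λ v → ∑ λ w → ∑ λ a → χ v * χ (v ⊙ v ⊕ a) * (χ w * χ (w ⊙ w ⊕ a)))
      ≡⟨ ∑-cong₂ (λ v w → trans (∑-cong λ a → lem₁ (χ v) (χ (v ⊙ v ⊕ a)) (χ w) (χ (w ⊙ w ⊕ a)))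
           (trans (∑-*ˡ (χ v * χ w) _) (cong (χ v * χ w *_) (correlation v w)))) ⟩
    ∑ (λ v → ∑ λ w → χ v * χ w * (-1ℤ + + q * 𝟙 (w ⊙ w ≟ᶠ v ⊙ v)))
      ≡⟨ trans (∑-cong₂ λ v w → lem₂ (χ v) (χ w) (+ q) (𝟙 (w ⊙ w ≟ᶠ v ⊙ v))) (∑²-minus _ _) ⟩
    ∑ (λ v → ∑ λ w → + q * (χ v * (𝟙 (w ⊙ w ≟ᶠ v ⊙ v) * χ w))) - ∑ (λ v → ∑ λ w → χ v * χ w)
      ≡⟨ cong₂ _-_
           (trans (∑²-* (+ q) _) (cong (+ q *_) (trans (∑-cong λ v → trans (∑-*ˡ (χ v) _)
              (trans (cong (χ v *_) (𝟙-square-χ v)) (lem₃ (χ v) η)))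
                  (trans (∑-*ˡ (1ℤ + η) _) (cong ((1ℤ + η) *_) ∑χ²)))))
           (trans (sym (∑-*-∑ χ χ)) (cong (_* ∑ χ) ∑χ≡0)) ⟩
    + q * ((1ℤ + η) * (+ q - 1ℤ)) - 0ℤ
      ≡⟨ lem₄ _ ⟩
    + q * ((1ℤ + η) * (+ q - 1ℤ)) ∎
    where
    lem₁ : ∀ a b d e → a * b * (d * e) ≡ a * d * (b * e)
    lem₁ = solve-∀
    lem₂ : ∀ a b n i → a * b * (-1ℤ + n * i) ≡ n * (a * (i * b)) - a * b
    lem₂ = solve-∀
    lem₃ : ∀ s e → s * ((1ℤ + e) * s) ≡ (1ℤ + e) * (s * s)
    lem₃ = solve-∀
    lem₄ : ∀ a → a - 0ℤ ≡ a
    lem₄ = solve-∀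
    correlation : ∀ v w → ∑ (λ a → χ (v ⊙ v ⊕ a) * χ (w ⊙ w ⊕ a)) ≡ -1ℤ + + q * 𝟙 (w ⊙ w ≟ᶠ v ⊙ v)
    correlation v w = begin
      ∑ (λ a → χ (v ⊙ v ⊕ a) * χ (w ⊙ w ⊕ a))
        ≡⟨ ∑-cong (λ a → cong₂ (λ r s → χ r * χ s) (⊕-comm (v ⊙ v) a)
             (solve 3 (λ v w a → w :* w :+ a := a :+ v :* v :+ (w :* w :+ :- (v :* v))) refl v w a)) ⟩
      ∑ (λ a → χ (a ⊕ v ⊙ v) * χ (a ⊕ v ⊙ v ⊕ (w ⊙ w ⊕ ⊖ (v ⊙ v))))
        ≡⟨ ∑-translate (v ⊙ v) (λ a → χ a * χ (a ⊕ (w ⊙ w ⊕ ⊖ (v ⊙ v)))) ⟩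
      ∑ (λ a → χ a * χ (a ⊕ (w ⊙ w ⊕ ⊖ (v ⊙ v))))
        ≡⟨ ∑χ-product-shift _ ⟩
      -1ℤ + + q * δ₀ (w ⊙ w ⊕ ⊖ (v ⊙ v))
        ≡⟨ cong (λ s → -1ℤ + + q * s) (𝟙-cong _ _
             (λ eq → by-hyp eq (solve 2 (λ a b → a := b :+ con 1ℤ :* ((a :+ :- b) :+ :- con 0ℤ))
                 refl (w ⊙ w) (v ⊙ v)))
             (λ eq → trans (cong (_⊕ ⊖ (v ⊙ v)) eq) (⊖-inverseʳ (v ⊙ v)))) ⟩
      -1ℤ + + q * 𝟙 (w ⊙ w ≟ᶠ v ⊙ v) ∎

  -- If χ never took the value -1, then χ² = χ, and q - 1 = ∑ χ² = ∑ χ = 0.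
  nonsquare-exists : ∃ λ n → χ n ≡ -1ℤ
  nonsquare-exists with any? (λ n → χ n ℤP.≟ -1ℤ)
  ... | yes found = found
  ... | no none = ⊥-elim (q-1≢0 (trans (sym ∑χ²) (trans (∑-cong idem) ∑χ≡0)))
    where
    idem : ∀ a → χ a * χ a ≡ χ a
    idem a with χ a in eq | χ-view a
    ... | _ | zero _ = refl
    ... | _ | square _ _ _ = refl
    ... | _ | nonsquare _ _ = ⊥-elim (none (a , eq))

  -- The weights χ² + χ and χ² - χ are twice the indicators of the nonzero squares and of the
  -- nonsquares, and T² is constant on each class by `T-square-⊙`. In this form the second moment
  -- can be summed over a without counting the classes.
  T²-classes : ∀ {n} → χ n ≡ -1ℤ → ∀ a →
               + 2 * (T a * T a) ≡ (χ a * χ a + χ a) * (T 1# * T 1#) + (χ a * χ a - χ a) * (T n * T n)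
  T²-classes {n} χn≡-1 a with χ a in eq | χ-view a
  ... | _ | zero refl = trans (cong (λ s → + 2 * (s * s)) T-zero) (lem (T 1# * T 1#) (T n * T n))
    where
    lem : ∀ r s → + 2 * (0ℤ * 0ℤ) ≡ (0ℤ * 0ℤ + 0ℤ) * r + (0ℤ * 0ℤ - 0ℤ) * s
    lem = solve-∀
  ... | _ | square b b≢0 refl = begin
    + 2 * (T (b ⊙ b) * T (b ⊙ b))               ≡⟨ cong (λ s → + 2 * (s * s)) (T-square b) ⟩
    + 2 * (χ b * T 1# * (χ b * T 1#))           ≡⟨ lem₁ (χ b) (T 1#) ⟩
    + 2 * (χ b * χ b) * (T 1# * T 1#)           ≡⟨ cong (λ s → + 2 * s * (T 1# * T 1#))
        (χ-square² b≢0) ⟩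
    + 2 * 1ℤ * (T 1# * T 1#)                    ≡⟨ lem₂ (T 1# * T 1#) (T n * T n) ⟩
    (1ℤ * 1ℤ + 1ℤ) * (T 1# * T 1#) + (1ℤ * 1ℤ - 1ℤ) * (T n * T n) ∎
    where
    lem₁ : ∀ s t → + 2 * (s * t * (s * t)) ≡ + 2 * (s * s) * (t * t)
    lem₁ = solve-∀
    lem₂ : ∀ r s → + 2 * 1ℤ * r ≡ (1ℤ * 1ℤ + 1ℤ) * r + (1ℤ * 1ℤ - 1ℤ) * s
    lem₂ = solve-∀
  -- As a product of two nonsquares, a n is a nonzero square b², and n² a = b² n compares T a with T
  -- n.
  ... | _ | nonsquare a≢0 _ with χ (a ⊙ n) in eq′ | χ-view (a ⊙ n)
  ...   | _ | zero an≡0 = ⊥-elim (⊙-nonzero a≢0 n≢0 an≡0)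
    where
    n≢0 : n ≢ 0#
    n≢0 n≡0 with () ← trans (sym (χ-zero n≡0)) χn≡-1
  ...   | _ | nonsquare _ _ with () ← trans (sym eq′) (trans (χ-⊙ a n) (cong₂ _*_ eq χn≡-1))
  T²-classes {n} χn≡-1 a | _ | nonsquare a≢0 _ | _ | square b b≢0 an≡b² = begin
    + 2 * (T a * T a)                           ≡⟨ lem₁ (T a) (T 1# * T 1#) ⟩
    + 2 * (-1ℤ * T a * (-1ℤ * T a))             ≡⟨ cong (λ s → + 2 * (s * s)) (begin
      -1ℤ * T a         ≡⟨ cong (_* T a) χn≡-1 ⟨
      χ n * T a         ≡⟨ T-square-⊙ n≢0 a ⟨
      T (n ⊙ n ⊙ a)     ≡⟨ cong T (by-hyp an≡b² (solve
          3 (λ n a b → n :* n :* a := b :* b :* n :+ n :* (a :* n :+ :- (b :* b))) refl n a b)) ⟩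
      T (b ⊙ b ⊙ n)     ≡⟨ T-square-⊙ b≢0 n ⟩
      χ b * T n         ∎) ⟩
    + 2 * (χ b * T n * (χ b * T n))             ≡⟨ lem₂ (χ b) (T n) ⟩
    + 2 * (χ b * χ b) * (T n * T n)             ≡⟨ cong (λ s → + 2 * s * (T n * T n)) (χ-square² b≢0) ⟩
    + 2 * 1ℤ * (T n * T n)                      ≡⟨ lem₃ (T 1# * T 1#) (T n * T n) ⟩
    (-1ℤ * -1ℤ + -1ℤ) * (T 1# * T 1#) + (-1ℤ * -1ℤ - -1ℤ) * (T n * T n) ∎
    where
    n≢0 : n ≢ 0#
    n≢0 n≡0 with () ← trans (sym (χ-zero n≡0)) χn≡-1
    lem₁ : ∀ t r → + 2 * (t * t) ≡ + 2 * (-1ℤ * t * (-1ℤ * t))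
    lem₁ = solve-∀
    lem₂ : ∀ s t → + 2 * (s * t * (s * t)) ≡ + 2 * (s * s) * (t * t)
    lem₂ = solve-∀
    lem₃ : ∀ r s → + 2 * 1ℤ * s ≡ (-1ℤ * -1ℤ + -1ℤ) * r + (-1ℤ * -1ℤ - -1ℤ) * s
    lem₃ = solve-∀

  -- Summed over a, both weights in `T²-classes` total q - 1, because ∑ χ² = q - 1 and ∑ χ = 0; the
  -- left side totals 4 q (q - 1) by `∑-T²` with η = 1.
  T1²+Tn² : η ≡ 1ℤ → ∀ {n} → χ n ≡ -1ℤ → T 1# * T 1# + T n * T n ≡ + 4 * + q
  T1²+Tn² η≡1 {n} χn≡-1 = ℤP.*-cancelˡ-≡ (+ q - 1ℤ) _ _ {{ℤ.≢-nonZero q-1≢0}} (begin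
    (+ q - 1ℤ) * (T 1# * T 1# + T n * T n)
      ≡⟨ lem₁ (+ q - 1ℤ) (T 1# * T 1#) (T n * T n) ⟩
    (+ q - 1ℤ + 0ℤ) * (T 1# * T 1#) + (+ q - 1ℤ - 0ℤ) * (T n * T n)
      ≡⟨ cong₂ (λ s r → (s + r) * (T 1# * T 1#) + (s - r) * (T n * T n)) (sym ∑χ²) (sym ∑χ≡0) ⟩
    (∑ (λ a → χ a * χ a) + ∑ χ) * (T 1# * T 1#) + (∑ (λ a → χ a * χ a) - ∑ χ) * (T n * T n)
      ≡⟨ cong₂ _+_ (trans (cong (_* (T 1# * T 1#)) (sym (∑-+ _ _))) (sym (∑-*ʳ (T 1# * T 1#) _)))
                   (trans (cong (_* (T n * T n)) (sym (∑-minus _ _))) (sym (∑-*ʳ (T n * T n) _))) ⟩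
    ∑ (λ a → (χ a * χ a + χ a) * (T 1# * T 1#)) + ∑ (λ a → (χ a * χ a - χ a) * (T n * T n))
      ≡⟨ ∑-+ _ _ ⟨
    ∑ (λ a → (χ a * χ a + χ a) * (T 1# * T 1#) + (χ a * χ a - χ a) * (T n * T n))
      ≡⟨ ∑-cong (T²-classes χn≡-1) ⟨
    ∑ (λ a → + 2 * (T a * T a))
      ≡⟨ trans (∑-*ˡ (+ 2) _) (cong (+ 2 *_) ∑-T²) ⟩
    + 2 * (+ q * ((1ℤ + η) * (+ q - 1ℤ)))
      ≡⟨ cong (λ s → + 2 * (+ q * ((1ℤ + s) * (+ q - 1ℤ)))) η≡1 ⟩
    + 2 * (+ q * ((1ℤ + 1ℤ) * (+ q - 1ℤ)))
      ≡⟨ lem₂ (+ q) (+ q - 1ℤ) ⟩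
    (+ q - 1ℤ) * (+ 4 * + q) ∎)
    where
    lem₁ : ∀ m r s → m * (r + s) ≡ (m + 0ℤ) * r + (m - 0ℤ) * s
    lem₁ = solve-∀
    lem₂ : ∀ n m → + 2 * (n * ((1ℤ + 1ℤ) * m)) ≡ m * (+ 4 * n)
    lem₂ = solve-∀

  -- Congruences from involutions.

  ∑-even : (f : F → ℤ) → (∀ v → f (⊖ v) ≡ f v) → f 0# ≡ 0ℤ → ∃ λ k → ∑ f ≡ + 2 * k
  ∑-even f f-even f0≡0 = halfsum ,
    trans (∑-halve ⊖_ ⊖-involutive toℕ f f-even) (trans (cong (λ s → + 2 * halfsum + s) fixedsum)
        (ℤP.+-identityʳ (+ 2 * halfsum)))
    where
    halfsum : ℤ
    halfsum = ∑ λ x → 𝟙 (toℕ x ℕP.<? toℕ (⊖ x)) * f x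
    -- A tie of keys means x = -x, hence x = 0, where f vanishes.
    fixedsum : ∑ (λ x → 𝟙 (toℕ x ℕP.≟ toℕ (⊖ x)) * f x) ≡ 0ℤ
    fixedsum = trans (∑-𝟙-const (λ x → toℕ x ℕP.≟ toℕ (⊖ x)) 0ℤ (λ x eq →
        trans (cong f (≡⊖⇒≡0 (toℕ-injective eq))) f0≡0))
      (ℤP.*-zeroʳ (∑ λ x → 𝟙 (toℕ x ℕP.≟ toℕ (⊖ x))))

  -- The group {±v, ±v⁻¹} acts freely on the v with v⁴ ≠ 0, 1; halving the sum once for
  -- each of the two commuting involutions leaves a multiple of 4.
  ∑-quarter : (f : F → ℤ) → (∀ v → f (⊖ v) ≡ f v) → (∀ v → f (v ⁻¹) ≡ f v) → f 0# ≡ 0ℤ →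
              ∃ λ k → ∑ f ≡ + 4 * k + + 2 * f 1# + ∑ (λ v → 𝟙 (v ⊙ v ≟ᶠ ⊖ 1#) * f v)
  ∑-quarter f f-even f-inv f0≡0 = k , (begin
    ∑ f
      ≡⟨ ∑-halve _⁻¹ ⁻¹-involutive key f f-inv ⟩
    + 2 * ∑ f′ + ∑ (λ v → 𝟙 (key v ℕP.≟ key (v ⁻¹)) * f v)
      ≡⟨ cong₂ (λ r s → + 2 * r + s) (proj₂ half) (trans (∑-cong split) (∑-+ _ _)) ⟩
    + 2 * (+ 2 * k) + (∑ (λ v → 𝟙 (v ⊙ v ≟ᶠ 1# ⊙ 1#) * f v) + ∑ (λ v → 𝟙 (v ⊙ v ≟ᶠ ⊖ 1#) * f v))
      ≡⟨ cong (λ r → + 2 * (+ 2 * k) + (r + ∑ (λ v → 𝟙 (v ⊙ v ≟ᶠ ⊖ 1#) * f v)))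
           (trans (∑-𝟙-const (λ v → v ⊙ v ≟ᶠ 1# ⊙ 1#) (f 1#) λ v eq → [ cong f
               , (λ v≡-1 → trans (cong f v≡-1) (f-even 1#)) ]′ (square-≡ eq))
             (cong (_* f 1#) (trans (∑-roots (1# ⊙ 1#)) (cong (λ s → 1ℤ + s) (χ-square 1≢0 refl))))) ⟩
    + 2 * (+ 2 * k) + (+ 2 * f 1# + ∑ (λ v → 𝟙 (v ⊙ v ≟ᶠ ⊖ 1#) * f v))
      ≡⟨ lem k (f 1#) _ ⟩
    + 4 * k + + 2 * f 1# + ∑ (λ v → 𝟙 (v ⊙ v ≟ᶠ ⊖ 1#) * f v) ∎)
    where
    lem : ∀ k a b → + 2 * (+ 2 * k) + (+ 2 * a + b) ≡ + 4 * k + + 2 * a + b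
    lem = solve-∀
    -- The key depends on v² only, so the half selected for inversion is stable under negation and
    -- `∑-even` can halve it again.
    key : F → ℕ
    key v = toℕ (v ⊙ v)
    f′ : F → ℤ
    f′ v = 𝟙 (key v ℕP.<? key (v ⁻¹)) * f v
    ⊖-square : ∀ v → (⊖ v) ⊙ (⊖ v) ≡ v ⊙ v
    ⊖-square = solve 1 (λ v → :- v :* :- v := v :* v) refl
    ⊖-⁻¹ : ∀ v → (⊖ v) ⁻¹ ≡ ⊖ (v ⁻¹)
    ⊖-⁻¹ v with v ≟ᶠ 0#
    ... | yes refl = trans (cong _⁻¹ -0≡0) (trans ⁻¹-zero (sym (trans (cong ⊖_ ⁻¹-zero) -0≡0)))
      where
      -0≡0 : ⊖ 0# ≡ 0#
      -0≡0 = solve 0 (:- con 0ℤ := con 0ℤ) refl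
    ... | no v≢0 = ⊙-cancelˡ (⊖-nonzero v≢0) (trans (⁻¹-inverse (⊖-nonzero v≢0))
      (trans (sym (⁻¹-inverse v≢0)) (solve 2 (λ v w → v :* w := :- v :* :- w) refl v (v ⁻¹))))
    half : ∃ λ k → ∑ f′ ≡ + 2 * k
    half = ∑-even f′
      (λ v → cong₂ _*_ (cong₂ (λ a b → 𝟙 (a ℕP.<? b)) (cong toℕ (⊖-square v))
               (cong toℕ (trans (cong (λ w → w ⊙ w) (⊖-⁻¹ v)) (⊖-square (v ⁻¹))))) (f-even v))
      (trans (cong (𝟙 (key 0# ℕP.<? key (0# ⁻¹)) *_) f0≡0) (ℤP.*-zeroʳ (𝟙 (key 0# ℕP.<? key (0# ⁻¹)))))
    k : ℤ
    k = proj₁ half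
    -- For v ≠ 0 the keys tie when v² = v⁻², that is v⁴ = 1, that is v² = 1 or v² = -1; at 0 the
    -- function vanishes.
    split : ∀ v → 𝟙 (key v ℕP.≟ key (v ⁻¹)) * f v ≡ 𝟙 (v ⊙ v ≟ᶠ 1# ⊙ 1#) * f v + 𝟙 (v ⊙ v ≟ᶠ ⊖ 1#) * f v
    split v with v ≟ᶠ 0#
    ... | yes refl = trans (cong (𝟙 (key 0# ℕP.≟ key (0# ⁻¹)) *_) f0≡0)
        (trans (ℤP.*-zeroʳ (𝟙 (key 0# ℕP.≟ key (0# ⁻¹))))
            (sym (cong₂ _+_ (trans (cong (𝟙 (0# ⊙ 0# ≟ᶠ 1# ⊙ 1#) *_) f0≡0)
                (ℤP.*-zeroʳ (𝟙 (0# ⊙ 0# ≟ᶠ 1# ⊙ 1#))))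
                            (trans (cong (𝟙 (0# ⊙ 0# ≟ᶠ ⊖ 1#) *_) f0≡0)
                                (ℤP.*-zeroʳ (𝟙 (0# ⊙ 0# ≟ᶠ ⊖ 1#)))))))
    ... | no v≢0 = trans (cong (_* f v) (trans (𝟙-cong _ (v ⊙ v ⊙ (v ⊙ v) ≟ᶠ 1# ⊙ 1#)
             (λ eq → by-hyps (toℕ-injective eq) (⁻¹-inverse v≢0)
                 (solve 2 (λ v w → v :* v :* (v :* v) := con 1ℤ :* con 1ℤ
                :+ v :* v :* (v :* v :+ :- (w :* w)) :+ (v :* w :+ con 1ℤ) :* (v :* w :+ :- con 1ℤ))
                    refl v (v ⁻¹)))
             (λ eq → cong toℕ (⊙-cancelˡ (⊙-nonzero v≢0 v≢0) (by-hyps eq (⁻¹-inverse v≢0)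
                (solve 2 (λ v w → v :* v :* (v :* v) := v :* v :* (w :* w) :+ con 1ℤ
                    :* (v :* v :* (v :* v) :+ :- (con 1ℤ :* con 1ℤ)) :+ :- (v :* w :+ con 1ℤ)
                    :* (v :* w :+ :- con 1ℤ)) refl v (v ⁻¹))))))
          (trans (𝟙-square 1≢0 (v ⊙ v)) (cong (λ a → 𝟙 (v ⊙ v ≟ᶠ a) + 𝟙 (v ⊙ v ≟ᶠ ⊖ 1#))
              (sym (⊙-identityˡ 1#))))))
        (ℤP.*-distribʳ-+ (f v) (𝟙 (v ⊙ v ≟ᶠ 1# ⊙ 1#)) (𝟙 (v ⊙ v ≟ᶠ ⊖ 1#)))

  χ-⁻¹ : ∀ v → χ (v ⁻¹) ≡ χ v
  χ-⁻¹ v with v ≟ᶠ 0#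
  ... | yes refl = cong χ ⁻¹-zero
  ... | no v≢0 = trans (sym (χ-square-⊙ v≢0 (v ⁻¹))) (cong χ (by-hyp (⁻¹-inverse v≢0)
    (solve 2 (λ v w → v :* v :* w := v :+ v :* (v :* w :+ :- con 1ℤ)) refl v (v ⁻¹))))

  root-of-⊖1-nonzero : ∀ {v} → v ⊙ v ≡ ⊖ 1# → v ≢ 0#
  root-of-⊖1-nonzero v²≡-1 refl = ⊖-nonzero 1≢0 (trans (sym v²≡-1) (⊙-zeroˡ 0#))

  -- `∑-quarter` is applied to χ², whose sum is q - 1: the points ±1 contribute 2 and the roots of
  -- -1 contribute 1 + η. So the value of χ at -1 comes from counting orbits instead of Euler's
  -- criterion.
  q-mod-4 : ∃ λ k → + q ≡ + 4 * k + η
  q-mod-4 = let k , eq = ∑-quarter (λ v → χ v * χ v)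
                  (λ v → trans (cong₂ _*_ (χ-⊖ v) (χ-⊖ v)) (trans (lem₁ η (χ v))
                      (trans (cong (_* (χ v * χ v)) (χ-square² (⊖-nonzero 1≢0))) (ℤP.*-identityˡ _))))
                  (λ v → cong₂ _*_ (χ-⁻¹ v) (χ-⁻¹ v))
                  (cong (λ s → s * s) (χ-zero refl))
            in k + 1ℤ , (begin
    + q
      ≡⟨ lem₂ (+ q) ⟩
    + q - 1ℤ + 1ℤ
      ≡⟨ cong (_+ 1ℤ) (trans (sym ∑χ²) eq) ⟩
    + 4 * k + + 2 * (χ 1# * χ 1#) + ∑ (λ v → 𝟙 (v ⊙ v ≟ᶠ ⊖ 1#) * (χ v * χ v)) + 1ℤ
      ≡⟨ cong₂ (λ r s → + 4 * k + + 2 * (r * r) + s + 1ℤ) χ-one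
           (trans (∑-𝟙-const (λ v → v ⊙ v ≟ᶠ ⊖ 1#) 1ℤ λ v eq → χ-square² (root-of-⊖1-nonzero eq))
               (trans (ℤP.*-identityʳ _) (∑-roots (⊖ 1#)))) ⟩
    + 4 * k + + 2 * (1ℤ * 1ℤ) + (1ℤ + η) + 1ℤ
      ≡⟨ lem₃ k η ⟩
    + 4 * (k + 1ℤ) + η ∎)
    where
    lem₁ : ∀ e s → e * s * (e * s) ≡ e * e * (s * s)
    lem₁ = solve-∀
    lem₂ : ∀ n → n ≡ n - 1ℤ + 1ℤ
    lem₂ = solve-∀
    lem₃ : ∀ k e → + 4 * k + + 2 * (1ℤ * 1ℤ) + (1ℤ + e) + 1ℤ ≡ + 4 * (k + 1ℤ) + e
    lem₃ = solve-∀

  ν : F → ℤ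
  ν a = 𝟙 (χ a ℤP.≟ -1ℤ)

  χ-ν : ∀ a → χ a ≡ 1ℤ - + 2 * ν a - δ₀ a
  χ-ν a with χ a in eq | χ-view a
  ... | _ | zero a≡0 = sym (cong₂ (λ r s → 1ℤ - + 2 * r - s) (𝟙-no (0ℤ ℤP.≟ -1ℤ) λ ()) (δ₀-yes a≡0))
  ... | _ | square b b≢0 a≡b² = sym (cong₂ (λ r s → 1ℤ - + 2 * r - s) (𝟙-no (1ℤ ℤP.≟ -1ℤ) λ ())
    (δ₀-no λ a≡0 → ⊙-nonzero b≢0 b≢0 (trans (sym a≡b²) a≡0)))
  ... | _ | nonsquare a≢0 _ = sym (cong₂ (λ r s → 1ℤ - + 2 * r - s) (𝟙-yes (-1ℤ ℤP.≟ -1ℤ) refl)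
      (δ₀-no a≢0))

  T-even : η ≡ 1ℤ → ∀ a → ∃ λ k → T a ≡ + 2 * k
  T-even η≡1 a = ∑-even (λ u → χ u * χ (u ⊙ u ⊕ a))
    (λ v → cong₂ _*_ (trans (χ-⊖ v) (trans (cong (_* χ v) η≡1) (ℤP.*-identityˡ (χ v))))
      (cong χ (solve 2 (λ v a → :- v :* :- v :+ a := v :* v :+ a) refl v a)))
    (trans (cong (_* χ (0# ⊙ 0# ⊕ a)) (χ-zero refl)) (ℤP.*-zeroˡ (χ (0# ⊙ 0# ⊕ a))))

  -- Replacing χ by 1 - 2 ν in the second factor leaves twice a sum that ∑-quarter applies to.
  T1-mod-8 : η ≡ 1ℤ → ∃ λ k → T 1# ≡ + 2 * (+ 4 * k - 1ℤ)
  T1-mod-8 η≡1 = let k , eq = ∑-quarter f f-even f-inv f0≡0 in - k , (begin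
    T 1#
      ≡⟨ trans (∑-cong λ u → trans (cong (χ u *_) (χ-ν (u ⊙ u ⊕ 1#)))
          (lem₁ (χ u) (ν (u ⊙ u ⊕ 1#)) (δ₀ (u ⊙ u ⊕ 1#))))
           (trans (∑-minus _ _) (cong (_- ∑ λ u → δ₀ (u ⊙ u ⊕ 1#) * χ u)
               (trans (∑-minus _ _) (cong (λ s → ∑ χ - s) (∑-*ˡ (+ 2) f))))) ⟩
    ∑ χ - + 2 * ∑ f - ∑ (λ u → δ₀ (u ⊙ u ⊕ 1#) * χ u)
      -- The `δ₀` term lives on the two roots u of -1, where χ u = χ 2 because χ (2 u) = 1.
      ≡⟨ cong₂ (λ r s → r - + 2 * ∑ f - s) ∑χ≡0 (trans
          (∑-𝟙-const (λ u → u ⊙ u ⊕ 1# ≟ᶠ 0#) (χ 2#) (λ u eq → χ-root u (to eq)))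
           (cong (_* χ 2#) (trans (∑-cong λ u → 𝟙-cong _ (u ⊙ u ≟ᶠ ⊖ 1#) to from)
               (trans (∑-roots (⊖ 1#)) (cong (λ s → 1ℤ + s) η≡1))))) ⟩
    0ℤ - + 2 * ∑ f - + 2 * χ 2#
      ≡⟨ cong (λ s → 0ℤ - + 2 * s - + 2 * χ 2#) (trans eq
          (cong₂ (λ r s → + 4 * k + + 2 * r + s) f1 rootsum)) ⟩
    0ℤ - + 2 * (+ 4 * k + + 2 * ν 2# + 0ℤ) - + 2 * χ 2#
      -- Writing χ 2 through ν as well makes the two occurrences of `ν 2#` cancel, whether or not 2
      -- is a square.
      ≡⟨ cong (λ s → 0ℤ - + 2 * (+ 4 * k + + 2 * ν 2# + 0ℤ) - + 2 * s)
          (trans (χ-ν 2#) (cong (λ s → 1ℤ - + 2 * ν 2# - s) (δ₀-no 2≢0))) ⟩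
    0ℤ - + 2 * (+ 4 * k + + 2 * ν 2# + 0ℤ) - + 2 * (1ℤ - + 2 * ν 2# - 0ℤ)
      ≡⟨ lem₂ k (ν 2#) ⟩
    + 2 * (+ 4 * (- k) - 1ℤ) ∎)
    where
    lem₁ : ∀ s n d → s * (1ℤ - + 2 * n - d) ≡ s - + 2 * (s * n) - d * s
    lem₁ = solve-∀
    lem₂ : ∀ k n → 0ℤ - + 2 * (+ 4 * k + + 2 * n + 0ℤ) - + 2 * (1ℤ - + 2 * n - 0ℤ) ≡ + 2
        * (+ 4 * (- k) - 1ℤ)
    lem₂ = solve-∀
    to : ∀ {u} → u ⊙ u ⊕ 1# ≡ 0# → u ⊙ u ≡ ⊖ 1#
    to {u} eq = by-hyp eq (solve 1 (λ u → u :* u := :- con 1ℤ :+ con 1ℤ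
        :* ((u :* u :+ con 1ℤ) :+ :- con 0ℤ)) refl u)
    from : ∀ {u} → u ⊙ u ≡ ⊖ 1# → u ⊙ u ⊕ 1# ≡ 0#
    from {u} eq = by-hyp eq (solve 1 (λ u → u :* u :+ con 1ℤ := con 0ℤ :+ con 1ℤ
        :* (u :* u :+ :- (:- con 1ℤ))) refl u)
    χ-root : ∀ u → u ⊙ u ≡ ⊖ 1# → χ u ≡ χ 2#
    χ-root u eq = begin
      χ u                   ≡⟨ ℤP.*-identityˡ (χ u) ⟨
      1ℤ * χ u              ≡⟨ cong (_* χ u) (χ-square² 2≢0) ⟨
      χ 2# * χ 2# * χ u     ≡⟨ ℤP.*-assoc (χ 2#) (χ 2#) (χ u) ⟩
      χ 2# * (χ 2# * χ u)   ≡⟨ cong (χ 2# *_) (trans (sym (χ-⊙ 2# u)) (χ-2i u eq)) ⟩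
      χ 2# * 1ℤ             ≡⟨ ℤP.*-identityʳ (χ 2#) ⟩
      χ 2# ∎
    f : F → ℤ
    f v = χ v * ν (v ⊙ v ⊕ 1#)
    f-even : ∀ v → f (⊖ v) ≡ f v
    f-even v = cong₂ _*_ (trans (χ-⊖ v) (trans (cong (_* χ v) η≡1) (ℤP.*-identityˡ (χ v))))
      (cong ν (solve 1 (λ v → :- v :* :- v :+ con 1ℤ := v :* v :+ con 1ℤ) refl v))
    f-inv : ∀ v → f (v ⁻¹) ≡ f v
    f-inv v with v ≟ᶠ 0#
    ... | yes refl = cong f ⁻¹-zero
    ... | no v≢0 = cong₂ _*_ (χ-⁻¹ v) (cong (λ s → 𝟙 (s ℤP.≟ -1ℤ))
        (trans (sym (χ-square-⊙ v≢0 (v ⁻¹ ⊙ v ⁻¹ ⊕ 1#)))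
      (cong χ (by-hyp (⁻¹-inverse v≢0) (solve 2 (λ v w → v :* v :* (w :* w :+ con 1ℤ)
          := (v :* v :+ con 1ℤ) :+ (v :* w :+ con 1ℤ) :* (v :* w :+ :- con 1ℤ)) refl v (v ⁻¹))))))
    f0≡0 : f 0# ≡ 0ℤ
    f0≡0 = trans (cong (_* ν (0# ⊙ 0# ⊕ 1#)) (χ-zero refl)) (ℤP.*-zeroˡ (ν (0# ⊙ 0# ⊕ 1#)))
    f1 : f 1# ≡ ν 2#
    f1 = trans (cong₂ _*_ χ-one (cong ν (solve 0 (con 1ℤ :* con 1ℤ :+ con 1ℤ := con (+ 2)) refl)))
        (ℤP.*-identityˡ (ν 2#))
    rootsum : ∑ (λ v → 𝟙 (v ⊙ v ≟ᶠ ⊖ 1#) * f v) ≡ 0ℤ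
    rootsum = trans (∑-𝟙-const (λ v → v ⊙ v ≟ᶠ ⊖ 1#) 0ℤ (λ v eq → trans (cong (χ v *_)
        (𝟙-no (χ (v ⊙ v ⊕ 1#) ℤP.≟ -1ℤ) λ χ≡-1 → 0≢-1 (trans (sym (χ-zero (from eq))) χ≡-1)))
            (ℤP.*-zeroʳ (χ v))))
      (ℤP.*-zeroʳ (∑ λ v → 𝟙 (v ⊙ v ≟ᶠ ⊖ 1#)))
      where
      0≢-1 : 0ℤ ≢ -1ℤ
      0≢-1 ()

  ∃-sqrt-⊖1 : η ≡ 1ℤ → ∃ λ i → i ⊙ i ≡ ⊖ 1#
  ∃-sqrt-⊖1 η≡1 with χ (⊖ 1#) | χ-view (⊖ 1#)
  ∃-sqrt-⊖1 _  | _ | square i _ eq = i , sym eq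

-- Vertex counts by degree

-- The value is an index, so that matching on four bits turns the polynomial identities of `exactly`
-- into closed computations.
data Bit : ℤ → Set where
  bit₀ : Bit 0ℤ
  bit₁ : Bit 1ℤ

𝟙-bit : {P : Set} (P? : Dec P) → Bit (𝟙 P?)
𝟙-bit P? with P?
... | yes p = subst Bit (sym (𝟙-yes (yes p) p)) bit₁
... | no ¬p = subst Bit (sym (𝟙-no (no ¬p) ¬p)) bit₀

e₁ e₂ e₃ e₄ : ℤ → ℤ → ℤ → ℤ → ℤ
e₁ a b c d = a + b + c + d
e₂ a b c d = a * b + a * c + a * d + b * c + b * d + c * d
e₃ a b c d = a * b * c + a * b * d + a * c * d + b * c * d
e₄ a b c d = a * b * c * d

-- On m set bits the k-th elementary symmetric polynomial is binomial(m, k). The condition that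
-- exactly j bits are set therefore has coefficient (-1)^(k-j) binomial(k, j) at the k-th of them
-- for k ≥ j; these are the constants in `exactly`.
combination : (k₁ k₂ k₃ k₄ a b c d : ℤ) → ℤ
combination k₁ k₂ k₃ k₄ a b c d = k₁ * e₁ a b c d + k₂ * e₂ a b c d + k₃ * e₃ a b c d + k₄ * e₄ a b c d

-- Inclusion–exclusion for the number 4 - n of bits that are set.
exactly : ∀ {a b c d} → Bit a → Bit b → Bit c → Bit d → ∀ n → + n ≡ + 4 - (a + b + c + d) →
          𝟙 (n ℕP.≟ 3) ≡ combination (+ 1) (- + 2) (+ 3) (- + 4) a b c d
        × 𝟙 (n ℕP.≟ 2) ≡ combination 0ℤ (+ 1) (- + 3) (+ 6) a b c d
        × 𝟙 (n ℕP.≟ 1) ≡ combination 0ℤ 0ℤ (+ 1) (- + 4) a b c d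
        × 𝟙 (n ℕP.≟ 0) ≡ combination 0ℤ 0ℤ 0ℤ (+ 1) a b c d
exactly bit₀ bit₀ bit₀ bit₀ _ refl = 𝟙-if _ , 𝟙-if _ , 𝟙-if _ , 𝟙-if _
exactly bit₀ bit₀ bit₀ bit₁ _ refl = 𝟙-if _ , 𝟙-if _ , 𝟙-if _ , 𝟙-if _
exactly bit₀ bit₀ bit₁ bit₀ _ refl = 𝟙-if _ , 𝟙-if _ , 𝟙-if _ , 𝟙-if _
exactly bit₀ bit₀ bit₁ bit₁ _ refl = 𝟙-if _ , 𝟙-if _ , 𝟙-if _ , 𝟙-if _
exactly bit₀ bit₁ bit₀ bit₀ _ refl = 𝟙-if _ , 𝟙-if _ , 𝟙-if _ , 𝟙-if _
exactly bit₀ bit₁ bit₀ bit₁ _ refl = 𝟙-if _ , 𝟙-if _ , 𝟙-if _ , 𝟙-if _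
exactly bit₀ bit₁ bit₁ bit₀ _ refl = 𝟙-if _ , 𝟙-if _ , 𝟙-if _ , 𝟙-if _
exactly bit₀ bit₁ bit₁ bit₁ _ refl = 𝟙-if _ , 𝟙-if _ , 𝟙-if _ , 𝟙-if _
exactly bit₁ bit₀ bit₀ bit₀ _ refl = 𝟙-if _ , 𝟙-if _ , 𝟙-if _ , 𝟙-if _
exactly bit₁ bit₀ bit₀ bit₁ _ refl = 𝟙-if _ , 𝟙-if _ , 𝟙-if _ , 𝟙-if _
exactly bit₁ bit₀ bit₁ bit₀ _ refl = 𝟙-if _ , 𝟙-if _ , 𝟙-if _ , 𝟙-if _
exactly bit₁ bit₀ bit₁ bit₁ _ refl = 𝟙-if _ , 𝟙-if _ , 𝟙-if _ , 𝟙-if _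
exactly bit₁ bit₁ bit₀ bit₀ _ refl = 𝟙-if _ , 𝟙-if _ , 𝟙-if _ , 𝟙-if _
exactly bit₁ bit₁ bit₀ bit₁ _ refl = 𝟙-if _ , 𝟙-if _ , 𝟙-if _ , 𝟙-if _
exactly bit₁ bit₁ bit₁ bit₀ _ refl = 𝟙-if _ , 𝟙-if _ , 𝟙-if _ , 𝟙-if _
exactly bit₁ bit₁ bit₁ bit₁ _ refl = 𝟙-if _ , 𝟙-if _ , 𝟙-if _ , 𝟙-if _

-- Sums over lists and neighbours in a graph

listSum : {X : Set} → (X → ℤ) → List X → ℤ
listSum f []       = 0ℤ
listSum f (x ∷ xs) = f x + listSum f xs

listSum-++ : (f : X → ℤ) → ∀ xs ys → listSum f (xs ++ ys) ≡ listSum f xs + listSum f ys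
listSum-++ f []       ys = sym (ℤP.+-identityˡ _)
listSum-++ f (x ∷ xs) ys = trans (cong (λ s → f x + s) (listSum-++ f xs ys))
    (sym (ℤP.+-assoc (f x) _ _))

listSum-map : (f : Y → ℤ) (g : X → Y) → ∀ xs → listSum f (map g xs) ≡ listSum (f ∘ g) xs
listSum-map f g []       = refl
listSum-map f g (x ∷ xs) = cong (λ s → f (g x) + s) (listSum-map f g xs)

listSum-filter : {P : X → Set} (P? : Decidable P) (f : X → ℤ) → ∀ xs →
                 listSum f (filter P? xs) ≡ listSum (λ x → 𝟙 (P? x) * f x) xs
listSum-filter P? f [] = refl
listSum-filter P? f (x ∷ xs) with P? x
... | yes p = cong₂ _+_ (sym (trans (cong (_* f x) (𝟙-yes (yes p) p)) (ℤP.*-identityˡ (f x))))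
    (listSum-filter P? f xs)
... | no ¬p = trans (listSum-filter P? f xs) (trans (sym (ℤP.+-identityˡ _))
  (cong (_+ listSum (λ x → 𝟙 (P? x) * f x) xs) (sym (cong (_* f x) (𝟙-no (no ¬p) ¬p)))))

length≡listSum : (xs : List X) → + length xs ≡ listSum (λ _ → 1ℤ) xs
length≡listSum []       = refl
length≡listSum (x ∷ xs) = cong (λ s → 1ℤ + s) (length≡listSum xs)

listSum-cartesianProduct : (f : X × Y → ℤ) → ∀ xs ys →
  listSum f (cartesianProduct xs ys) ≡ listSum (λ x → listSum (λ y → f (x , y)) ys) xs
listSum-cartesianProduct f []       ys = refl
listSum-cartesianProduct f (x ∷ xs) ys = trans (listSum-++ f (map (x ,_) ys) _)
  (cong₂ _+_ (listSum-map f (x ,_) ys) (listSum-cartesianProduct f xs ys))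

listSum-tabulate : ∀ {n} (f : X → ℤ) (g : Fin n → X) → listSum f (tabulate g) ≡ ∑ (f ∘ g)
listSum-tabulate {n = ℕ.zero}  f g = sym (∑-[] (f ∘ g))
listSum-tabulate {n = ℕ.suc n} f g = trans (cong (λ s → f (g zero) + s)
    (listSum-tabulate f (g ∘ suc))) (sym (∑-∷ (f ∘ g)))

listSum-allQuads : ∀ {q} (f : Quad q → ℤ) → listSum f (allQuads q) ≡ ∑⁴ (λ x y z t → f (x , y , z , t))
listSum-allQuads {q} f = begin
  listSum f (allQuads q)
    ≡⟨ listSum-cartesianProduct f (allFin q) _ ⟩
  listSum _ (allFin q)
    ≡⟨ listSum-tabulate _ (λ x → x) ⟩
  ∑ (λ x → listSum (λ v → f (x , v)) (cartesianProduct (allFin q)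
      (cartesianProduct (allFin q) (allFin q))))
    ≡⟨ ∑-cong (λ x → trans (listSum-cartesianProduct (λ v → f (x , v)) (allFin q) _)
        (listSum-tabulate _ (λ x → x))) ⟩
  ∑ (λ x → ∑ λ y → listSum (λ v → f (x , y , v)) (cartesianProduct (allFin q) (allFin q)))
    ≡⟨ ∑-cong₂ (λ x y → trans (listSum-cartesianProduct (λ v → f (x , y , v)) (allFin q) _)
        (trans (listSum-tabulate _ (λ x → x))
         (∑-cong λ z → listSum-tabulate _ (λ x → x)))) ⟩
  ∑⁴ (λ x y z t → f (x , y , z , t)) ∎
  where open ≡-Reasoning

length-filter-allQuads : ∀ {q} {P : Quad q → Set} (P? : Decidable P) →
  + length (filter P? (allQuads q)) ≡ ∑⁴ (λ x y z t → 𝟙 (P? (x , y , z , t)))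
length-filter-allQuads {q} P? = trans (length≡listSum (filter P? (allQuads q)))
    (trans (listSum-filter P? (λ _ → 1ℤ) (allQuads q))
  (trans (listSum-allQuads (λ v → 𝟙 (P? v) * 1ℤ)) (∑⁴-cong λ x y z t → ℤP.*-identityʳ
      (𝟙 (P? (x , y , z , t))))))

length-filter²-allQuads : ∀ {q} {P Q : Quad q → Set} (P? : Decidable P) (Q? : Decidable Q) →
  + length (filter Q? (filter P? (allQuads q))) ≡ ∑⁴ (λ x y z t → 𝟙 (P? (x , y , z , t)) * 𝟙
      (Q? (x , y , z , t)))
length-filter²-allQuads {q} P? Q? = trans (length≡listSum (filter Q? (filter P? (allQuads q))))
    (trans (listSum-filter Q? (λ _ → 1ℤ) (filter P? (allQuads q)))
  (trans (listSum-filter P? (λ v → 𝟙 (Q? v) * 1ℤ) (allQuads q))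
      (trans (listSum-allQuads (λ v → 𝟙 (P? v) * (𝟙 (Q? v) * 1ℤ)))
    (∑⁴-cong λ x y z t → cong (𝟙 (P? (x , y , z , t)) *_) (ℤP.*-identityʳ (𝟙 (Q? (x , y , z , t))))))))

∑⁴-δ : ∀ {q} (v : Quad q) (f : Quad q → ℤ) → ∑⁴ (λ x y z t → 𝟙 ((x , y , z , t) ≟Q v)
    * f (x , y , z , t)) ≡ f v
∑⁴-δ (a , b , c , d) f = begin
  ∑⁴ (λ x y z t → 𝟙 ((x , y , z , t) ≟Q (a , b , c , d)) * f (x , y , z , t))
    ≡⟨ ∑⁴-cong (λ x y z t → trans (cong (_* f (x , y , z , t)) (factor x y z t))
        (assoc (𝟙 (x ≟ᶠ a)) (𝟙 (y ≟ᶠ b)) (𝟙 (z ≟ᶠ c)) (𝟙 (t ≟ᶠ d)) _)) ⟩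
  ∑⁴ (λ x y z t → 𝟙 (x ≟ᶠ a) * (𝟙 (y ≟ᶠ b) * (𝟙 (z ≟ᶠ c) * (𝟙 (t ≟ᶠ d) * f (x , y , z , t)))))
    ≡⟨ ∑-cong (λ x → begin
         ∑ (λ y → ∑ λ z → ∑ λ t → 𝟙 (x ≟ᶠ a) * (𝟙 (y ≟ᶠ b) * (𝟙 (z ≟ᶠ c)
             * (𝟙 (t ≟ᶠ d) * f (x , y , z , t)))))
           ≡⟨ ∑-cong (λ y → trans (∑²-* (𝟙 (x ≟ᶠ a)) _) (cong (𝟙 (x ≟ᶠ a) *_)
               (trans (∑²-* (𝟙 (y ≟ᶠ b)) _) (cong (𝟙 (y ≟ᶠ b) *_)
                (trans (∑-cong λ z → trans (∑-*ˡ (𝟙 (z ≟ᶠ c)) _)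
                    (cong (𝟙 (z ≟ᶠ c) *_) (∑-δ d λ t → f (x , y , z , t))))
                    (∑-δ c λ z → f (x , y , z , d))))))) ⟩
         ∑ (λ y → 𝟙 (x ≟ᶠ a) * (𝟙 (y ≟ᶠ b) * f (x , y , c , d)))
           ≡⟨ trans (∑-*ˡ (𝟙 (x ≟ᶠ a)) _) (cong (𝟙 (x ≟ᶠ a) *_) (∑-δ b λ y → f (x , y , c , d))) ⟩
         𝟙 (x ≟ᶠ a) * f (x , b , c , d) ∎) ⟩
  ∑ (λ x → 𝟙 (x ≟ᶠ a) * f (x , b , c , d))
    ≡⟨ ∑-δ a (λ x → f (x , b , c , d)) ⟩
  f (a , b , c , d) ∎
  where
  open ≡-Reasoning
  assoc : ∀ a b c d e → a * (b * (c * d)) * e ≡ a * (b * (c * (d * e)))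
  assoc = solve-∀
  factor : ∀ x y z t → 𝟙 ((x , y , z , t) ≟Q (a , b , c , d)) ≡ 𝟙 (x ≟ᶠ a)
      * (𝟙 (y ≟ᶠ b) * (𝟙 (z ≟ᶠ c) * 𝟙 (t ≟ᶠ d)))
  factor x y z t = trans (𝟙-cong _ ((x ≟ᶠ a) ×-dec (y ≟ᶠ b) ×-dec (z ≟ᶠ c) ×-dec (t ≟ᶠ d))
      (λ { refl → refl , refl , refl , refl }) (λ { (refl , refl , refl , refl) → refl }))
    (trans (𝟙-× (x ≟ᶠ a) _) (cong (𝟙 (x ≟ᶠ a) *_) (trans (𝟙-× (y ≟ᶠ b) _)
        (cong (𝟙 (y ≟ᶠ b) *_) (𝟙-× (z ≟ᶠ c) (t ≟ᶠ d))))))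

module Neighbours {X : Set} (_≟_ : DecidableEquality X) (v w : X) where

  -- The factor `1ℤ - 𝟙 (u ≟ v)` discards the flips that fix v, since the graph has no loops.
  term : X → ℤ
  term u = 𝟙 (w ≟ u) * (1ℤ - 𝟙 (u ≟ v))

  term-≢ : ∀ {u} → w ≢ u → term u ≡ 0ℤ
  term-≢ {u} w≢u = cong (_* (1ℤ - 𝟙 (u ≟ v))) (𝟙-no (w ≟ u) w≢u)

  listSum-term-zero : ∀ {us} → All (w ≢_) us → listSum term us ≡ 0ℤ
  listSum-term-zero []         = refl
  listSum-term-zero (w≢u ∷ ws) = cong₂ _+_ (term-≢ w≢u) (listSum-term-zero ws)

  listSum-term-self : w ≡ v → ∀ us → listSum term us ≡ 0ℤ
  listSum-term-self w≡v []       = refl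
  listSum-term-self w≡v (u ∷ us) = cong₂ _+_
    (trans (𝟙-*-cong (w ≟ u) λ w≡u → cong (λ s → 1ℤ - s) (𝟙-yes (u ≟ v) (trans (sym w≡u) w≡v)))
        (ℤP.*-zeroʳ (𝟙 (w ≟ u))))
    (listSum-term-self w≡v us)

  -- Two flips of v agree only if both fix v, so no neighbour is counted twice.
  𝟙-neighbour : ∀ {us} → AllPairs (λ u u′ → u ≡ u′ → u ≡ v) us → (adj? : Dec (v ≢ w × w ∈ us)) →
                𝟙 adj? ≡ listSum term us
  𝟙-neighbour {us} sep adj? with w ≟ v
  ... | yes w≡v = trans (𝟙-no adj? λ (v≢w , _) → v≢w (sym w≡v)) (sym (listSum-term-self w≡v us))
  ... | no  w≢v = go sep adj?
    where
    go : ∀ {us} → AllPairs (λ u u′ → u ≡ u′ → u ≡ v) us → (adj? : Dec (v ≢ w × w ∈ us)) → 𝟙 adj?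
        ≡ listSum term us
    go [] adj? = 𝟙-no adj? λ { (_ , ()) }
    go {u ∷ us} (s ∷ sep) adj? = head (w ≟ u)
      where
      separated : w ≡ u → ∀ {us} → All (λ u′ → u ≡ u′ → u ≡ v) us → All (w ≢_) us
      separated w≡u []       = []
      separated w≡u (s ∷ ss) = (λ w≡u′ → w≢v (trans w≡u (s (trans (sym w≡u) w≡u′)))) ∷ separated w≡u ss
      head : Dec (w ≡ u) → 𝟙 adj? ≡ term u + listSum term us
      head (yes w≡u) = trans (𝟙-yes adj? ((λ v≡w → w≢v (sym v≡w)) , here w≡u))
        (sym (cong₂ _+_ (cong₂ (λ r s → r * (1ℤ - s)) (𝟙-yes (w ≟ u) w≡u)
            (𝟙-no (u ≟ v) λ u≡v → w≢v (trans w≡u u≡v)))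
                        (listSum-term-zero (separated w≡u s))))
      head (no w≢u) = trans (𝟙-cong adj? tail? (λ
          { (_ , here w≡u) → ⊥-elim (w≢u w≡u) ; (v≢w , there w∈us) → v≢w , w∈us })
                                               (λ (v≢w , w∈us) → v≢w , there w∈us))
        (trans (go sep tail?) (sym (trans (cong (_+ listSum term us) (term-≢ w≢u)) (ℤP.+-identityˡ _))))
        where
        open import Data.List.Membership.DecPropositional _≟_ using (_∈?_)
        tail? : Dec (v ≢ w × w ∈ us)
        tail? = yes (λ v≡w → w≢v (sym v≡w)) ×-dec (w ∈? us)

-- Solutions of x² + y² + z² + t² = c x y z t

module QuarticCounts {q : ℕ} (K : FiniteField q) (c : Fin q) (c≢0 : c ≢ FiniteField.0# K) where
  open CharacterSums K
  open ≡-Reasoning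

  -- disc x y is the discriminant of the quadratic form z² - c x y z t + t².
  disc sq : F → F → F
  disc x y = c ⊙ c ⊙ (x ⊙ x) ⊙ (y ⊙ y) ⊕ ⊖ 4#
  sq x y = x ⊙ x ⊕ y ⊙ y

  -- This character governs both degenerate loci: where `sq x y` = 0, one has y² = -x² and
  -- `disc x y` = -(c² x⁴ + 4); where `disc x y` = 0, one has (c x)² `sq x y` = c² x⁴ + 4.
  g : F → ℤ
  g x = χ (c ⊙ c ⊙ (x ⊙ x ⊙ (x ⊙ x)) ⊕ 4#)

  δ₀-square : ∀ x → δ₀ (x ⊙ x) ≡ δ₀ x
  δ₀-square x = 𝟙-cong _ _ square-zero (λ { refl → ⊙-zeroˡ 0# })

  χ-c²x² : ∀ x → χ (c ⊙ c ⊙ (x ⊙ x)) ≡ χ x * χ x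
  χ-c²x² x = trans (χ-square-⊙ c≢0 (x ⊙ x)) (χ-⊙ x x)

  δ₀-c²x² : ∀ x → δ₀ (c ⊙ c ⊙ (x ⊙ x)) ≡ δ₀ x
  δ₀-c²x² x = trans (δ₀-⊙ (⊙-nonzero c≢0 c≢0) (x ⊙ x)) (δ₀-square x)

  χ-⊖four : χ (⊖ 4#) ≡ η
  χ-⊖four = trans (χ-⊖ 4#) (trans (cong (η *_) χ-four) (ℤP.*-identityʳ η))

  ∑-δ₀-sq : ∀ x → ∑ (λ y → δ₀ (sq x y)) ≡ 1ℤ + η * (χ x * χ x)
  ∑-δ₀-sq x = begin
    ∑ (λ y → δ₀ (sq x y))
      ≡⟨ ∑-cong (λ y → 𝟙-cong _ (y ⊙ y ≟ᶠ ⊖ (x ⊙ x))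
           (λ eq → by-hyp eq (solve 2 (λ x y → y :* y := :- (x :* x) :+ con 1ℤ
               :* ((x :* x :+ y :* y) :+ :- con 0ℤ)) refl x y))
           (λ eq → by-hyp eq (solve 2 (λ x y → x :* x :+ y :* y := con 0ℤ :+ con 1ℤ
               :* (y :* y :+ :- (:- (x :* x)))) refl x y))) ⟩
    ∑ (λ y → 𝟙 (y ⊙ y ≟ᶠ ⊖ (x ⊙ x)))
      ≡⟨ ∑-roots _ ⟩
    1ℤ + χ (⊖ (x ⊙ x))
      ≡⟨ cong (λ s → 1ℤ + s) (trans (χ-⊖ (x ⊙ x)) (cong (η *_) (χ-⊙ x x))) ⟩
    1ℤ + η * (χ x * χ x) ∎

  ∑-δ₀-disc : ∀ x → ∑ (λ y → δ₀ (disc x y)) ≡ + 2 * (χ x * χ x)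
  ∑-δ₀-disc x = begin
    ∑ (λ y → δ₀ (disc x y))
      ≡⟨ ∑-cong (λ y → 𝟙-cong _ (c ⊙ c ⊙ (x ⊙ x) ⊙ (y ⊙ y) ≟ᶠ 4#)
           (λ eq → by-hyp eq (solve 2 (λ a b → a := b :+ con 1ℤ :* ((a :+ :- b) :+ :- con 0ℤ))
               refl (c ⊙ c ⊙ (x ⊙ x) ⊙ (y ⊙ y)) 4#))
           (λ eq → by-hyp eq (solve 2 (λ a b → a :+ :- b := con 0ℤ :+ con 1ℤ :* (a :+ :- b))
               refl (c ⊙ c ⊙ (x ⊙ x) ⊙ (y ⊙ y)) 4#))) ⟩
    ∑ (λ y → 𝟙 (c ⊙ c ⊙ (x ⊙ x) ⊙ (y ⊙ y) ≟ᶠ 4#))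
      ≡⟨ ∑-pure-quadratic _ 4# ⟩
    1ℤ - δ₀ (c ⊙ c ⊙ (x ⊙ x)) + χ (c ⊙ c ⊙ (x ⊙ x) ⊙ 4#) + + q * (δ₀ (c ⊙ c ⊙ (x ⊙ x)) * δ₀ 4#)
      ≡⟨ cong₂ (λ s r → 1ℤ - δ₀ (c ⊙ c ⊙ (x ⊙ x)) + s + + q * (δ₀ (c ⊙ c ⊙ (x ⊙ x)) * r))
           (trans (χ-⊙ _ 4#) (cong₂ _*_ (χ-c²x² x) χ-four)) (δ₀-no 4≢0) ⟩
    1ℤ - δ₀ (c ⊙ c ⊙ (x ⊙ x)) + χ x * χ x * 1ℤ + + q * (δ₀ (c ⊙ c ⊙ (x ⊙ x)) * 0ℤ)
      ≡⟨ lem (δ₀ (c ⊙ c ⊙ (x ⊙ x))) (χ x * χ x) (+ q) ⟩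
    (1ℤ - δ₀ (c ⊙ c ⊙ (x ⊙ x))) + χ x * χ x
      ≡⟨ cong (_+ χ x * χ x) (trans (cong (λ s → 1ℤ - s) (δ₀-c²x² x)) (sym (χ²≡1-δ₀ x))) ⟩
    χ x * χ x + χ x * χ x
      ≡⟨ lem′ (χ x * χ x) ⟩
    + 2 * (χ x * χ x) ∎
    where
    lem : ∀ d s n → 1ℤ - d + s * 1ℤ + n * (d * 0ℤ) ≡ 1ℤ - d + s
    lem = solve-∀
    lem′ : ∀ s → s + s ≡ + 2 * s
    lem′ = solve-∀

  -- `R` counts the common zeros of `sq` and `disc`; their first coordinates solve c² x⁴ = -4, the
  -- equation counted by `M`. All vertex counts are expressed through q, η, `G`, `R` and the sum `W`
  -- below.
  G R M : ℤ
  G = ∑ g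
  R = ∑ λ x → ∑ λ y → δ₀ (sq x y) * δ₀ (disc x y)
  M = ∑ λ x → δ₀ (c ⊙ c ⊙ (x ⊙ x ⊙ (x ⊙ x)) ⊕ 4#)

  g-zero : g 0# ≡ 1ℤ
  g-zero = trans (cong χ (solve 1 (λ c → c :* c :* (con 0ℤ :* con 0ℤ :* (con 0ℤ :* con 0ℤ))
      :+ con (+ 4) := con (+ 4)) refl c)) χ-four

  ∑-*-χ² : (f : F → ℤ) → ∑ (λ x → f x * (χ x * χ x)) ≡ ∑ f - f 0#
  ∑-*-χ² f = begin
    ∑ (λ x → f x * (χ x * χ x)) ≡⟨ ∑-cong (λ x → trans (cong (f x *_) (χ²≡1-δ₀ x)) (lem (f x) (δ₀ x))) ⟩
    ∑ (λ x → f x - δ₀ x * f x)  ≡⟨ trans (∑-minus _ _) (cong (λ s → ∑ f - s) (∑-δ₀ f)) ⟩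
    ∑ f - f 0# ∎
    where
    lem : ∀ a d → a * (1ℤ - d) ≡ a - d * a
    lem = solve-∀

  ∑-g-χ² : ∑ (λ x → g x * (χ x * χ x)) ≡ G - 1ℤ
  ∑-g-χ² = trans (∑-*-χ² g) (cong (λ s → G - s) g-zero)

  disc≡-on-sq : ∀ x y → sq x y ≡ 0# → disc x y ≡ ⊖ (c ⊙ c ⊙ (x ⊙ x ⊙ (x ⊙ x)) ⊕ 4#)
  disc≡-on-sq x y eq = by-hyp eq (solve 3 (λ c x y → c :* c :* (x :* x) :* (y :* y) :+ :- con (+ 4)
    := :- (c :* c :* (x :* x :* (x :* x)) :+ con (+ 4)) :+ c :* c :* (x :* x)
        :* ((x :* x :+ y :* y) :+ :- con 0ℤ)) refl c x y)

  ∑χ-disc : ∑ (λ x → ∑ λ y → χ (disc x y)) ≡ + q * η - (+ q - 1ℤ)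
  ∑χ-disc = begin
    ∑ (λ x → ∑ λ y → χ (disc x y))
      ≡⟨ ∑-cong (λ x → trans (∑χ-quadratic (c ⊙ c ⊙ (x ⊙ x)) (⊖ 4#))
           (trans (cong₂ (λ s d → - s + + q * (s * d) + + q * (χ (⊖ 4#) * δ₀ (c ⊙ c ⊙ (x ⊙ x))))
               (χ-c²x² x) (δ₀-no (⊖-nonzero 4≢0)))
           (trans (cong₂ (λ s d → - (χ x * χ x) + + q * (χ x * χ x * 0ℤ) + + q * (s * d)) χ-⊖four
               (δ₀-c²x² x))
             (lem (χ x * χ x) (+ q) η (δ₀ x))))) ⟩
    ∑ (λ x → + q * η * δ₀ x - χ x * χ x)
      ≡⟨ trans (∑-minus _ _) (cong₂ _-_ (trans (∑-*ˡ (+ q * η) _)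
          (trans (cong (+ q * η *_) (∑-δ-one 0#)) (ℤP.*-identityʳ (+ q * η)))) ∑χ²) ⟩
    + q * η - (+ q - 1ℤ) ∎
    where
    lem : ∀ s n e d → - s + n * (s * 0ℤ) + n * (e * d) ≡ n * e * d - s
    lem = solve-∀

  ∑χ-disc-on-sq : ∑ (λ x → ∑ λ y → δ₀ (sq x y) * χ (disc x y)) ≡ η * (G + η * (G - 1ℤ))
  ∑χ-disc-on-sq = begin
    ∑ (λ x → ∑ λ y → δ₀ (sq x y) * χ (disc x y))
      ≡⟨ ∑-cong (λ x → trans (∑-𝟙-const (λ y → sq x y ≟ᶠ 0#) (η * g x) λ y eq →
          trans (cong χ (disc≡-on-sq x y eq)) (χ-⊖ _))
           (trans (cong (_* (η * g x)) (∑-δ₀-sq x)) (lem η (g x) (χ x * χ x)))) ⟩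
    ∑ (λ x → η * (g x + η * (g x * (χ x * χ x))))
      ≡⟨ trans (∑-*ˡ η _) (cong (η *_) (trans (∑-+ g _) (cong (λ s → G + s)
          (trans (∑-*ˡ η _) (cong (η *_) ∑-g-χ²))))) ⟩
    η * (G + η * (G - 1ℤ)) ∎
    where
    lem : ∀ e g s → (1ℤ + e * s) * (e * g) ≡ e * (g + e * (g * s))
    lem = solve-∀

  disc-zero⇒nonzero : ∀ x y → disc x y ≡ 0# → x ≢ 0#
  disc-zero⇒nonzero x y eq refl = 4≢0 (by-hyp eq (solve 2 (λ c y → con (+ 4) := con 0ℤ
    :+ :- con 1ℤ :* ((c :* c :* (con 0ℤ :* con 0ℤ) :* (y :* y) :+ :- con (+ 4)) :+ :- con 0ℤ))
        refl c y))

  ∑χ-sq-on-disc : ∑ (λ x → ∑ λ y → δ₀ (disc x y) * χ (sq x y)) ≡ + 2 * (G - 1ℤ)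
  ∑χ-sq-on-disc = begin
    ∑ (λ x → ∑ λ y → δ₀ (disc x y) * χ (sq x y))
      ≡⟨ ∑-cong (λ x → trans (∑-𝟙-const (λ y → disc x y ≟ᶠ 0#) (g x) (value x))
           (trans (cong (_* g x) (∑-δ₀-disc x)) (lem (g x) (χ x * χ x)))) ⟩
    ∑ (λ x → + 2 * (g x * (χ x * χ x)))
      ≡⟨ trans (∑-*ˡ (+ 2) _) (cong (+ 2 *_) ∑-g-χ²) ⟩
    + 2 * (G - 1ℤ) ∎
    where
    lem : ∀ g s → + 2 * s * g ≡ + 2 * (g * s)
    lem = solve-∀
    value : ∀ x y → disc x y ≡ 0# → χ (sq x y) ≡ g x
    value x y eq = trans (sym (χ-square-⊙ (⊙-nonzero c≢0 (disc-zero⇒nonzero x y eq)) (sq x y)))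
      (cong χ (by-hyp eq (solve 3 (λ c x y → c :* x :* (c :* x) :* (x :* x :+ y :* y)
        := (c :* c :* (x :* x :* (x :* x)) :+ con (+ 4)) :+ con 1ℤ
            :* ((c :* c :* (x :* x) :* (y :* y) :+ :- con (+ 4)) :+ :- con 0ℤ)) refl c x y)))

  -- The number of solutions.

  Solution : F → F → F → F → Set
  Solution x y z t = x ⊙ x ⊕ y ⊙ y ⊕ z ⊙ z ⊕ t ⊙ t ≡ c ⊙ x ⊙ y ⊙ z ⊙ t

  solution? : ∀ x y z t → Dec (Solution x y z t)
  solution? x y z t = _ ≟ᶠ _

  ∑²-const : ∀ k → ∑ {q} (λ _ → ∑ {q} (λ _ → k)) ≡ + q * (+ q * k)
  ∑²-const k = trans (∑-cong λ _ → ∑-const q k) (∑-const q _)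

  χ-square-disc : ∀ x y z → χ (c ⊙ x ⊙ y ⊙ z ⊙ (c ⊙ x ⊙ y ⊙ z) ⊕ ⊖ (4# ⊙ (x ⊙ x ⊕ y ⊙ y ⊕ z ⊙ z)))
                            ≡ χ (disc x y ⊙ (z ⊙ z) ⊕ (⊖ 4#) ⊙ sq x y)
  χ-square-disc x y z = cong χ (solve 4 (λ c x y z → c :* x :* y :* z :* (c :* x :* y :* z) :+ :-
      (con (+ 4) :* (x :* x :+ y :* y :+ z :* z))
      := (c :* c :* (x :* x) :* (y :* y) :+ :- con (+ 4)) :* (z :* z) :+ (:- con (+ 4))
          :* (x :* x :+ y :* y)) refl c x y z)

  -- As a quadratic in t the equation has discriminant `disc x y` z² - 4 `sq x y`, which
  -- `∑χ-quadratic` sums over z. Two of the three resulting terms are confined to the zeros of `sq`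
  -- and of `disc`, where they reduce to `g`; the other one is elementary.
  ∑-solutions : ∑⁴ (λ x y z t → 𝟙 (solution? x y z t))
              ≡ + q * + q * + q + (+ q - 1ℤ) - + q * η + + q * (η * (G + η * (G - 1ℤ))) + + q * η
                  * (+ 2 * (G - 1ℤ))
  ∑-solutions = begin
    ∑⁴ (λ x y z t → 𝟙 (solution? x y z t))
      ≡⟨ ∑-cong₂ (λ x y → trans (∑-cong λ z → trans (∑-monic-quadratic
          (c ⊙ x ⊙ y ⊙ z) (x ⊙ x ⊕ y ⊙ y ⊕ z ⊙ z))
                                       (cong (λ s → 1ℤ + s) (χ-square-disc x y z)))
           (trans (∑-+ _ _) (trans (cong₂ _+_ (∑-one q) (∑χ-quadratic (disc x y) ((⊖ 4#) ⊙ sq x y)))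
           (trans (cong₂ (λ d s → + q + (- χ (disc x y) + + q * (χ (disc x y) * d) + + q
               * (s * δ₀ (disc x y))))
                    (δ₀-⊙ (⊖-nonzero 4≢0) (sq x y))
                    (trans (χ-⊙ (⊖ 4#) (sq x y)) (cong (_* χ (sq x y)) χ-⊖four)))
             (lem (+ q) (χ (disc x y)) (δ₀ (sq x y)) η (χ (sq x y)) (δ₀ (disc x y))))))) ⟩
    ∑ (λ x → ∑ λ y → + q - χ (disc x y) + + q * (δ₀ (sq x y) * χ (disc x y)) + + q * η
        * (δ₀ (disc x y) * χ (sq x y)))
      ≡⟨ ∑²-+ _ _ ⟩
    ∑ (λ x → ∑ λ y → + q - χ (disc x y) + + q * (δ₀ (sq x y) * χ (disc x y)))
        + ∑ (λ x → ∑ λ y → + q * η * (δ₀ (disc x y) * χ (sq x y)))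
      ≡⟨ cong₂ _+_ (trans (∑²-+ _ _) (cong₂ _+_
           (trans (∑²-minus _ _) (cong₂ _-_ (∑²-const (+ q)) ∑χ-disc))
           (trans (∑²-* (+ q) _) (cong (+ q *_) ∑χ-disc-on-sq))))
           (trans (∑²-* (+ q * η) _) (cong (+ q * η *_) ∑χ-sq-on-disc)) ⟩
    + q * (+ q * + q) - (+ q * η - (+ q - 1ℤ)) + + q * (η * (G + η * (G - 1ℤ))) + + q * η
        * (+ 2 * (G - 1ℤ))
      ≡⟨ lem′ (+ q) η G ⟩
    + q * + q * + q + (+ q - 1ℤ) - + q * η + + q * (η * (G + η * (G - 1ℤ))) + + q * η
        * (+ 2 * (G - 1ℤ)) ∎
    where
    lem : ∀ n d a e s b → n + (- d + n * (d * a) + n * (e * s * b)) ≡ n - d + n * (a * d) + n * e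
        * (b * s)
    lem = solve-∀
    lem′ : ∀ n e g → n * (n * n) - (n * e - (n - 1ℤ)) + n * (e * (g + e * (g - 1ℤ))) + n * e
        * (+ 2 * (g - 1ℤ))
      ≡ n * n * n + (n - 1ℤ) - n * e + n * (e * (g + e * (g - 1ℤ))) + n * e * (+ 2 * (g - 1ℤ))
    lem′ = solve-∀

  -- Evaluation of `G`, `R` and `M`.

  ∑χ-c²u²⊕ : ∀ {b} → b ≢ 0# → ∑ (λ u → χ (c ⊙ c ⊙ (u ⊙ u) ⊕ b)) ≡ -1ℤ
  ∑χ-c²u²⊕ {b} b≢0 = trans (∑χ-quadratic (c ⊙ c) b) (trans
    (cong₂ (λ d s → - s + + q * (s * d) + + q * (χ b * δ₀ (c ⊙ c))) (δ₀-no b≢0) (χ-square c≢0 refl))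
    (trans (cong (λ d → - 1ℤ + + q * (1ℤ * 0ℤ) + + q * (χ b * d)) (δ₀-no (⊙-nonzero c≢0 c≢0)))
        (lem (+ q) (χ b))))
    where
    lem : ∀ n s → - 1ℤ + n * (1ℤ * 0ℤ) + n * (s * 0ℤ) ≡ -1ℤ
    lem = solve-∀

  -- Grouping by u = x² splits the sum in two: the unweighted part is a quadratic character sum,
  -- worth -1, and the part weighted by χ u is a rescaled T(4).
  G-value : G ≡ -1ℤ + χ c * (χ 2# * T 1#)
  G-value = begin
    ∑ g
      ≡⟨ ∑-square (λ u → χ (c ⊙ c ⊙ (u ⊙ u) ⊕ 4#)) ⟩
    ∑ (λ u → (1ℤ + χ u) * χ (c ⊙ c ⊙ (u ⊙ u) ⊕ 4#))
      ≡⟨ trans (∑-cong λ u → lem (χ u) _) (∑-+ _ _) ⟩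
    ∑ (λ u → χ (c ⊙ c ⊙ (u ⊙ u) ⊕ 4#)) + ∑ (λ u → χ u * χ (c ⊙ c ⊙ (u ⊙ u) ⊕ 4#))
      ≡⟨ cong₂ _+_ (∑χ-c²u²⊕ 4≢0) (trans (∑-scaled-T c≢0 4#) (cong (χ c *_) T-four)) ⟩
    -1ℤ + χ c * (χ 2# * T 1#) ∎
    where
    lem : ∀ s t → (1ℤ + s) * t ≡ t + s * t
    lem = solve-∀

  -- On the common zeros c² x⁴ + 4 = 0, so x ≠ 0, and y² = -x² has 1 + η solutions y for each such
  -- x.
  R≡[1+η]M : R ≡ (1ℤ + η) * M
  R≡[1+η]M = begin
    ∑ (λ x → ∑ λ y → δ₀ (sq x y) * δ₀ (disc x y))
      ≡⟨ ∑-cong (λ x → trans (∑-𝟙-const (λ y → sq x y ≟ᶠ 0#) (r x) λ y eq →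
          trans (cong δ₀ (disc≡-on-sq x y eq)) (δ₀-⊖ _))
           (trans (cong (_* r x) (∑-δ₀-sq x)) (trans (ℤP.*-comm _ (r x)) (𝟙-*-cong (_ ≟ᶠ 0#) λ eq →
             cong (λ s → 1ℤ + s) (trans (cong (η *_) (χ-square² (x≢0 x eq))) (ℤP.*-identityʳ η)))))) ⟩
    ∑ (λ x → r x * (1ℤ + η))
      ≡⟨ trans (∑-*ʳ (1ℤ + η) r) (ℤP.*-comm M (1ℤ + η)) ⟩
    (1ℤ + η) * M ∎
    where
    r : F → ℤ
    r x = δ₀ (c ⊙ c ⊙ (x ⊙ x ⊙ (x ⊙ x)) ⊕ 4#)
    δ₀-⊖ : ∀ a → δ₀ (⊖ a) ≡ δ₀ a
    δ₀-⊖ a = trans (cong δ₀ (solve 1 (λ a → :- a := :- con 1ℤ :* a) refl a)) (δ₀-⊙ (⊖-nonzero 1≢0) a)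
    x≢0 : ∀ x → c ⊙ c ⊙ (x ⊙ x ⊙ (x ⊙ x)) ⊕ 4# ≡ 0# → x ≢ 0#
    x≢0 x eq refl = 4≢0 (by-hyp eq (solve 1 (λ c → con (+ 4) := con 0ℤ
      :+ con 1ℤ :* ((c :* c :* (con 0ℤ :* con 0ℤ :* (con 0ℤ :* con 0ℤ)) :+ con (+ 4)) :+ :- con 0ℤ))
          refl c))

  -- With u = x² the equation reads (c u)² = (2 i)², so c u = ±2 i. Both values have character 1 by
  -- `χ-2i`, hence χ u = χ c, and each of the two u is the square of `1 + χ c` elements.
  M-value : ∀ i → i ⊙ i ≡ ⊖ 1# → M ≡ + 2 * (1ℤ + χ c)
  M-value i i²≡-1 = begin
    M
      ≡⟨ ∑-square (λ u → δ₀ (c ⊙ c ⊙ (u ⊙ u) ⊕ 4#)) ⟩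
    ∑ (λ u → (1ℤ + χ u) * δ₀ (c ⊙ c ⊙ (u ⊙ u) ⊕ 4#))
      ≡⟨ trans (∑-cong λ u → ℤP.*-comm (1ℤ + χ u) _) (∑-𝟙-const
          (λ u → c ⊙ c ⊙ (u ⊙ u) ⊕ 4# ≟ᶠ 0#) (1ℤ + χ c) (λ u eq → cong (λ s → 1ℤ + s) (value u eq))) ⟩
    ∑ (λ u → δ₀ (c ⊙ c ⊙ (u ⊙ u) ⊕ 4#)) * (1ℤ + χ c)
      ≡⟨ cong (_* (1ℤ + χ c)) (trans (∑-cong λ u → 𝟙-cong _ (c ⊙ u ⊙ (c ⊙ u) ≟ᶠ w ⊙ w)
           (λ eq → by-hyps eq i²≡-1 (solve 3 (λ c u i → c :* u :* (c :* u) := con (+ 2) :* i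
               :* (con (+ 2) :* i)
              :+ con 1ℤ :* ((c :* c :* (u :* u) :+ con (+ 4)) :+ :- con 0ℤ) :+ :- con (+ 4)
                  :* (i :* i :+ :- (:- con 1ℤ))) refl c u i))
           (λ eq → by-hyps eq i²≡-1 (solve 3 (λ c u i → c :* c :* (u :* u) :+ con (+ 4) := con 0ℤ
              :+ con 1ℤ :* (c :* u :* (c :* u) :+ :- (con (+ 2) :* i :* (con (+ 2) :* i)))
                  :+ con (+ 4) :* (i :* i :+ :- (:- con 1ℤ))) refl c u i)))
           (trans (∑-scale c≢0 (λ v → 𝟙 (v ⊙ v ≟ᶠ w ⊙ w))) (trans (∑-roots (w ⊙ w))
               (cong (λ s → 1ℤ + s) (χ-square w≢0 refl))))) ⟩
    + 2 * (1ℤ + χ c) ∎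
    where
    w : F
    w = 2# ⊙ i
    χw : χ w ≡ 1ℤ
    χw = χ-2i i i²≡-1
    w≢0 : w ≢ 0#
    w≢0 w≡0 with () ← trans (sym (χ-zero w≡0)) χw
    χ-⊖w : χ (⊖ w) ≡ 1ℤ
    χ-⊖w = trans (cong χ (solve 1 (λ i → :- (con (+ 2) :* i) := con (+ 2) :* (:- i)) refl i))
        (χ-2i (⊖ i)
      (trans (solve 1 (λ i → :- i :* :- i := i :* i) refl i) i²≡-1))
    value : ∀ u → c ⊙ c ⊙ (u ⊙ u) ⊕ 4# ≡ 0# → χ u ≡ χ c
    value u eq = begin
      χ u             ≡⟨ ℤP.*-identityˡ (χ u) ⟨
      1ℤ * χ u        ≡⟨ cong (_* χ u) (χ-square² c≢0) ⟨
      χ c * χ c * χ u ≡⟨ ℤP.*-assoc (χ c) (χ c) (χ u) ⟩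
      χ c * (χ c * χ u) ≡⟨ cong (χ c *_) (trans (sym (χ-⊙ c u)) χcu) ⟩
      χ c * 1ℤ        ≡⟨ ℤP.*-identityʳ (χ c) ⟩
      χ c ∎
      where
      χcu : χ (c ⊙ u) ≡ 1ℤ
      χcu with square-≡ {c ⊙ u} {w} (by-hyps eq i²≡-1 (solve
          3 (λ c u i → c :* u :* (c :* u) := con (+ 2) :* i :* (con (+ 2) :* i)
              :+ con 1ℤ :* ((c :* c :* (u :* u) :+ con (+ 4)) :+ :- con 0ℤ) :+ :- con (+ 4)
                  :* (i :* i :+ :- (:- con 1ℤ))) refl c u i))
      ... | inj₁ cu≡w = trans (cong χ cu≡w) χw
      ... | inj₂ cu≡-w = trans (cong χ cu≡-w) χ-⊖w

  -- The character sum of the product of `disc` and `sq`.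

  W : ℤ
  W = ∑ λ x → ∑ λ y → χ (disc x y) * χ (sq x y)

  private
    -- With w = x y, `h w` is the character of `disc x y`, and `k x w` is that of x² `sq x y`.
    h : F → ℤ
    h w = χ (c ⊙ c ⊙ (w ⊙ w) ⊕ ⊖ 4#)
    k : F → F → ℤ
    k x w = χ (x ⊙ x ⊙ (x ⊙ x) ⊕ w ⊙ w)

  -- As (χ x)² = χ (x²), grouping by u = x² applies. It yields T(w²), which is `χ w * T 1#`, and a
  -- quadratic character sum without its term at u = 0.
  ∑-χ²-k : ∀ w → ∑ (λ x → χ x * χ x * k x w) ≡ χ w * T 1# - + 2 + (+ q + 1ℤ) * δ₀ w
  ∑-χ²-k w = begin
    ∑ (λ x → χ x * χ x * k x w)
      ≡⟨ ∑-cong (λ x → cong (_* k x w) (sym (χ-⊙ x x))) ⟩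
    ∑ (λ x → χ (x ⊙ x) * k x w)
      ≡⟨ ∑-square (λ u → χ u * χ (u ⊙ u ⊕ w ⊙ w)) ⟩
    ∑ (λ u → (1ℤ + χ u) * (χ u * χ (u ⊙ u ⊕ w ⊙ w)))
      ≡⟨ trans (∑-cong λ u → lem (χ u) (χ (u ⊙ u ⊕ w ⊙ w))) (∑-+ _ _) ⟩
    T (w ⊙ w) + ∑ (λ u → χ (u ⊙ u ⊕ w ⊙ w) * (χ u * χ u))
      ≡⟨ cong₂ _+_ (T-square w) (trans (∑-*-χ² _) (cong₂ _-_ (∑χ-square-shift (w ⊙ w))
          (trans (cong χ (⊕-0² w)) (χ-⊙ w w)))) ⟩
    χ w * T 1# + (-1ℤ + + q * δ₀ (w ⊙ w) - χ w * χ w)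
      ≡⟨ cong₂ (λ d s → χ w * T 1# + (-1ℤ + + q * d - s)) (δ₀-square w) (χ²≡1-δ₀ w) ⟩
    χ w * T 1# + (-1ℤ + + q * δ₀ w - (1ℤ - δ₀ w))
      ≡⟨ lem′ (χ w * T 1#) (+ q) (δ₀ w) ⟩
    χ w * T 1# - + 2 + (+ q + 1ℤ) * δ₀ w ∎
    where
    lem : ∀ s t → (1ℤ + s) * (s * t) ≡ s * t + t * (s * s)
    lem = solve-∀
    lem′ : ∀ a n d → a + (-1ℤ + n * d - (1ℤ - d)) ≡ a - + 2 + (n + 1ℤ) * d
    lem′ = solve-∀
    ⊕-0² : ∀ w → 0# ⊙ 0# ⊕ w ⊙ w ≡ w ⊙ w
    ⊕-0² = solve 1 (λ w → con 0ℤ :* con 0ℤ :+ w :* w := w :* w) refl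

  -- The substitution w = x y makes the first factor independent of x.
  W-row : ∀ x → ∑ (λ y → χ (disc x y) * χ (sq x y))
              ≡ δ₀ x * (η * (+ q - 1ℤ)) + χ x * χ x * ∑ (λ w → h w * k x w)
  W-row x with x ≟ᶠ 0#
  ... | yes refl = begin
    ∑ (λ y → χ (disc 0# y) * χ (sq 0# y))
      ≡⟨ ∑-cong (λ y → cong₂ _*_ (trans (cong χ (solve
          2 (λ c y → c :* c :* (con 0ℤ :* con 0ℤ) :* (y :* y) :+ :- con (+ 4) := :- con (+ 4))
          refl c y)) χ-⊖four)
           (trans (cong χ (solve 1 (λ y → con 0ℤ :* con 0ℤ :+ y :* y := y :* y) refl y)) (χ-⊙ y y))) ⟩
    ∑ (λ y → η * (χ y * χ y))
      ≡⟨ trans (∑-*ˡ η _) (cong (η *_) ∑χ²) ⟩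
    η * (+ q - 1ℤ)
      ≡⟨ lem (η * (+ q - 1ℤ)) (∑ λ w → h w * k 0# w) ⟩
    1ℤ * (η * (+ q - 1ℤ)) + 0ℤ * 0ℤ * ∑ (λ w → h w * k 0# w)
      ≡⟨ cong₂ (λ d s → d * (η * (+ q - 1ℤ)) + s * s * ∑ (λ w → h w * k 0# w)) (𝟙-yes (yes refl) refl)
          (χ-zero refl) ⟨
    𝟙 (yes refl) * (η * (+ q - 1ℤ)) + χ 0# * χ 0# * ∑ (λ w → h w * k 0# w) ∎
    where
    lem : ∀ a b → a ≡ 1ℤ * a + 0ℤ * 0ℤ * b
    lem = solve-∀
  ... | no x≢0 = begin
    ∑ (λ y → χ (disc x y) * χ (sq x y))
      ≡⟨ ∑-cong (λ y → cong₂ (λ d s → χ d * s)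
           (solve 3 (λ c x y → c :* c :* (x :* x) :* (y :* y) :+ :- con (+ 4) := c :* c
               :* (x :* y :* (x :* y)) :+ :- con (+ 4)) refl c x y)
           (trans (sym (χ-square-⊙ x≢0 (sq x y))) (cong χ
             (solve 2 (λ x y → x :* x :* (x :* x :+ y :* y) := x :* x :* (x :* x) :+ x :* y
                 :* (x :* y)) refl x y)))) ⟩
    ∑ (λ y → h (x ⊙ y) * k x (x ⊙ y))
      ≡⟨ ∑-scale x≢0 (λ w → h w * k x w) ⟩
    ∑ (λ w → h w * k x w)
      ≡⟨ lem (η * (+ q - 1ℤ)) _ ⟩
    0ℤ * (η * (+ q - 1ℤ)) + 1ℤ * ∑ (λ w → h w * k x w)
      ≡⟨ cong₂ (λ d s → d * (η * (+ q - 1ℤ)) + s * ∑ (λ w → h w * k x w)) (𝟙-no (no x≢0) x≢0)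
          (χ-square² x≢0) ⟨
    𝟙 (no x≢0) * (η * (+ q - 1ℤ)) + χ x * χ x * ∑ (λ w → h w * k x w) ∎
    where
    lem : ∀ a b → b ≡ 0ℤ * a + 1ℤ * b
    lem = solve-∀

  -- The sum over x is taken at fixed w = x y: `∑-χ²-k` leaves `χ w * T 1#` and elementary terms,
  -- and `χ w * h w` summed over w gives χ c T(-4). Hence a product of two Jacobsthal sums.
  W-value : W ≡ + 2 * + q * η + + 2 + T 1# * (χ c * T (⊖ 4#))
  W-value = begin
    W
      ≡⟨ ∑-cong W-row ⟩
    ∑ (λ x → δ₀ x * (η * (+ q - 1ℤ)) + χ x * χ x * ∑ (λ w → h w * k x w))
      ≡⟨ trans (∑-+ _ _) (cong₂ _+_ (∑-δ₀ (λ _ → η * (+ q - 1ℤ)))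
           (trans (∑-cong λ x → trans (sym (∑-*ˡ (χ x * χ x) _))
               (∑-cong λ w → lem₁ (χ x * χ x) (h w) (k x w)))
             (trans (∑-comm _) (∑-cong λ w → trans (∑-*ˡ (h w) _)
                 (trans (cong (h w *_) (∑-χ²-k w)) (lem₂ (h w) (χ w) (T 1#) (+ q) (δ₀ w))))))) ⟩
    η * (+ q - 1ℤ) + ∑ (λ w → T 1# * (χ w * h w) - + 2 * h w + (+ q + 1ℤ) * (δ₀ w * h w))
      ≡⟨ cong (λ s → η * (+ q - 1ℤ) + s) (trans (∑-+ _ _) (cong₂ _+_
           (trans (∑-minus _ _) (cong₂ _-_
             (trans (∑-*ˡ (T 1#) _) (cong (T 1# *_) (∑-scaled-T c≢0 (⊖ 4#))))
             (trans (∑-*ˡ (+ 2) h) (cong (+ 2 *_) (∑χ-c²u²⊕ (⊖-nonzero 4≢0))))))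
           (trans (∑-*ˡ (+ q + 1ℤ) _) (cong ((+ q + 1ℤ) *_) (trans (∑-δ₀ h) h0))))) ⟩
    η * (+ q - 1ℤ) + (T 1# * (χ c * T (⊖ 4#)) - + 2 * -1ℤ + (+ q + 1ℤ) * η)
      ≡⟨ lem₃ η (+ q) (T 1# * (χ c * T (⊖ 4#))) ⟩
    + 2 * + q * η + + 2 + T 1# * (χ c * T (⊖ 4#)) ∎
    where
    h0 : h 0# ≡ η
    h0 = trans (cong χ (solve 1 (λ c → c :* c :* (con 0ℤ :* con 0ℤ) :+ :- con (+ 4) := :- con (+ 4))
        refl c)) χ-⊖four
    lem₁ : ∀ a b d → a * (b * d) ≡ b * (a * d)
    lem₁ = solve-∀
    lem₂ : ∀ h s t n d → h * (s * t - + 2 + (n + 1ℤ) * d) ≡ t * (s * h) - + 2 * h + (n + 1ℤ) * (d * h)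
    lem₂ = solve-∀
    lem₃ : ∀ e n a → e * (n - 1ℤ) + (a - + 2 * -1ℤ + (n + 1ℤ) * e) ≡ + 2 * n * e + + 2 + a
    lem₃ = solve-∀

  -- Solutions with prescribed fixed coordinates.

  fixed : F → F → F → F → ℤ
  fixed x y z t = 𝟙 (2# ⊙ x ≟ᶠ c ⊙ y ⊙ z ⊙ t)

  sol : F → F → F → F → ℤ
  sol x y z t = 𝟙 (solution? x y z t)

  ∑-disc≡0 : ∑ (λ x → ∑ λ y → δ₀ (disc x y)) ≡ + 2 * (+ q - 1ℤ)
  ∑-disc≡0 = trans (∑-cong ∑-δ₀-disc) (trans (∑-*ˡ (+ 2) _) (cong (+ 2 *_) ∑χ²))

  -- If t is fixed, then t = c x y z / 2 is a double root, so the equation says that its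
  -- discriminant in t vanishes: `disc x y` z² = 4 `sq x y`, a pure quadratic in z.
  ∑-fixed₁ : ∑⁴ (λ x y z t → sol x y z t * fixed t x y z) ≡ + q * + q - + 2 * (+ q - 1ℤ) + W + + q * R
  ∑-fixed₁ = begin
    ∑⁴ (λ x y z t → sol x y z t * fixed t x y z)
      ≡⟨ ∑-cong₂ (λ x y → trans (∑-cong λ z → trans (∑-cong λ t → split x y z t)
           (trans (∑-*ˡ (𝟙 (disc x y ⊙ (z ⊙ z) ≟ᶠ 4# ⊙ sq x y)) _)
               (trans (cong (𝟙 (disc x y ⊙ (z ⊙ z) ≟ᶠ 4# ⊙ sq x y) *_) (∑-linear 2≢0 _))
               (ℤP.*-identityʳ _))))
           (trans (∑-pure-quadratic (disc x y) (4# ⊙ sq x y))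
             (trans (cong₂ (λ s d → 1ℤ - δ₀ (disc x y) + s + + q * (δ₀ (disc x y) * d))
               (trans (χ-⊙ (disc x y) (4# ⊙ sq x y)) (cong (χ (disc x y) *_)
                   (trans (χ-⊙ 4# (sq x y)) (trans (cong (_* χ (sq x y)) χ-four)
                   (ℤP.*-identityˡ (χ (sq x y)))))))
               (δ₀-⊙ 4≢0 (sq x y)))
               (cong (λ s → 1ℤ - δ₀ (disc x y) + χ (disc x y) * χ (sq x y) + + q * s)
                   (ℤP.*-comm (δ₀ (disc x y)) (δ₀ (sq x y))))))) ⟩
    ∑ (λ x → ∑ λ y → 1ℤ - δ₀ (disc x y) + χ (disc x y) * χ (sq x y) + + q
        * (δ₀ (sq x y) * δ₀ (disc x y)))
      ≡⟨ trans (∑²-+ _ _) (cong₂ _+_ (trans (∑²-+ _ _) (cong (_+ W) (trans (∑²-minus _ _)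
           (cong₂ _-_ (trans (∑²-const 1ℤ) (cong (+ q *_) (ℤP.*-identityʳ (+ q)))) ∑-disc≡0))))
               (∑²-* (+ q) _)) ⟩
    + q * + q - + 2 * (+ q - 1ℤ) + W + + q * R ∎
    where
    split : ∀ x y z t → sol x y z t * fixed t x y z ≡ 𝟙 (disc x y ⊙ (z ⊙ z) ≟ᶠ 4# ⊙ sq x y) * 𝟙
        (2# ⊙ t ≟ᶠ c ⊙ x ⊙ y ⊙ z)
    split x y z t = 𝟙-*-⇔ _ _ _ _
      (λ s f → by-hyps s f (solve 5 (λ c x y z t → (c :* c :* (x :* x) :* (y :* y) :+ :- con (+ 4))
          :* (z :* z) := con (+ 4) :* (x :* x :+ y :* y)
         :+ :- con (+ 4) :* ((x :* x :+ y :* y :+ z :* z :+ t :* t) :+ :- (c :* x :* y :* z :* t))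
         :+ (con (+ 2) :* t :+ :- (c :* x :* y :* z)) :* (con (+ 2) :* t :+ :- (c :* x :* y :* z)))
             refl c x y z t) , f)
      (λ d f → ⊙-cancelˡ 4≢0 (by-hyps d f (solve 5 (λ c x y z t → con (+ 4)
          :* (x :* x :+ y :* y :+ z :* z :+ t :* t) := con (+ 4) :* (c :* x :* y :* z :* t)
         :+ :- con 1ℤ :* ((c :* c :* (x :* x) :* (y :* y) :+ :- con (+ 4)) :* (z :* z) :+ :-
             (con (+ 4) :* (x :* x :+ y :* y)))
         :+ (con (+ 2) :* t :+ :- (c :* x :* y :* z)) :* (con (+ 2) :* t :+ :- (c :* x :* y :* z)))
             refl c x y z t)) , f)

  -- The two conditions give 2 z² = 2 t² = c x y z t, so z² + t² cancels the right-hand side of the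
  -- equation and x² + y² = 0 remains. Eliminating t from the condition on z gives `disc x y` z = 0.
  sol-fixed₂ : ∀ x y z t → sol x y z t * fixed z x y t * fixed t x y z
             ≡ δ₀ (sq x y) * (𝟙 (disc x y ⊙ z ≟ᶠ 0#) * 𝟙 (2# ⊙ t ≟ᶠ c ⊙ x ⊙ y ⊙ z))
  sol-fixed₂ x y z t = trans
    (𝟙-⇔³ (solution? x y z t) (2# ⊙ z ≟ᶠ c ⊙ x ⊙ y ⊙ t) (2# ⊙ t ≟ᶠ c ⊙ x ⊙ y ⊙ z)
          (sq x y ≟ᶠ 0#) ((disc x y ⊙ z ≟ᶠ 0#) ×-dec (2# ⊙ t ≟ᶠ c ⊙ x ⊙ y ⊙ z))
       (λ s fz ft → ⊙-cancelˡ 2≢0 (by-hyp s (by-hyps fz ft (solve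
           5 (λ c x y z t → con (+ 2) :* (x :* x :+ y :* y)
            := con (+ 2) :* con 0ℤ :+ con (+ 2) :* ((x :* x :+ y :* y :+ z :* z :+ t :* t)
                :+ :- (c :* x :* y :* z :* t))
               :+ :- z :* (con (+ 2) :* z :+ :- (c :* x :* y :* t)) :+ :- t
                   :* (con (+ 2) :* t :+ :- (c :* x :* y :* z))) refl c x y z t)))
          , by-hyps fz ft (solve 5 (λ c x y z t → (c :* c :* (x :* x) :* (y :* y) :+ :- con (+ 4)) :* z
            := con 0ℤ :+ :- con (+ 2) :* (con (+ 2) :* z :+ :- (c :* x :* y :* t)) :+ :- (c :* x :* y)
                :* (con (+ 2) :* t :+ :- (c :* x :* y :* z))) refl c x y z t)
          , ft)
       (λ m (d , ft) →
            ⊙-cancelˡ 4≢0 (by-hyp m (by-hyps d ft (solve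
                5 (λ c x y z t → con (+ 4) :* (x :* x :+ y :* y :+ z :* z :+ t :* t)
              := con (+ 4) :* (c :* x :* y :* z :* t) :+ con (+ 4) :* ((x :* x :+ y :* y) :+ :- con 0ℤ)
                 :+ :- z :* ((c :* c :* (x :* x) :* (y :* y) :+ :- con (+ 4)) :* z :+ :- con 0ℤ)
                 :+ (con (+ 2) :* t :+ :- (c :* x :* y :* z))
                     :* (con (+ 2) :* t :+ :- (c :* x :* y :* z))) refl c x y z t)))
          , ⊙-cancelˡ 2≢0 (by-hyps d ft (solve 5 (λ c x y z t → con (+ 2) :* (con (+ 2) :* z)
              := con (+ 2) :* (c :* x :* y :* t)
                 :+ :- con 1ℤ :* ((c :* c :* (x :* x) :* (y :* y) :+ :- con (+ 4)) :* z :+ :- con 0ℤ)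
                 :+ :- (c :* x :* y) :* (con (+ 2) :* t :+ :- (c :* x :* y :* z))) refl c x y z t))
          , ft))
    (cong (δ₀ (sq x y) *_) (𝟙-× _ _))

  ∑-annihilated : ∀ d → ∑ (λ z → 𝟙 (d ⊙ z ≟ᶠ 0#)) ≡ 1ℤ + (+ q - 1ℤ) * δ₀ d
  ∑-annihilated d with d ≟ᶠ 0#
  ... | yes refl = trans (∑-cong λ z → 𝟙-yes (0# ⊙ z ≟ᶠ 0#) (⊙-zeroˡ z)) (trans (∑-one q)
    (trans (lem (+ q)) (cong (λ s → 1ℤ + (+ q - 1ℤ) * s) (sym (𝟙-yes (yes refl) refl)))))
    where
    lem : ∀ n → n ≡ 1ℤ + (n - 1ℤ) * 1ℤ
    lem = solve-∀
  ... | no d≢0 = trans (∑-linear d≢0 0#) (trans (lem (+ q)) (cong (λ s → 1ℤ + (+ q - 1ℤ) * s)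
      (sym (𝟙-no (no d≢0) d≢0))))
    where
    lem : ∀ n → 1ℤ ≡ 1ℤ + (n - 1ℤ) * 0ℤ
    lem = solve-∀

  ∑-sq≡0 : ∑ (λ x → ∑ λ y → δ₀ (sq x y)) ≡ + q + η * (+ q - 1ℤ)
  ∑-sq≡0 = trans (∑-cong ∑-δ₀-sq) (trans (∑-+ _ _) (cong₂ _+_ (∑-one q)
      (trans (∑-*ˡ η _) (cong (η *_) ∑χ²))))

  ∑-fixed₂ : ∑⁴ (λ x y z t → sol x y z t * fixed z x y t * fixed t x y z) ≡ + q + η * (+ q - 1ℤ)
      + (+ q - 1ℤ) * R
  ∑-fixed₂ = begin
    ∑⁴ (λ x y z t → sol x y z t * fixed z x y t * fixed t x y z)
      ≡⟨ ∑-cong₂ (λ x y → begin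
           ∑ (λ z → ∑ λ t → sol x y z t * fixed z x y t * fixed t x y z)
             ≡⟨ ∑-cong₂ (λ z t → sol-fixed₂ x y z t) ⟩
           ∑ (λ z → ∑ λ t → δ₀ (sq x y) * (𝟙 (disc x y ⊙ z ≟ᶠ 0#) * 𝟙 (2# ⊙ t ≟ᶠ c ⊙ x ⊙ y ⊙ z)))
             ≡⟨ ∑²-* (δ₀ (sq x y)) _ ⟩
           δ₀ (sq x y) * ∑ (λ z → ∑ λ t → 𝟙 (disc x y ⊙ z ≟ᶠ 0#) * 𝟙 (2# ⊙ t ≟ᶠ c ⊙ x ⊙ y ⊙ z))
             ≡⟨ cong (δ₀ (sq x y) *_) (trans (∑-cong λ z → ∑-*-one (𝟙 (disc x y ⊙ z ≟ᶠ 0#))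
                 (∑-linear 2≢0 (c ⊙ x ⊙ y ⊙ z))) (∑-annihilated (disc x y))) ⟩
           δ₀ (sq x y) * (1ℤ + (+ q - 1ℤ) * δ₀ (disc x y))
             ≡⟨ lem (δ₀ (sq x y)) (+ q) (δ₀ (disc x y)) ⟩
           δ₀ (sq x y) + (+ q - 1ℤ) * (δ₀ (sq x y) * δ₀ (disc x y)) ∎) ⟩
    ∑ (λ x → ∑ λ y → δ₀ (sq x y) + (+ q - 1ℤ) * (δ₀ (sq x y) * δ₀ (disc x y)))
      ≡⟨ trans (∑²-+ _ _) (cong₂ _+_ ∑-sq≡0 (∑²-* (+ q - 1ℤ) _)) ⟩
    + q + η * (+ q - 1ℤ) + (+ q - 1ℤ) * R ∎
    where
    lem : ∀ a n d → a * (1ℤ + (n - 1ℤ) * d) ≡ a + (n - 1ℤ) * (a * d)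
    lem = solve-∀

  -- If `disc x y` = 0, the conditions amount to z² = y², which has two roots since y ≠ 0, and t is
  -- determined by z. Otherwise the conditions on z and t force z = t = 0, and then y = 0. The two
  -- terms never overlap, as `disc x y` = 0 excludes y = 0.
  ∑-fixed-yzt : ∀ x y → ∑ (λ z → ∑ λ t → fixed y x z t * fixed z x y t * fixed t x y z) ≡ δ₀ y + + 2
      * δ₀ (disc x y)
  ∑-fixed-yzt x y with disc x y ≟ᶠ 0#
  ... | yes D≡0 = begin
    ∑ (λ z → ∑ λ t → fixed y x z t * fixed z x y t * fixed t x y z)
      ≡⟨ ∑-cong₂ (λ z t → 𝟙-⇔³ _ _ _ (z ⊙ z ≟ᶠ y ⊙ y) (2# ⊙ t ≟ᶠ c ⊙ x ⊙ y ⊙ z)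
           (λ fy fz ft → z²≡y² z (⊙-cancelˡ y≢0 (by-hyps fy ft
               (solve 5 (λ c x y z t → y :* (c :* c :* (x :* x) :* (z :* z)) := y :* con (+ 4)
               :+ :- con (+ 2) :* (con (+ 2) :* y :+ :- (c :* x :* z :* t)) :+ :- (c :* x :* z)
                   :* (con (+ 2) :* t :+ :- (c :* x :* y :* z))) refl c x y z t))) , ft)
           (λ zz ft →
               ⊙-cancelˡ 2≢0 (by-hyp D≡0 (by-hyps zz ft (solve
                   5 (λ c x y z t → con (+ 2) :* (con (+ 2) :* y) := con (+ 2) :* (c :* x :* z :* t)
                 :+ :- y :* ((c :* c :* (x :* x) :* (y :* y) :+ :- con (+ 4)) :+ :- con 0ℤ)
                 :+ :- (c :* c :* (x :* x) :* y) :* (z :* z :+ :- (y :* y))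
                 :+ :- (c :* x :* z) :* (con (+ 2) :* t :+ :- (c :* x :* y :* z))) refl c x y z t)))
             , ⊙-cancelˡ 2≢0 (by-hyps D≡0 ft (solve 5 (λ c x y z t → con (+ 2) :* (con (+ 2) :* z)
                 := con (+ 2) :* (c :* x :* y :* t)
                 :+ :- z :* ((c :* c :* (x :* x) :* (y :* y) :+ :- con (+ 4)) :+ :- con 0ℤ)
                 :+ :- (c :* x :* y) :* (con (+ 2) :* t :+ :- (c :* x :* y :* z))) refl c x y z t))
             , ft)) ⟩
    ∑ (λ z → ∑ λ t → 𝟙 (z ⊙ z ≟ᶠ y ⊙ y) * 𝟙 (2# ⊙ t ≟ᶠ c ⊙ x ⊙ y ⊙ z))
      ≡⟨ ∑-cong (λ z → ∑-*-one (𝟙 (z ⊙ z ≟ᶠ y ⊙ y)) (∑-linear 2≢0 (c ⊙ x ⊙ y ⊙ z))) ⟩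
    ∑ (λ z → 𝟙 (z ⊙ z ≟ᶠ y ⊙ y))
      ≡⟨ trans (∑-roots (y ⊙ y)) (cong (λ s → 1ℤ + s) (χ-square y≢0 refl)) ⟩
    + 2
      ≡⟨ cong₂ (λ d e → d + + 2 * e) (δ₀-no y≢0) (𝟙-yes (yes D≡0) D≡0) ⟨
    δ₀ y + + 2 * 𝟙 (yes D≡0) ∎
    where
    x≢0 : x ≢ 0#
    x≢0 = disc-zero⇒nonzero x y D≡0
    y≢0 : y ≢ 0#
    y≢0 = disc-zero⇒nonzero y x (trans (solve 3 (λ c x y → c :* c :* (y :* y) :* (x :* x) :+ :-
        con (+ 4) := c :* c :* (x :* x) :* (y :* y) :+ :- con (+ 4)) refl c x y) D≡0)
    z²≡y² : ∀ z → c ⊙ c ⊙ (x ⊙ x) ⊙ (z ⊙ z) ≡ 4# → z ⊙ z ≡ y ⊙ y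
    z²≡y² z eq = ⊙-cancelˡ (⊙-nonzero (⊙-nonzero c≢0 c≢0) (⊙-nonzero x≢0 x≢0)) (by-hyps eq D≡0
      (solve 4 (λ c x y z → c :* c :* (x :* x) :* (z :* z) := c :* c :* (x :* x) :* (y :* y)
        :+ con 1ℤ :* (c :* c :* (x :* x) :* (z :* z) :+ :- con (+ 4))
        :+ :- con 1ℤ :* ((c :* c :* (x :* x) :* (y :* y) :+ :- con (+ 4)) :+ :- con 0ℤ)) refl c x y z))
  ... | no D≢0 = begin
    ∑ (λ z → ∑ λ t → fixed y x z t * fixed z x y t * fixed t x y z)
      ≡⟨ ∑-cong₂ (λ z t → trans (𝟙-⇔³ _ _ _ (y ≟ᶠ 0#) ((z ≟ᶠ 0#) ×-dec (t ≟ᶠ 0#)) (origin z t)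
           (λ { refl (refl , refl) →
               solve 2 (λ c x → con (+ 2) :* con 0ℤ := c :* x :* con 0ℤ :* con 0ℤ) refl c x
             , solve 2 (λ c x → con (+ 2) :* con 0ℤ := c :* x :* con 0ℤ :* con 0ℤ) refl c x
             , solve 2 (λ c x → con (+ 2) :* con 0ℤ := c :* x :* con 0ℤ :* con 0ℤ) refl c x }))
           (cong (δ₀ y *_) (𝟙-× (z ≟ᶠ 0#) (t ≟ᶠ 0#)))) ⟩
    ∑ (λ z → ∑ λ t → δ₀ y * (δ₀ z * δ₀ t))
      ≡⟨ trans (∑²-* (δ₀ y) _) (cong (δ₀ y *_) (trans (∑-cong λ z → ∑-*-one (δ₀ z) (∑-δ-one 0#))
          (∑-δ-one 0#))) ⟩
    δ₀ y * 1ℤ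
      ≡⟨ lem (δ₀ y) ⟩
    δ₀ y + + 2 * 0ℤ
      ≡⟨ cong (λ s → δ₀ y + + 2 * s) (𝟙-no (no D≢0) D≢0) ⟨
    δ₀ y + + 2 * 𝟙 (no D≢0) ∎
    where
    lem : ∀ d → d * 1ℤ ≡ d + + 2 * 0ℤ
    lem = solve-∀
    origin : ∀ z t → 2# ⊙ y ≡ c ⊙ x ⊙ z ⊙ t → 2# ⊙ z ≡ c ⊙ x ⊙ y ⊙ t → 2# ⊙ t ≡ c ⊙ x ⊙ y ⊙ z → y ≡ 0#
        × z ≡ 0# × t ≡ 0#
    origin z t fy fz ft = y≡0 , z≡0 , t≡0
      where
      z≡0 : z ≡ 0#
      z≡0 = ⊙-cancelˡ D≢0 (by-hyps fz ft (solve
          5 (λ c x y z t → (c :* c :* (x :* x) :* (y :* y) :+ :- con (+ 4)) :* z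
            := (c :* c :* (x :* x) :* (y :* y) :+ :- con (+ 4)) :* con 0ℤ
               :+ :- con (+ 2) :* (con (+ 2) :* z :+ :- (c :* x :* y :* t)) :+ :- (c :* x :* y)
                   :* (con (+ 2) :* t :+ :- (c :* x :* y :* z))) refl c x y z t))
      t≡0 : t ≡ 0#
      t≡0 = ⊙-cancelˡ 2≢0 (by-hyps ft z≡0 (solve 5 (λ c x y z t → con (+ 2) :* t := con (+ 2) :* con 0ℤ
               :+ con 1ℤ :* (con (+ 2) :* t :+ :- (c :* x :* y :* z)) :+ c :* x :* y
                   :* (z :+ :- con 0ℤ)) refl c x y z t))
      y≡0 : y ≡ 0#
      y≡0 = ⊙-cancelˡ 2≢0 (by-hyps fy z≡0 (solve 5 (λ c x y z t → con (+ 2) :* y := con (+ 2) :* con 0ℤ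
               :+ con 1ℤ :* (con (+ 2) :* y :+ :- (c :* x :* z :* t)) :+ c :* x :* t
                   :* (z :+ :- con 0ℤ)) refl c x y z t))

  -- In the presence of the conditions on z and t the equation says `sq x y` = 0, which leaves
  -- `∑-fixed-yzt`. The 1 is the origin, and over every common zero of `sq` and `disc` lie two
  -- further solutions.
  ∑-fixed₃ : ∑⁴ (λ x y z t → sol x y z t * fixed y x z t * fixed z x y t * fixed t x y z) ≡ 1ℤ + + 2 * R
  ∑-fixed₃ = begin
    ∑⁴ (λ x y z t → sol x y z t * fixed y x z t * fixed z x y t * fixed t x y z)
      ≡⟨ ∑-cong₂ (λ x y → begin
           ∑ (λ z → ∑ λ t → sol x y z t * fixed y x z t * fixed z x y t * fixed t x y z)
             ≡⟨ ∑-cong₂ (λ z t → trans (lem₁ (sol x y z t) (fixed y x z t) (fixed z x y t)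
                 (fixed t x y z))
                  (trans (cong (_* fixed y x z t) (sol⇔sq x y z t))
                      (lem₂ (δ₀ (sq x y)) (fixed y x z t) (fixed z x y t) (fixed t x y z)))) ⟩
           ∑ (λ z → ∑ λ t → δ₀ (sq x y) * (fixed y x z t * fixed z x y t * fixed t x y z))
             ≡⟨ trans (∑²-* (δ₀ (sq x y)) _) (cong (δ₀ (sq x y) *_) (∑-fixed-yzt x y)) ⟩
           δ₀ (sq x y) * (δ₀ y + + 2 * δ₀ (disc x y))
             ≡⟨ lem₃ (δ₀ (sq x y)) (δ₀ y) (δ₀ (disc x y)) ⟩
           δ₀ y * δ₀ (sq x y) + + 2 * (δ₀ (sq x y) * δ₀ (disc x y)) ∎) ⟩
    ∑ (λ x → ∑ λ y → δ₀ y * δ₀ (sq x y) + + 2 * (δ₀ (sq x y) * δ₀ (disc x y)))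
      ≡⟨ trans (∑²-+ _ _) (cong₂ _+_
           (trans (∑-cong λ x → trans (∑-δ₀ (λ y → δ₀ (sq x y))) (𝟙-cong _ (x ≟ᶠ 0#)
               (λ eq → square-zero (trans (x²⊕0 x) eq)) (λ { refl → trans (sym (x²⊕0 0#)) (⊙-zeroˡ 0#)
                   }))) (∑-δ-one 0#))
           (∑²-* (+ 2) _)) ⟩
    1ℤ + + 2 * R ∎
    where
    x²⊕0 : ∀ x → x ⊙ x ≡ x ⊙ x ⊕ 0# ⊙ 0#
    x²⊕0 = solve 1 (λ x → x :* x := x :* x :+ con 0ℤ :* con 0ℤ) refl
    lem₁ : ∀ s a b d → s * a * b * d ≡ s * b * d * a
    lem₁ = solve-∀
    lem₂ : ∀ s a b d → s * b * d * a ≡ s * (a * b * d)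
    lem₂ = solve-∀
    lem₃ : ∀ s a d → s * (a + + 2 * d) ≡ a * s + + 2 * (s * d)
    lem₃ = solve-∀
    sol⇔sq : ∀ x y z t → sol x y z t * fixed z x y t * fixed t x y z ≡ δ₀ (sq x y) * fixed z x y t
        * fixed t x y z
    sol⇔sq x y z t = trans (sol-fixed₂ x y z t) (trans (cong (δ₀ (sq x y) *_) (𝟙-*-⇔ _ _ _ _
      (λ d ft → ⊙-cancelˡ 2≢0 (by-hyps d ft (solve 5 (λ c x y z t → con (+ 2) :* (con (+ 2) :* z)
          := con (+ 2) :* (c :* x :* y :* t)
                 :+ :- con 1ℤ :* ((c :* c :* (x :* x) :* (y :* y) :+ :- con (+ 4)) :* z :+ :- con 0ℤ)
                 :+ :- (c :* x :* y) :* (con (+ 2) :* t :+ :- (c :* x :* y :* z))) refl c x y z t))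
                     , ft)
      (λ fz ft → by-hyps fz ft (solve 5 (λ c x y z t → (c :* c :* (x :* x) :* (y :* y) :+ :-
          con (+ 4)) :* z
            := con 0ℤ :+ :- con (+ 2) :* (con (+ 2) :* z :+ :- (c :* x :* y :* t)) :+ :- (c :* x :* y)
                :* (con (+ 2) :* t :+ :- (c :* x :* y :* z))) refl c x y z t) , ft)))
      (sym (ℤP.*-assoc (δ₀ (sq x y)) (fixed z x y t) (fixed t x y z))))

  -- With P = c x y z t the conditions give 2 x² = 2 y² = 2 z² = 2 t² = P, so twice the equation
  -- reads 4 P = 2 P. Then all four squares vanish as well, which makes the origin the only isolated
  -- vertex.
  all-fixed⇒product-zero : ∀ {x y z t} → Solution x y z t →
    2# ⊙ x ≡ c ⊙ y ⊙ z ⊙ t → 2# ⊙ y ≡ c ⊙ x ⊙ z ⊙ t → 2# ⊙ z ≡ c ⊙ x ⊙ y ⊙ t → 2# ⊙ t ≡ c ⊙ x ⊙ y ⊙ z →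
    c ⊙ x ⊙ y ⊙ z ⊙ t ≡ 0#
  all-fixed⇒product-zero {x} {y} {z} {t} s fx fy fz ft = ⊙-cancelˡ 2≢0
      (by-hyp s (by-hyp fx (by-hyp fy (by-hyps fz ft
    (solve 5 (λ c x y z t → con (+ 2) :* (c :* x :* y :* z :* t) := con (+ 2) :* con 0ℤ
      :+ con (+ 2) :* ((x :* x :+ y :* y :+ z :* z :+ t :* t) :+ :- (c :* x :* y :* z :* t))
      :+ :- x :* (con (+ 2) :* x :+ :- (c :* y :* z :* t))
      :+ :- y :* (con (+ 2) :* y :+ :- (c :* x :* z :* t))
      :+ :- z :* (con (+ 2) :* z :+ :- (c :* x :* y :* t))
      :+ :- t :* (con (+ 2) :* t :+ :- (c :* x :* y :* z))) refl c x y z t)))))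

  ∑-fixed₄ : ∑⁴ (λ x y z t → sol x y z t * fixed x y z t * fixed y x z t * fixed z x y t * fixed
      t x y z) ≡ 1ℤ
  ∑-fixed₄ = begin
    ∑⁴ (λ x y z t → sol x y z t * fixed x y z t * fixed y x z t * fixed z x y t * fixed t x y z)
      ≡⟨ ∑-cong₂ (λ x y → ∑-cong₂ (λ z t → pointwise x y z t)) ⟩
    ∑⁴ (λ x y z t → δ₀ x * (δ₀ y * (δ₀ z * δ₀ t)))
      ≡⟨ ∑-cong (λ x → trans (∑-cong λ y → trans (∑-cong λ z → ∑-δ-factor (δ₀ x) (δ₀ y) (δ₀ z))
          (∑-*-one (δ₀ x * δ₀ y) (∑-δ-one 0#)))
           (∑-*-one (δ₀ x) (∑-δ-one 0#))) ⟩
    ∑ δ₀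
      ≡⟨ ∑-δ-one 0# ⟩
    1ℤ ∎
    where
    ∑-δ-factor : ∀ a b d → ∑ (λ t → a * (b * (d * δ₀ t))) ≡ a * b * d
    ∑-δ-factor a b d = trans (∑-cong λ t → lem a b d (δ₀ t)) (∑-*-one (a * b * d) (∑-δ-one 0#))
      where
      lem : ∀ a b d e → a * (b * (d * e)) ≡ a * b * d * e
      lem = solve-∀
    twice-square : ∀ {x p} → p ⊙ x ≡ 0# → 2# ⊙ x ≡ p → x ≡ 0#
    twice-square {x} {p} px≡0 2x≡p = square-zero (⊙-cancelˡ 2≢0 (by-hyps px≡0 2x≡p
      (solve 2 (λ x p → con (+ 2) :* (x :* x) := con (+ 2) :* con 0ℤ :+ con 1ℤ
          :* (p :* x :+ :- con 0ℤ) :+ x :* (con (+ 2) :* x :+ :- p)) refl x p)))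
    pointwise : ∀ x y z t → sol x y z t * fixed x y z t * fixed y x z t * fixed z x y t * fixed t x y z
              ≡ δ₀ x * (δ₀ y * (δ₀ z * δ₀ t))
    pointwise x y z t = begin
      sol x y z t * fixed x y z t * fixed y x z t * fixed z x y t * fixed t x y z
        ≡⟨ cong (λ s → s * fixed z x y t * fixed t x y z) (trans
            (cong (_* fixed y x z t) (sym (𝟙-× _ _))) (sym (𝟙-× _ _))) ⟩
      𝟙 ((solution? x y z t ×-dec (2# ⊙ x ≟ᶠ c ⊙ y ⊙ z ⊙ t)) ×-dec (2# ⊙ y ≟ᶠ c ⊙ x ⊙ z ⊙ t)) * fixed
          z x y t * fixed t x y z
        ≡⟨ 𝟙-⇔³ _ _ _ (x ≟ᶠ 0#) ((y ≟ᶠ 0#) ×-dec (z ≟ᶠ 0#) ×-dec (t ≟ᶠ 0#))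
             (λ ((s , fx) , fy) fz ft → let p≡0 = all-fixed⇒product-zero s fx fy fz ft in
                 twice-square (trans (solve 5 (λ c x y z t → c :* y :* z :* t :* x := c :* x :* y :* z
                     :* t) refl c x y z t) p≡0) fx
               , twice-square (trans (solve 5 (λ c x y z t → c :* x :* z :* t :* y := c :* x :* y :* z
                   :* t) refl c x y z t) p≡0) fy
               , twice-square (trans (solve 5 (λ c x y z t → c :* x :* y :* t :* z := c :* x :* y :* z
                   :* t) refl c x y z t) p≡0) fz
               , twice-square p≡0 ft)
             (λ { refl (refl , refl , refl) →
                 ((solve 1 (λ c → con 0ℤ :* con 0ℤ :+ con 0ℤ :* con 0ℤ :+ con 0ℤ :* con 0ℤ :+ con 0ℤ
                 :* con 0ℤ := c :* con 0ℤ :* con 0ℤ :* con 0ℤ :* con 0ℤ) refl c , 2·0) , 2·0) , 2·0 ,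
                 2·0 }) ⟩
      δ₀ x * 𝟙 ((y ≟ᶠ 0#) ×-dec (z ≟ᶠ 0#) ×-dec (t ≟ᶠ 0#))
        ≡⟨ cong (δ₀ x *_) (trans (𝟙-× _ _) (cong (δ₀ y *_) (𝟙-× _ _))) ⟩
      δ₀ x * (δ₀ y * (δ₀ z * δ₀ t)) ∎
      where
      2·0 : 2# ⊙ 0# ≡ c ⊙ 0# ⊙ 0# ⊙ 0#
      2·0 = solve 1 (λ c → con (+ 2) :* con 0ℤ := c :* con 0ℤ :* con 0ℤ :* con 0ℤ) refl c

  -- Symmetry in the four coordinates.

  Fun : Set
  Fun = F → F → F → F → ℤ

  infix 4 _≐_
  _≐_ : Fun → Fun → Set
  f ≐ g = ∀ x y z t → f x y z t ≡ g x y z t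

  swap₁₂ swap₂₃ swap₃₄ : Fun → Fun
  swap₁₂ f x y z t = f y x z t
  swap₂₃ f x y z t = f x z y t
  swap₃₄ f x y z t = f x y t z

  ∑⁴-swap₁₂ : (f : Fun) → ∑⁴ f ≡ ∑⁴ (swap₁₂ f)
  ∑⁴-swap₁₂ f = ∑-comm _

  ∑⁴-swap₂₃ : (f : Fun) → ∑⁴ f ≡ ∑⁴ (swap₂₃ f)
  ∑⁴-swap₂₃ f = ∑-cong λ x → ∑-comm _

  ∑⁴-swap₃₄ : (f : Fun) → ∑⁴ f ≡ ∑⁴ (swap₃₄ f)
  ∑⁴-swap₃₄ f = ∑-cong₂ λ x y → ∑-comm _

  -- `fixed` takes the fixed coordinate first and the others in their order, so that swapping
  -- adjacent coordinates exchanges their two indicators definitionally. The other two indicators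
  -- are invariant by commutativity.
  φ₁ φ₂ φ₃ φ₄ : Fun
  φ₁ x y z t = fixed x y z t
  φ₂ x y z t = fixed y x z t
  φ₃ x y z t = fixed z x y t
  φ₄ x y z t = fixed t x y z

  fixed-swap₂₃ : ∀ x y z t → fixed x z y t ≡ fixed x y z t
  fixed-swap₂₃ x y z t = cong (λ s → 𝟙 (2# ⊙ x ≟ᶠ s)) (solve
      4 (λ c y z t → c :* z :* y :* t := c :* y :* z :* t) refl c y z t)

  fixed-swap₃₄ : ∀ x y z t → fixed x y t z ≡ fixed x y z t
  fixed-swap₃₄ x y z t = cong (λ s → 𝟙 (2# ⊙ x ≟ᶠ s)) (solve
      4 (λ c y z t → c :* y :* t :* z := c :* y :* z :* t) refl c y z t)

  sol-swap₁₂ : swap₁₂ sol ≐ sol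
  sol-swap₁₂ x y z t = cong₂ (λ r s → 𝟙 (r ≟ᶠ s))
    (solve 4 (λ x y z t → y :* y :+ x :* x :+ z :* z :+ t :* t := x :* x :+ y :* y :+ z :* z :+ t
        :* t) refl x y z t)
    (solve 5 (λ c x y z t → c :* y :* x :* z :* t := c :* x :* y :* z :* t) refl c x y z t)

  sol-swap₂₃ : swap₂₃ sol ≐ sol
  sol-swap₂₃ x y z t = cong₂ (λ r s → 𝟙 (r ≟ᶠ s))
    (solve 4 (λ x y z t → x :* x :+ z :* z :+ y :* y :+ t :* t := x :* x :+ y :* y :+ z :* z :+ t
        :* t) refl x y z t)
    (solve 5 (λ c x y z t → c :* x :* z :* y :* t := c :* x :* y :* z :* t) refl c x y z t)

  sol-swap₃₄ : swap₃₄ sol ≐ sol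
  sol-swap₃₄ x y z t = cong₂ (λ r s → 𝟙 (r ≟ᶠ s))
    (solve 4 (λ x y z t → x :* x :+ y :* y :+ t :* t :+ z :* z := x :* x :+ y :* y :+ z :* z :+ t
        :* t) refl x y z t)
    (solve 5 (λ c x y z t → c :* x :* y :* t :* z := c :* x :* y :* z :* t) refl c x y z t)

  infixl 7 _·_
  _·_ : Fun → Fun → Fun
  (f · g) x y z t = f x y z t * g x y z t

  ·-cong : ∀ {f f′ g g′} → f ≐ f′ → g ≐ g′ → f · g ≐ f′ · g′
  ·-cong eq eq′ x y z t = cong₂ _*_ (eq x y z t) (eq′ x y z t)

  ≐-refl : ∀ {f} → f ≐ f
  ≐-refl x y z t = refl

  -- Representatives of the 4, 6, 4 and 1 products of one, two, three and four indicators; adjacent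
  -- transpositions of the coordinates carry every other product to one of them.
  F₁ F₂ F₃ F₄ : ℤ
  F₁ = ∑⁴ (sol · φ₄)
  F₂ = ∑⁴ (sol · φ₃ · φ₄)
  F₃ = ∑⁴ (sol · φ₂ · φ₃ · φ₄)
  F₄ = ∑⁴ (sol · φ₁ · φ₂ · φ₃ · φ₄)

  φ₃-swap₁₂ : swap₁₂ φ₃ ≐ φ₃
  φ₃-swap₁₂ x y z t = fixed-swap₂₃ z x y t
  φ₄-swap₁₂ : swap₁₂ φ₄ ≐ φ₄
  φ₄-swap₁₂ x y z t = fixed-swap₂₃ t x y z
  φ₁-swap₂₃ : swap₂₃ φ₁ ≐ φ₁
  φ₁-swap₂₃ x y z t = fixed-swap₂₃ x y z t
  φ₄-swap₂₃ : swap₂₃ φ₄ ≐ φ₄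
  φ₄-swap₂₃ x y z t = fixed-swap₃₄ t x y z
  φ₁-swap₃₄ : swap₃₄ φ₁ ≐ φ₁
  φ₁-swap₃₄ x y z t = fixed-swap₃₄ x y z t
  φ₂-swap₃₄ : swap₃₄ φ₂ ≐ φ₂
  φ₂-swap₃₄ x y z t = fixed-swap₃₄ y x z t

  by₁₂ : ∀ f {g k} → swap₁₂ f ≐ g → ∑⁴ g ≡ k → ∑⁴ f ≡ k
  by₁₂ f eq eq′ = trans (∑⁴-swap₁₂ f) (trans (∑⁴-cong eq) eq′)
  by₂₃ : ∀ f {g k} → swap₂₃ f ≐ g → ∑⁴ g ≡ k → ∑⁴ f ≡ k
  by₂₃ f eq eq′ = trans (∑⁴-swap₂₃ f) (trans (∑⁴-cong eq) eq′)
  by₃₄ : ∀ f {g k} → swap₃₄ f ≐ g → ∑⁴ g ≡ k → ∑⁴ f ≡ k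
  by₃₄ f eq eq′ = trans (∑⁴-swap₃₄ f) (trans (∑⁴-cong eq) eq′)

  ∑-φ₃ : ∑⁴ (sol · φ₃) ≡ F₁
  ∑-φ₃ = by₃₄ (sol · φ₃) (·-cong sol-swap₃₄ (≐-refl {φ₄})) refl
  ∑-φ₂ : ∑⁴ (sol · φ₂) ≡ F₁
  ∑-φ₂ = by₂₃ (sol · φ₂) (·-cong sol-swap₂₃ (≐-refl {φ₃})) ∑-φ₃
  ∑-φ₁ : ∑⁴ (sol · φ₁) ≡ F₁
  ∑-φ₁ = by₁₂ (sol · φ₁) (·-cong sol-swap₁₂ (≐-refl {φ₂})) ∑-φ₂

  ∑-φ₂φ₄ : ∑⁴ (sol · φ₂ · φ₄) ≡ F₂
  ∑-φ₂φ₄ = by₂₃ (sol · φ₂ · φ₄) (·-cong (·-cong sol-swap₂₃ (≐-refl {φ₃})) φ₄-swap₂₃) refl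
  ∑-φ₁φ₄ : ∑⁴ (sol · φ₁ · φ₄) ≡ F₂
  ∑-φ₁φ₄ = by₁₂ (sol · φ₁ · φ₄) (·-cong (·-cong sol-swap₁₂ (≐-refl {φ₂})) φ₄-swap₁₂) ∑-φ₂φ₄
  ∑-φ₂φ₃ : ∑⁴ (sol · φ₂ · φ₃) ≡ F₂
  ∑-φ₂φ₃ = by₃₄ (sol · φ₂ · φ₃) (·-cong (·-cong sol-swap₃₄ φ₂-swap₃₄) (≐-refl {φ₄})) ∑-φ₂φ₄
  ∑-φ₁φ₃ : ∑⁴ (sol · φ₁ · φ₃) ≡ F₂
  ∑-φ₁φ₃ = by₃₄ (sol · φ₁ · φ₃) (·-cong (·-cong sol-swap₃₄ φ₁-swap₃₄) (≐-refl {φ₄})) ∑-φ₁φ₄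
  ∑-φ₁φ₂ : ∑⁴ (sol · φ₁ · φ₂) ≡ F₂
  ∑-φ₁φ₂ = by₂₃ (sol · φ₁ · φ₂) (·-cong (·-cong sol-swap₂₃ φ₁-swap₂₃) (≐-refl {φ₃})) ∑-φ₁φ₃

  ∑-φ₁φ₃φ₄ : ∑⁴ (sol · φ₁ · φ₃ · φ₄) ≡ F₃
  ∑-φ₁φ₃φ₄ = by₁₂ (sol · φ₁ · φ₃ · φ₄) (·-cong (·-cong (·-cong sol-swap₁₂ (≐-refl {φ₂})) φ₃-swap₁₂)
      φ₄-swap₁₂) refl
  ∑-φ₁φ₂φ₄ : ∑⁴ (sol · φ₁ · φ₂ · φ₄) ≡ F₃
  ∑-φ₁φ₂φ₄ = by₂₃ (sol · φ₁ · φ₂ · φ₄) (·-cong (·-cong (·-cong sol-swap₂₃ φ₁-swap₂₃) (≐-refl {φ₃}))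
      φ₄-swap₂₃) ∑-φ₁φ₃φ₄
  ∑-φ₁φ₂φ₃ : ∑⁴ (sol · φ₁ · φ₂ · φ₃) ≡ F₃
  ∑-φ₁φ₂φ₃ = by₃₄ (sol · φ₁ · φ₂ · φ₃) (·-cong (·-cong (·-cong sol-swap₃₄ φ₁-swap₃₄) φ₂-swap₃₄)
      (≐-refl {φ₄})) ∑-φ₁φ₂φ₄

  infixl 6 _∔_
  _∔_ : Fun → Fun → Fun
  (f ∔ g) x y z t = f x y z t + g x y z t

  ∑⁴-∔ : ∀ {f g k l} → ∑⁴ f ≡ k → ∑⁴ g ≡ l → ∑⁴ (f ∔ g) ≡ k + l
  ∑⁴-∔ {f} {g} eq eq′ = trans (∑⁴-+ f g) (cong₂ _+_ eq eq′)

  ∑-combination : ∀ k₁ k₂ k₃ k₄ →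
    ∑⁴ (λ x y z t → sol x y z t * combination
        k₁ k₂ k₃ k₄ (φ₁ x y z t) (φ₂ x y z t) (φ₃ x y z t) (φ₄ x y z t))
    ≡ k₁ * (+ 4 * F₁) + k₂ * (+ 6 * F₂) + k₃ * (+ 4 * F₃) + k₄ * F₄
  ∑-combination k₁ k₂ k₃ k₄ = begin
    ∑⁴ (λ x y z t → sol x y z t * combination
        k₁ k₂ k₃ k₄ (φ₁ x y z t) (φ₂ x y z t) (φ₃ x y z t) (φ₄ x y z t))
      ≡⟨ ∑⁴-cong (λ x y z t → expand k₁ k₂ k₃ k₄ (sol
          x y z t) (φ₁ x y z t) (φ₂ x y z t) (φ₃ x y z t) (φ₄ x y z t)) ⟩
    ∑⁴ ((λ x y z t → k₁ * s₁ x y z t) ∔ (λ x y z t → k₂ * s₂ x y z t) ∔ (λ x y z t → k₃ * s₃ x y z t)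
        ∔ (λ x y z t → k₄ * s₄ x y z t))
      ≡⟨ ∑⁴-∔ (∑⁴-∔ (∑⁴-∔ (∑⁴-* k₁ s₁) (∑⁴-* k₂ s₂)) (∑⁴-* k₃ s₃)) (∑⁴-* k₄ s₄) ⟩
    k₁ * ∑⁴ s₁ + k₂ * ∑⁴ s₂ + k₃ * ∑⁴ s₃ + k₄ * ∑⁴ s₄
      ≡⟨ cong (_+ k₄ * F₄) (cong₂ _+_ (cong₂ (λ r s → k₁ * r + k₂ * s)
           (∑⁴-∔ (∑⁴-∔ (∑⁴-∔ ∑-φ₁ ∑-φ₂) ∑-φ₃) refl)
           (∑⁴-∔ (∑⁴-∔ (∑⁴-∔ (∑⁴-∔ (∑⁴-∔ ∑-φ₁φ₂ ∑-φ₁φ₃) ∑-φ₁φ₄) ∑-φ₂φ₃) ∑-φ₂φ₄) refl))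
           (cong (k₃ *_) (∑⁴-∔ (∑⁴-∔ (∑⁴-∔ ∑-φ₁φ₂φ₃ ∑-φ₁φ₂φ₄) ∑-φ₁φ₃φ₄) refl))) ⟩
    k₁ * (F₁ + F₁ + F₁ + F₁) + k₂ * (F₂ + F₂ + F₂ + F₂ + F₂ + F₂) + k₃ * (F₃ + F₃ + F₃ + F₃) + k₄ * F₄
      ≡⟨ collect k₁ k₂ k₃ k₄ F₁ F₂ F₃ F₄ ⟩
    k₁ * (+ 4 * F₁) + k₂ * (+ 6 * F₂) + k₃ * (+ 4 * F₃) + k₄ * F₄ ∎
    where
    s₁ s₂ s₃ s₄ : Fun
    s₁ = sol · φ₁ ∔ sol · φ₂ ∔ sol · φ₃ ∔ sol · φ₄
    s₂ = sol · φ₁ · φ₂ ∔ sol · φ₁ · φ₃ ∔ sol · φ₁ · φ₄ ∔ sol · φ₂ · φ₃ ∔ sol · φ₂ · φ₄ ∔ sol · φ₃ · φ₄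
    s₃ = sol · φ₁ · φ₂ · φ₃ ∔ sol · φ₁ · φ₂ · φ₄ ∔ sol · φ₁ · φ₃ · φ₄ ∔ sol · φ₂ · φ₃ · φ₄
    s₄ = sol · φ₁ · φ₂ · φ₃ · φ₄
    expand : ∀ k₁ k₂ k₃ k₄ s a b c d →
      s * (k₁ * (a + b + c + d) + k₂ * (a * b + a * c + a * d + b * c + b * d + c * d)
           + k₃ * (a * b * c + a * b * d + a * c * d + b * c * d) + k₄ * (a * b * c * d))
      ≡ k₁ * (s * a + s * b + s * c + s * d)
        + k₂ * (s * a * b + s * a * c + s * a * d + s * b * c + s * b * d + s * c * d)
        + k₃ * (s * a * b * c + s * a * b * d + s * a * c * d + s * b * c * d) + k₄
            * (s * a * b * c * d)
    expand = solve-∀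
    collect : ∀ k₁ k₂ k₃ k₄ a b c d →
      k₁ * (a + a + a + a) + k₂ * (b + b + b + b + b + b) + k₃ * (c + c + c + c) + k₄ * d
      ≡ k₁ * (+ 4 * a) + k₂ * (+ 6 * b) + k₃ * (+ 4 * c) + k₄ * d
    collect = solve-∀

  -- Flips and the degree of a vertex.

  flip₁ flip₂ flip₃ flip₄ : Quad q → Quad q
  flip₁ (x , y , z , t) = c ⊙ y ⊙ z ⊙ t ⊕ ⊖ x , y , z , t
  flip₂ (x , y , z , t) = x , c ⊙ x ⊙ z ⊙ t ⊕ ⊖ y , z , t
  flip₃ (x , y , z , t) = x , y , c ⊙ x ⊙ y ⊙ t ⊕ ⊖ z , t
  flip₄ (x , y , z , t) = x , y , z , c ⊙ x ⊙ y ⊙ z ⊕ ⊖ t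

  flipList : Quad q → List (Quad q)
  flipList v = flip₁ v ∷ flip₂ v ∷ flip₃ v ∷ flip₄ v ∷ []

  flip-involutive : ∀ k x → k ⊕ ⊖ (k ⊕ ⊖ x) ≡ x
  flip-involutive = solve 2 (λ k x → k :+ :- (k :+ :- x) := x) refl

  -- Each flip is an involution; this reduces both directions of adjacency to membership in
  -- `flipList v`.
  flipList-sym : ∀ v w → v ∈ flipList w → w ∈ flipList v
  flipList-sym v (x , y , z , t) (here refl) = here (cong (_, y , z , t) (sym (flip-involutive _ x)))
  flipList-sym v (x , y , z , t) (there (here refl)) = there
      (here (cong (λ s → x , s , z , t) (sym (flip-involutive _ y))))
  flipList-sym v (x , y , z , t) (there (there (here refl))) = there
      (there (here (cong (λ s → x , y , s , t) (sym (flip-involutive _ z)))))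
  flipList-sym v (x , y , z , t) (there (there (there (here refl)))) = there
      (there (there (here (cong (λ s → x , y , z , s) (sym (flip-involutive _ t))))))

  -- Different flips change different coordinates: if two of them agree, the coordinate that the
  -- first could change is that of v.
  flipList-separated : ∀ v → AllPairs (λ u u′ → u ≡ u′ → u ≡ v) (flipList v)
  flipList-separated (x , y , z , t) =
      ( (λ eq → cong (_, y , z , t) (cong proj₁ eq)) ∷ (λ eq → cong (_, y , z , t) (cong proj₁ eq))
      ∷ (λ eq → cong (_, y , z , t) (cong proj₁ eq)) ∷ [])
    ∷ ( (λ eq → cong (λ s → x , s , z , t) (cong (λ u → proj₁ (proj₂ u)) eq))
        ∷ (λ eq → cong (λ s → x , s , z , t) (cong (λ u → proj₁ (proj₂ u)) eq)) ∷ [])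
    ∷ ( (λ eq → cong (λ s → x , y , s , t) (cong (λ u → proj₁ (proj₂ (proj₂ u))) eq)) ∷ [])
    ∷ [] ∷ []

  flip-fixed : ∀ {k x} → k ⊕ ⊖ x ≡ x → 2# ⊙ x ≡ k
  flip-fixed {k} {x} eq = by-hyp eq (solve 2 (λ k x → con (+ 2) :* x := k :+ :- con 1ℤ
      :* ((k :+ :- x) :+ :- x)) refl k x)

  fixed-flip : ∀ {k x} → 2# ⊙ x ≡ k → k ⊕ ⊖ x ≡ x
  fixed-flip {k} {x} eq = by-hyp eq (solve 2 (λ k x → k :+ :- x := x :+ :- con 1ℤ
      :* (con (+ 2) :* x :+ :- k)) refl k x)

  solQ : Quad q → ℤ
  solQ (x , y , z , t) = sol x y z t

  module _ (x y z t : F) (s : Solution x y z t) where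
    private
      v : Quad q
      v = x , y , z , t

    -- x and its flip are the two roots of the equation as a quadratic in the first coordinate.
    sol-flip₁ : solQ (flip₁ v) ≡ 1ℤ
    sol-flip₁ = 𝟙-yes (_ ≟ᶠ _) (by-hyp s (solve 5 (λ c x y z t → let x′ = c :* y :* z :* t :+ :- x in
      x′ :* x′ :+ y :* y :+ z :* z :+ t :* t := c :* x′ :* y :* z :* t :+ con 1ℤ
          :* ((x :* x :+ y :* y :+ z :* z :+ t :* t) :+ :- (c :* x :* y :* z :* t))) refl c x y z t))

    sol-flip₂ : solQ (flip₂ v) ≡ 1ℤ
    sol-flip₂ = 𝟙-yes (_ ≟ᶠ _) (by-hyp s (solve 5 (λ c x y z t → let y′ = c :* x :* z :* t :+ :- y in
      x :* x :+ y′ :* y′ :+ z :* z :+ t :* t := c :* x :* y′ :* z :* t :+ con 1ℤ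
          :* ((x :* x :+ y :* y :+ z :* z :+ t :* t) :+ :- (c :* x :* y :* z :* t))) refl c x y z t))

    sol-flip₃ : solQ (flip₃ v) ≡ 1ℤ
    sol-flip₃ = 𝟙-yes (_ ≟ᶠ _) (by-hyp s (solve 5 (λ c x y z t → let z′ = c :* x :* y :* t :+ :- z in
      x :* x :+ y :* y :+ z′ :* z′ :+ t :* t := c :* x :* y :* z′ :* t :+ con 1ℤ
          :* ((x :* x :+ y :* y :+ z :* z :+ t :* t) :+ :- (c :* x :* y :* z :* t))) refl c x y z t))

    sol-flip₄ : solQ (flip₄ v) ≡ 1ℤ
    sol-flip₄ = 𝟙-yes (_ ≟ᶠ _) (by-hyp s (solve 5 (λ c x y z t → let t′ = c :* x :* y :* z :+ :- t in
      x :* x :+ y :* y :+ z :* z :+ t′ :* t′ := c :* x :* y :* z :* t′ :+ con 1ℤ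
          :* ((x :* x :+ y :* y :+ z :* z :+ t :* t) :+ :- (c :* x :* y :* z :* t))) refl c x y z t))

    ∑-flip : ∀ u {φ} → solQ u ≡ 1ℤ → 𝟙 (u ≟Q v) ≡ φ →
             ∑⁴ (λ a b d e → solQ (a , b , d , e) * (𝟙 ((a , b , d , e) ≟Q u) * (1ℤ - 𝟙 (u ≟Q v))))
                 ≡ 1ℤ - φ
    ∑-flip u {φ} su eq = trans (∑⁴-cong λ a b d e → lem (sol a b d e) (𝟙 ((a , b , d , e) ≟Q u)) (1ℤ
        - 𝟙 (u ≟Q v)))
      (trans (∑⁴-δ u λ w → solQ w * (1ℤ - 𝟙 (u ≟Q v))) (trans (cong₂ (λ r s → r * (1ℤ - s)) su eq)
          (ℤP.*-identityˡ (1ℤ - φ))))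
      where
      lem : ∀ a b d → a * (b * d) ≡ b * (a * d)
      lem = solve-∀

    -- Flips of a solution are solutions, hence vertices, so every flip that moves v contributes one
    -- neighbour; `flipList-separated` prevents double counting.
    degree-formula : (adj? : ∀ w → Dec (v ≢ w × (w ∈ flipList v ⊎ v ∈ flipList w))) →
      ∑⁴ (λ a b d e → sol a b d e * 𝟙 (adj? (a , b , d , e)))
      ≡ + 4 - (φ₁ x y z t + φ₂ x y z t + φ₃ x y z t + φ₄ x y z t)
    degree-formula adj? = begin
      ∑⁴ (λ a b d e → sol a b d e * 𝟙 (adj? (a , b , d , e)))
        ≡⟨ ∑⁴-cong (λ a b d e → trans (cong (sol a b d e *_) (indicator (a , b , d , e)))
            (expand (sol a b d e) _ _ _ _)) ⟩
      ∑⁴ (part (flip₁ v) ∔ part (flip₂ v) ∔ part (flip₃ v) ∔ part (flip₄ v))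
        ≡⟨ ∑⁴-∔ (∑⁴-∔ (∑⁴-∔
             (∑-flip (flip₁ v) sol-flip₁ (𝟙-cong _ _ (λ eq → flip-fixed (cong proj₁ eq)) (λ eq →
                 cong (_, y , z , t) (fixed-flip eq))))
             (∑-flip (flip₂ v) sol-flip₂ (𝟙-cong _ _ (λ eq → flip-fixed
                 (cong (λ u → proj₁ (proj₂ u)) eq)) (λ eq → cong (λ s → x , s , z , t)
                 (fixed-flip eq)))))
             (∑-flip (flip₃ v) sol-flip₃ (𝟙-cong _ _ (λ eq → flip-fixed
                 (cong (λ u → proj₁ (proj₂ (proj₂ u))) eq)) (λ eq → cong (λ s → x , y , s , t)
                 (fixed-flip eq)))))
             (∑-flip (flip₄ v) sol-flip₄ (𝟙-cong _ _ (λ eq → flip-fixed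
                 (cong (λ u → proj₂ (proj₂ (proj₂ u))) eq)) (λ eq → cong (λ s → x , y , z , s)
                 (fixed-flip eq)))) ⟩
      (1ℤ - φ₁ x y z t) + (1ℤ - φ₂ x y z t) + (1ℤ - φ₃ x y z t) + (1ℤ - φ₄ x y z t)
        ≡⟨ collect (φ₁ x y z t) (φ₂ x y z t) (φ₃ x y z t) (φ₄ x y z t) ⟩
      + 4 - (φ₁ x y z t + φ₂ x y z t + φ₃ x y z t + φ₄ x y z t) ∎
      where
      open import Data.List.Membership.DecPropositional (_≟Q_ {q}) using (_∈?_)
      part : Quad q → Fun
      part u a b d e = solQ (a , b , d , e) * (𝟙 ((a , b , d , e) ≟Q u) * (1ℤ - 𝟙 (u ≟Q v)))
      indicator : ∀ w → 𝟙 (adj? w) ≡ listSum (λ u → 𝟙 (w ≟Q u) * (1ℤ - 𝟙 (u ≟Q v))) (flipList v)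
      indicator w = trans (𝟙-cong (adj? w) (¬? (v ≟Q w) ×-dec (w ∈? flipList v))
          (λ (v≢w , e) → v≢w , [ (λ w∈ → w∈) , flipList-sym v w ]′ e) (λ (v≢w , w∈) → v≢w , inj₁ w∈))
        (Neighbours.𝟙-neighbour _≟Q_ v w (flipList-separated v) _)
      expand : ∀ s a b d e → s * (a + (b + (d + (e + 0ℤ)))) ≡ s * a + s * b + s * d + s * e
      expand = solve-∀
      collect : ∀ a b d e → (1ℤ - a) + (1ℤ - b) + (1ℤ - d) + (1ℤ - e) ≡ + 4 - (a + b + d + e)
      collect = solve-∀

-- The prime field

module PrimeField (p : ℕ) .{{_ : NonZero p}} (prime : Prime p) (p≥5 : p ≥ 5) where

  toℕ-residue : ∀ n → toℕ (residue {p} n) ≡ n % p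
  toℕ-residue n = toℕ-fromℕ< (m%n<n n p)

  residue-cong : ∀ {m n} → m % p ≡ n % p → residue {p} m ≡ residue n
  residue-cong eq = toℕ-injective (trans (toℕ-residue _) (trans eq (sym (toℕ-residue _))))

  residue-toℕ : (a : 𝔽 p) → residue (toℕ a) ≡ a
  residue-toℕ a = toℕ-injective (trans (toℕ-residue (toℕ a)) (m<n⇒m%n≡m (toℕ<n a)))

  residue-+ : ∀ m n → residue {p} m +ₚ residue n ≡ residue (m ℕ.+ n)
  residue-+ m n = trans (cong₂ (λ a b → residue (a ℕ.+ b)) (toℕ-residue m) (toℕ-residue n))
    (residue-cong (sym (%-distribˡ-+ m n p)))

  residue-* : ∀ m n → residue {p} m *ₚ residue n ≡ residue (m ℕ.* n)
  residue-* m n = trans (cong₂ (λ a b → residue (a ℕ.* b)) (toℕ-residue m) (toℕ-residue n))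
    (residue-cong (sym (%-distribˡ-* m n p)))

  -- Every element is the residue of its representative, which lets the ring laws be inherited from
  -- ℕ.
  residue-elim : (P : 𝔽 p → Set) → (∀ n → P (residue n)) → ∀ a → P a
  residue-elim P h a = subst P (residue-toℕ a) (h (toℕ a))

  negₚ : 𝔽 p → 𝔽 p
  negₚ a = residue (p ℕ.∸ toℕ a)

  residue-p : residue {p} p ≡ residue 0
  residue-p = residue-cong (trans (n%n≡0 p) (sym (m<n⇒m%n≡m (ℕP.≤-trans (ℕ.s≤s ℕ.z≤n) p≥5))))

  abstract
    +ₚ-assoc : ∀ a b c → (a +ₚ b) +ₚ c ≡ a +ₚ (b +ₚ c)
    +ₚ-assoc = residue-elim _ λ i → residue-elim _ λ j → residue-elim _ λ k →
      trans (cong (_+ₚ residue k) (residue-+ i j)) (trans (residue-+ (i ℕ.+ j) k)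
        (trans (cong residue (ℕP.+-assoc i j k)) (sym
            (trans (cong (residue i +ₚ_) (residue-+ j k)) (residue-+ i (j ℕ.+ k))))))

    +ₚ-comm : ∀ a b → a +ₚ b ≡ b +ₚ a
    +ₚ-comm a b = cong residue (ℕP.+-comm (toℕ a) (toℕ b))

    +ₚ-identityˡ : ∀ a → residue 0 +ₚ a ≡ a
    +ₚ-identityˡ = residue-elim _ λ i → residue-+ 0 i

    negₚ-inverseʳ : ∀ a → a +ₚ (negₚ a) ≡ residue 0
    negₚ-inverseʳ a = trans (cong (_+ₚ (negₚ a)) (sym (residue-toℕ a)))
        (trans (residue-+ (toℕ a) (p ℕ.∸ toℕ a))
      (trans (cong residue (ℕP.m+[n∸m]≡n (ℕP.<⇒≤ (toℕ<n a)))) residue-p))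

    *ₚ-assoc : ∀ a b c → (a *ₚ b) *ₚ c ≡ a *ₚ (b *ₚ c)
    *ₚ-assoc = residue-elim _ λ i → residue-elim _ λ j → residue-elim _ λ k →
      trans (cong (_*ₚ residue k) (residue-* i j)) (trans (residue-* (i ℕ.* j) k)
        (trans (cong residue (ℕP.*-assoc i j k)) (sym
            (trans (cong (residue i *ₚ_) (residue-* j k)) (residue-* i (j ℕ.* k))))))

    *ₚ-comm : ∀ a b → a *ₚ b ≡ b *ₚ a
    *ₚ-comm a b = cong residue (ℕP.*-comm (toℕ a) (toℕ b))

    *ₚ-identityˡ : ∀ a → residue 1 *ₚ a ≡ a
    *ₚ-identityˡ = residue-elim _ λ i → trans (residue-* 1 i) (cong residue (ℕP.*-identityˡ i))

    *ₚ-distribʳ-+ₚ : ∀ a b c → (b +ₚ c) *ₚ a ≡ b *ₚ a +ₚ c *ₚ a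
    *ₚ-distribʳ-+ₚ = residue-elim _ λ i → residue-elim _ λ j → residue-elim _ λ k →
      trans (cong (_*ₚ residue i) (residue-+ j k)) (trans (residue-* (j ℕ.+ k) i)
        (trans (cong residue (ℕP.*-distribʳ-+ i j k)) (sym
            (trans (cong₂ _+ₚ_ (residue-* j i) (residue-* k i)) (residue-+ (j ℕ.* i) (k ℕ.* i))))))

    -ₚ-def : ∀ a b → a -ₚ b ≡ a +ₚ (negₚ b)
    -ₚ-def a b = trans (sym (residue-+ (toℕ a) (p ℕ.∸ toℕ b))) (cong (_+ₚ (negₚ b)) (residue-toℕ a))

    +ₚ-*ₚ-isCommutativeRing : Structures.IsCommutativeRing _≡_ _+ₚ_ _*ₚ_ negₚ (residue 0) (residue 1)
    +ₚ-*ₚ-isCommutativeRing = record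
      { isRing = record
        { +-isAbelianGroup = record
          { isGroup = record
            { isMonoid = record
              { isSemigroup = record
                { isMagma = record { isEquivalence = isEquivalence ; ∙-cong = cong₂ _+ₚ_ }
                ; assoc = +ₚ-assoc }
              ; identity = +ₚ-identityˡ , λ a → trans (+ₚ-comm a _) (+ₚ-identityˡ a) }
            ; inverse = (λ a → trans (+ₚ-comm _ a) (negₚ-inverseʳ a)) , negₚ-inverseʳ
            ; ⁻¹-cong = cong negₚ }
          ; comm = +ₚ-comm }
        ; *-cong = cong₂ _*ₚ_
        ; *-assoc = *ₚ-assoc
        ; *-identity = *ₚ-identityˡ , λ a → trans (*ₚ-comm a _) (*ₚ-identityˡ a)
        ; distrib = (λ a b c → trans (*ₚ-comm a _) (trans (*ₚ-distribʳ-+ₚ a b c)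
            (cong₂ _+ₚ_ (*ₚ-comm b a) (*ₚ-comm c a))))
                  , *ₚ-distribʳ-+ₚ }
      ; *-comm = *ₚ-comm }

  private
    ring : CommutativeRing 0ℓ 0ℓ
    ring = record { isCommutativeRing = +ₚ-*ₚ-isCommutativeRing }
    open IntegerSolver ring

  residue≢0 : ∀ n → .{{NonZero n}} → n ℕ.< p → residue {p} n ≢ residue 0
  residue≢0 n n<p eq = ℕ.≢-nonZero⁻¹ n (begin
    n                       ≡⟨ m<n⇒m%n≡m n<p ⟨
    n % p                   ≡⟨ toℕ-residue n ⟨
    toℕ (residue {p} n)     ≡⟨ cong toℕ eq ⟩
    toℕ (residue {p} 0)     ≡⟨ toℕ-residue 0 ⟩
    0 % p                   ≡⟨ m<n⇒m%n≡m (ℕP.≤-trans (ℕ.s≤s ℕ.z≤n) p≥5) ⟩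
    0                       ∎)
    where open ≡-Reasoning

  residue-*-p : ∀ n → residue {p} (n ℕ.* p) ≡ residue 0
  residue-*-p n = residue-cong (trans (m*n%n≡0 n p) (sym (m<n⇒m%n≡m (ℕP.≤-trans (ℕ.s≤s ℕ.z≤n) p≥5))))

  abstract
    invertible : (a : 𝔽 p) → a ≢ residue 0 → ∃ λ b → a *ₚ b ≡ residue 1
    invertible a a≢0 with coprime-Bézout (prime⇒coprime prime
        {{ℕ.≢-nonZero λ a≡0 → a≢0 (trans (sym (residue-toℕ a)) (cong residue a≡0))}} (toℕ<n a))
    ... | Bézout.-+ x y eq = residue y , (begin
      a *ₚ residue y               ≡⟨ cong (_*ₚ residue y) (residue-toℕ a) ⟨
      residue (toℕ a) *ₚ residue y ≡⟨ residue-* (toℕ a) y ⟩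
      residue (toℕ a ℕ.* y)        ≡⟨ cong residue (trans (ℕP.*-comm (toℕ a) y) (sym eq)) ⟩
      residue (1 ℕ.+ x ℕ.* p)      ≡⟨ residue-+ 1 (x ℕ.* p) ⟨
      residue 1 +ₚ residue (x ℕ.* p) ≡⟨ cong (residue 1 +ₚ_) (residue-*-p x) ⟩
      residue 1 +ₚ residue 0       ≡⟨ residue-+ 1 0 ⟩
      residue 1                    ∎)
      where open ≡-Reasoning
    -- Here 1 + y a = x p vanishes modulo p, so the inverse of a is -y.
    ... | Bézout.+- x y eq = negₚ (residue y) , (begin
      a *ₚ negₚ (residue y)          ≡⟨ solve 2 (λ a b → a :* (:- b) := con 1ℤ :+ :-
          (con 1ℤ :+ b :* a)) refl a (residue y) ⟩
      residue 1 +ₚ (negₚ (residue 1 +ₚ residue y *ₚ a))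
        ≡⟨ cong (λ s → residue 1 +ₚ (negₚ s)) (begin
           residue 1 +ₚ residue y *ₚ a ≡⟨ cong (λ s → residue 1 +ₚ residue y *ₚ s) (residue-toℕ a) ⟨
           residue 1 +ₚ residue y *ₚ residue (toℕ a) ≡⟨ cong (residue 1 +ₚ_) (residue-* y (toℕ a)) ⟩
           residue 1 +ₚ residue (y ℕ.* toℕ a) ≡⟨ residue-+ 1 (y ℕ.* toℕ a) ⟩
           residue (1 ℕ.+ y ℕ.* toℕ a) ≡⟨ cong residue eq ⟩
           residue (x ℕ.* p) ≡⟨ residue-*-p x ⟩
           residue 0 ∎) ⟩
      residue 1 +ₚ (negₚ (residue 0))  ≡⟨ solve 0 (con 1ℤ :+ :- con 0ℤ := con 1ℤ) refl ⟩
      residue 1                    ∎)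
      where open ≡-Reasoning

    inverse : (a : 𝔽 p) → ∃ λ b → (a ≢ residue 0 → a *ₚ b ≡ residue 1) × (a ≡ residue 0 → b ≡ residue 0)
    inverse a with a ≟ᶠ residue 0
    ... | yes a≡0 = residue 0 , (λ a≢0 → ⊥-elim (a≢0 a≡0)) , λ _ → refl
    ... | no a≢0 = let b , eq = invertible a a≢0 in b , (λ _ → eq) , λ a≡0 → ⊥-elim (a≢0 a≡0)

  field𝔽 : FiniteField p
  field𝔽 = record
    { _⊕_ = _+ₚ_
    ; _⊙_ = _*ₚ_
    ; ⊖_  = negₚ
    ; _⁻¹ = λ a → proj₁ (inverse a)
    ; 0# = residue 0
    ; 1# = residue 1
    ; isCommutativeRing = +ₚ-*ₚ-isCommutativeRing
    ; ⁻¹-inverse = λ {a} → proj₁ (proj₂ (inverse a))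
    ; ⁻¹-zero = proj₂ (proj₂ (inverse (residue 0))) refl
    ; 1≢0 = residue≢0 1 (ℕP.≤-trans (ℕ.s≤s (ℕ.s≤s ℕ.z≤n)) p≥5)
    ; 2≢0 = λ eq → residue≢0 2 (ℕP.≤-trans (ℕ.s≤s (ℕ.s≤s (ℕ.s≤s ℕ.z≤n))) p≥5)
        (trans (sym (residue-+ 1 1)) eq)
    }

-- Sums of two squares

4*≢ : ∀ x n .{{_ : NonZero n}} → n ℕ.< 4 → + 4 * x ≢ + n
4*≢ x n n<4 eq = ℕP.<⇒≱ n<4 (∣⇒≤ (divides ∣ x ∣ (trans (sym (cong ∣_∣ eq))
    (trans (ℤP.abs-* (+ 4) x) (ℕP.*-comm 4 ∣ x ∣)))))

square≡0 : ∀ i → i * i ≡ 0ℤ → i ≡ 0ℤ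
square≡0 i eq = [ (λ z → z) , (λ z → z) ]′ (ℤP.i*j≡0⇒i≡0∨j≡0 i eq)

∣i∣²≡i² : ∀ i → + (∣ i ∣ ℕ.* ∣ i ∣) ≡ i * i
∣i∣²≡i² (+ n) = ℤP.pos-* n n
∣i∣²≡i² -[1+ n ] = refl

module TwoSquares {p : ℕ} (prime : Prime p) {m : ℤ} (p≡4m+1 : + p ≡ + 4 * m + 1ℤ) where
  open ≡-Reasoning

  private
    instance
      p≢0 : NonZero p
      p≢0 = prime⇒nonZero prime

  -- With C = A A′ + B B′ and D = A B′ - A′ B one has C² + D² = p², so p ∣ D leaves D = 0 or D = ±p.
  -- If D = 0, then A² = A′², and A = -A′ contradicts the common residue -1 modulo 4. If D = ±p,
  -- then C = 0 and A² = B′², so p = A′² + A² is a sum of two odd squares, which p ≡ 1 modulo 4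
  -- excludes.
  unique-if-∣ : ∀ a a′ B B′ → let A = + 4 * a - 1ℤ ; A′ = + 4 * a′ - 1ℤ in
           + p ≡ A * A + B * B → + p ≡ A′ * A′ + B′ * B′ →
           p ∣ ∣ A * B′ - A′ * B ∣ → A ≡ A′
  unique-if-∣ a a′ B B′ eq eq′ (divides k ∣D∣≡kp) = cases k ∣D∣≡kp
      (ℕP.*-cancelʳ-≤ (k ℕ.* k) 1 (p ℕ.* p) {{ℕP.m*n≢0 p p}} k²p²≤p²)
    where
    A A′ D C : ℤ
    A = + 4 * a - 1ℤ
    A′ = + 4 * a′ - 1ℤ
    D = A * B′ - A′ * B
    C = A * A′ + B * B′
    C²+D²≡p² : C * C + D * D ≡ + p * + p
    C²+D²≡p² = trans (lem A A′ B B′) (sym (cong₂ _*_ eq eq′))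
      where
      lem : ∀ A A′ B B′ → (A * A′ + B * B′) * (A * A′ + B * B′) + (A * B′ - A′ * B)
          * (A * B′ - A′ * B) ≡ (A * A + B * B) * (A′ * A′ + B′ * B′)
      lem = solve-∀
    C²+D²≡p²ᴺ : ∣ C ∣ ℕ.* ∣ C ∣ ℕ.+ ∣ D ∣ ℕ.* ∣ D ∣ ≡ p ℕ.* p
    C²+D²≡p²ᴺ = ℤP.+-injective (trans (ℤP.pos-+ (∣ C ∣ ℕ.* ∣ C ∣) (∣ D ∣ ℕ.* ∣ D ∣))
        (trans (cong₂ _+_ (∣i∣²≡i² C) (∣i∣²≡i² D)) (trans C²+D²≡p² (sym (ℤP.pos-* p p)))))
    k²p²≡D² : k ℕ.* k ℕ.* (p ℕ.* p) ≡ ∣ D ∣ ℕ.* ∣ D ∣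
    k²p²≡D² = trans (ℕP.[m*n]*[o*p]≡[m*o]*[n*p] k k p p) (sym (cong₂ ℕ._*_ ∣D∣≡kp ∣D∣≡kp))
    k²p²≤p² : k ℕ.* k ℕ.* (p ℕ.* p) ℕ.≤ 1 ℕ.* (p ℕ.* p)
    k²p²≤p² = subst₂ ℕ._≤_ (sym k²p²≡D²) (trans C²+D²≡p²ᴺ (sym (ℕP.*-identityˡ (p ℕ.* p))))
        (ℕP.m≤n+m (∣ D ∣ ℕ.* ∣ D ∣) (∣ C ∣ ℕ.* ∣ C ∣))
    A²≢A′² : + p ≢ A′ * A′ + A * A
    A²≢A′² p≡ = 4*≢ (m - (+ 4 * a * a - + 2 * a + + 4 * a′ * a′ - + 2 * a′)) 1 (ℕ.s≤s (ℕ.s≤s ℕ.z≤n))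
      (trans (lem a a′ m) (trans (cong₂ (λ s r → s - r + 1ℤ) (sym p≡4m+1) (sym p≡)) (lem′ (+ p))))
      where
      lem : ∀ a a′ m → + 4 * (m - (+ 4 * a * a - + 2 * a + + 4 * a′ * a′ - + 2 * a′))
        ≡ + 4 * m + 1ℤ - ((+ 4 * a′ - 1ℤ) * (+ 4 * a′ - 1ℤ) + (+ 4 * a - 1ℤ) * (+ 4 * a - 1ℤ)) + 1ℤ
      lem = solve-∀
      lem′ : ∀ p → p - p + 1ℤ ≡ 1ℤ
      lem′ = solve-∀
    cases : ∀ k → ∣ D ∣ ≡ k ℕ.* p → k ℕ.* k ℕ.≤ 1 → A ≡ A′
    cases 0 ∣D∣≡0 _ = [ (λ A-A′≡0 → ℤP.i-j≡0⇒i≡j A A′ A-A′≡0)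
                      , (λ A+A′≡0 → ⊥-elim (4*≢ (a + a′) 2 (ℕ.s≤s (ℕ.s≤s (ℕ.s≤s ℕ.z≤n)))
                          (trans (lem₂ a a′) (cong (_+ + 2) A+A′≡0)))) ]′
                      (ℤP.i*j≡0⇒i≡0∨j≡0 (A - A′) (ℤP.*-cancelˡ-≡ (+ p) _ _ (begin
        + p * ((A - A′) * (A + A′))
          ≡⟨ lem₀ (+ p) A A′ ⟩
        A * A * + p - A′ * A′ * + p
          ≡⟨ cong₂ (λ s r → A * A * s - A′ * A′ * r) eq′ eq ⟩
        A * A * (A′ * A′ + B′ * B′) - A′ * A′ * (A * A + B * B)
          ≡⟨ lem₁ A A′ B B′ ⟩
        D * (A * B′ + A′ * B)
          ≡⟨ cong (_* (A * B′ + A′ * B)) (ℤP.∣i∣≡0⇒i≡0 {D} ∣D∣≡0) ⟩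
        0ℤ * (A * B′ + A′ * B)
          ≡⟨ ℤP.*-zeroˡ (A * B′ + A′ * B) ⟩
        0ℤ
          ≡⟨ ℤP.*-zeroʳ (+ p) ⟨
        + p * 0ℤ ∎)))
      where
      lem₀ : ∀ p A A′ → p * ((A - A′) * (A + A′)) ≡ A * A * p - A′ * A′ * p
      lem₀ = solve-∀
      lem₁ : ∀ A A′ B B′ → A * A * (A′ * A′ + B′ * B′) - A′ * A′ * (A * A + B * B) ≡ (A * B′ - A′ * B)
          * (A * B′ + A′ * B)
      lem₁ = solve-∀
      lem₂ : ∀ a a′ → + 4 * (a + a′) ≡ + 4 * a - 1ℤ + (+ 4 * a′ - 1ℤ) + + 2
      lem₂ = solve-∀
    cases 1 ∣D∣≡p _ = ⊥-elim (A²≢A′² (trans eq′ (cong (λ s → A′ * A′ + s)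
        (sym (ℤP.*-cancelˡ-≡ (+ p * + p) _ _ {{ℤP.i*j≢0 (+ p) (+ p)}} (begin
        + p * + p * (A * A)          ≡⟨ lem₀ (+ p) A ⟩
        (A * + p) * (A * + p)        ≡⟨ cong (λ s → s * s) Ap≡B′D ⟩
        (B′ * D) * (B′ * D)          ≡⟨ lem₁ B′ D ⟩
        D * D * (B′ * B′)            ≡⟨ cong (_* (B′ * B′)) D²≡p² ⟩
        + p * + p * (B′ * B′) ∎))))))
      where
      lem₀ : ∀ p A → p * p * (A * A) ≡ (A * p) * (A * p)
      lem₀ = solve-∀
      lem₁ : ∀ b d → (b * d) * (b * d) ≡ d * d * (b * b)
      lem₁ = solve-∀
      D²≡p² : D * D ≡ + p * + p
      D²≡p² = trans (sym (∣i∣²≡i² D)) (trans (cong (λ s → + (s ℕ.* s))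
          (trans ∣D∣≡p (ℕP.*-identityˡ p))) (ℤP.pos-* p p))
      C≡0 : C ≡ 0ℤ
      C≡0 = square≡0 C (trans (lem₂ (C * C) (D * D)) (trans (cong₂ _-_ C²+D²≡p² D²≡p²)
          (ℤP.+-inverseʳ (+ p * + p))))
        where
        lem₂ : ∀ c d → c ≡ c + d - d
        lem₂ = solve-∀
      Ap≡B′D : A * + p ≡ B′ * D
      Ap≡B′D = trans (cong (A *_) eq′) (trans (lem₂ A A′ B B′)
          (trans (cong (λ s → B′ * D + A′ * s) C≡0) (lem₃ (B′ * D) A′)))
        where
        lem₂ : ∀ A A′ B B′ → A * (A′ * A′ + B′ * B′) ≡ B′ * (A * B′ - A′ * B) + A′ * (A * A′ + B * B′)
        lem₂ = solve-∀
        lem₃ : ∀ x y → x + y * 0ℤ ≡ x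
        lem₃ = solve-∀
    cases (ℕ.suc (ℕ.suc k)) _ (ℕ.s≤s ())

  -- The product (A B′ - A′ B)(A B′ + A′ B) equals (A² - A′²) p, so p divides one of the factors;
  -- replacing B by -B exchanges them.
  unique : ∀ a a′ B B′ → let A = + 4 * a - 1ℤ ; A′ = + 4 * a′ - 1ℤ in
           + p ≡ A * A + B * B → + p ≡ A′ * A′ + B′ * B′ → A ≡ A′
  unique a a′ B B′ eq eq′ = [ unique-if-∣ a a′ B B′ eq eq′
                            , (λ p∣ → unique-if-∣ a a′ (- B) B′ (trans eq (lem₁ A B)) eq′
                                (subst (λ s → p ∣ ∣ s ∣) (lem₂ A A′ B B′) p∣)) ]′
    (euclidsLemma ∣ A * B′ - A′ * B ∣ ∣ A * B′ + A′ * B ∣ prime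
        (subst (p ∣_) (ℤP.abs-* (A * B′ - A′ * B) (A * B′ + A′ * B))
      (divides ∣ A * A - A′ * A′ ∣ (trans (cong ∣_∣ product) (ℤP.abs-* (A * A - A′ * A′) (+ p))))))
    where
    A A′ : ℤ
    A = + 4 * a - 1ℤ
    A′ = + 4 * a′ - 1ℤ
    lem₁ : ∀ A B → A * A + B * B ≡ A * A + (- B) * (- B)
    lem₁ = solve-∀
    lem₂ : ∀ A A′ B B′ → A * B′ + A′ * B ≡ A * B′ - A′ * (- B)
    lem₂ = solve-∀
    product : (A * B′ - A′ * B) * (A * B′ + A′ * B) ≡ (A * A - A′ * A′) * + p
    product = begin
      (A * B′ - A′ * B) * (A * B′ + A′ * B)
        ≡⟨ lem₃ A A′ B B′ ⟩
      A * A * (A′ * A′ + B′ * B′) - A′ * A′ * (A * A + B * B)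
        ≡⟨ cong₂ (λ s r → A * A * s - A′ * A′ * r) eq′ eq ⟨
      A * A * + p - A′ * A′ * + p
        ≡⟨ lem₄ (+ p) A A′ ⟩
      (A * A - A′ * A′) * + p ∎
      where
      lem₃ : ∀ A A′ B B′ → (A * B′ - A′ * B) * (A * B′ + A′ * B) ≡ A * A * (A′ * A′ + B′ * B′) - A′
          * A′ * (A * A + B * B)
      lem₃ = solve-∀
      lem₄ : ∀ p A A′ → A * A * p - A′ * A′ * p ≡ (A * A - A′ * A′) * p
      lem₄ = solve-∀

-- The Vieta graph

module VietaCounts (p : ℕ) .{{_ : NonZero p}} (p-prime : Prime p) (p≥5 : p ≥ 5)
                   (E : 𝔽 p) (E≢0 : E ≢ residue 0) where

  open PrimeField p p-prime p≥5
  open CharacterSums field𝔽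
  open ≡-Reasoning

  c : 𝔽 p
  c = residue 2 *ₚ E

  residue-2 : residue {p} 2 ≡ 2#
  residue-2 = sym (residue-+ 1 1)

  c≢0 : c ≢ residue 0
  c≢0 = ⊙-nonzero (λ 2≡0 → 2≢0 (trans (sym residue-2) 2≡0)) E≢0

  open QuarticCounts field𝔽 c c≢0

  graph : FiniteSimpleGraph
  graph = vietaGraph E

  P : ℤ
  P = + p

  σ≡χ : ∀ a → σ a ≡ χ a
  σ≡χ a = sym (χ-if a)

  flips≡flipList : ∀ v → flips E v ≡ flipList v
  flips≡flipList (x , y , z , t)
    rewrite -ₚ-def (c *ₚ y *ₚ z *ₚ t) x | -ₚ-def (c *ₚ x *ₚ z *ₚ t) y
          | -ₚ-def (c *ₚ x *ₚ y *ₚ t) z | -ₚ-def (c *ₚ x *ₚ y *ₚ z) t = refl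

  order≡∑ : + order graph ≡ ∑⁴ sol
  order≡∑ = length-filter-allQuads (isSolution? E)

  degree≡ : ∀ x y z t → Solution x y z t →
            + degree graph (x , y , z , t) ≡ + 4 - (φ₁ x y z t + φ₂ x y z t + φ₃ x y z t + φ₄ x y z t)
  degree≡ x y z t s = trans (length-filter²-allQuads (isSolution? E) (FiniteSimpleGraph.adj? graph v))
    (trans (∑⁴-cong λ a b d e → cong (sol a b d e *_) (𝟙-cong
        (FiniteSimpleGraph.adj? graph v (a , b , d , e)) (adj′ (a , b , d , e)) (to _) (from _)))
      (degree-formula x y z t s adj′))
    where
    v : Quad p
    v = x , y , z , t
    Adj′ : Quad p → Set
    Adj′ w = v ≢ w × (w ∈ flipList v ⊎ v ∈ flipList w)
    to : ∀ w → VietaAdj E v w → Adj′ w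
    to w (v≢w , inj₁ w∈) = v≢w , inj₁ (subst (w ∈_) (flips≡flipList v) w∈)
    to w (v≢w , inj₂ v∈) = v≢w , inj₂ (subst (v ∈_) (flips≡flipList w) v∈)
    from : ∀ w → Adj′ w → VietaAdj E v w
    from w (v≢w , inj₁ w∈) = v≢w , inj₁ (subst (w ∈_) (sym (flips≡flipList v)) w∈)
    from w (v≢w , inj₂ v∈) = v≢w , inj₂ (subst (v ∈_) (sym (flips≡flipList w)) v∈)
    adj′ : ∀ w → Dec (Adj′ w)
    adj′ w = map′ (to w) (from w) (FiniteSimpleGraph.adj? graph v w)

  #ofDegree≡ : ∀ d k₁ k₂ k₃ k₄ →
    (∀ x y z t → Solution x y z t → 𝟙 (degree graph (x , y , z , t) ℕP.≟ d)
       ≡ combination k₁ k₂ k₃ k₄ (φ₁ x y z t) (φ₂ x y z t) (φ₃ x y z t) (φ₄ x y z t)) →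
    + #ofDegree graph d ≡ k₁ * (+ 4 * F₁) + k₂ * (+ 6 * F₂) + k₃ * (+ 4 * F₃) + k₄ * F₄
  #ofDegree≡ d k₁ k₂ k₃ k₄ eq = trans (length-filter²-allQuads
      (isSolution? E) (λ v → degree graph v ℕP.≟ d))
    (trans (∑⁴-cong λ x y z t → 𝟙-*-cong (isSolution? E (x , y , z , t)) (eq x y z t))
        (∑-combination k₁ k₂ k₃ k₄))

  exactly-degree = λ x y z t s → exactly (𝟙-bit (2# ⊙ x ≟ᶠ c ⊙ y ⊙ z ⊙ t))
      (𝟙-bit (2# ⊙ y ≟ᶠ c ⊙ x ⊙ z ⊙ t))
    (𝟙-bit (2# ⊙ z ≟ᶠ c ⊙ x ⊙ y ⊙ t)) (𝟙-bit (2# ⊙ t ≟ᶠ c ⊙ x ⊙ y ⊙ z)) (degree graph (x , y , z , t))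
        (degree≡ x y z t s)

  #degree₃ : + #ofDegree graph 3 ≡ + 4 * (F₁ - + 3 * F₂ + + 3 * F₃ - F₄)
  #degree₃ = trans (#ofDegree≡ 3 (+ 1) (- + 2) (+ 3) (- + 4) λ x y z t s → proj₁
      (exactly-degree x y z t s)) (lem F₁ F₂ F₃ F₄)
    where
    lem : ∀ a b c d → + 1 * (+ 4 * a) + (- + 2) * (+ 6 * b) + + 3 * (+ 4 * c) + (- + 4) * d ≡ + 4
        * (a - + 3 * b + + 3 * c - d)
    lem = solve-∀

  #degree₂ : + #ofDegree graph 2 ≡ + 6 * (F₂ - + 2 * F₃ + F₄)
  #degree₂ = trans (#ofDegree≡ 2 0ℤ (+ 1) (- + 3) (+ 6) λ x y z t s → proj₁
      (proj₂ (exactly-degree x y z t s))) (lem F₁ F₂ F₃ F₄)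
    where
    lem : ∀ a b c d → 0ℤ * (+ 4 * a) + + 1 * (+ 6 * b) + (- + 3) * (+ 4 * c) + + 6 * d ≡ + 6
        * (b - + 2 * c + d)
    lem = solve-∀

  #degree₁ : + #ofDegree graph 1 ≡ + 4 * (F₃ - F₄)
  #degree₁ = trans (#ofDegree≡ 1 0ℤ 0ℤ (+ 1) (- + 4) λ x y z t s → proj₁
      (proj₂ (proj₂ (exactly-degree x y z t s)))) (lem F₁ F₂ F₃ F₄)
    where
    lem : ∀ a b c d → 0ℤ * (+ 4 * a) + 0ℤ * (+ 6 * b) + + 1 * (+ 4 * c) + (- + 4) * d ≡ + 4 * (c - d)
    lem = solve-∀

  #degree₀ : #ofDegree graph 0 ≡ 1
  #degree₀ = ℤP.+-injective (trans (#ofDegree≡ 0 0ℤ 0ℤ 0ℤ (+ 1) λ x y z t s → proj₂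
      (proj₂ (proj₂ (exactly-degree x y z t s))))
    (trans (lem F₁ F₂ F₃ F₄) ∑-fixed₄))
    where
    lem : ∀ a b c d → 0ℤ * (+ 4 * a) + 0ℤ * (+ 6 * b) + 0ℤ * (+ 4 * c) + + 1 * d ≡ d
    lem = solve-∀

  -- The χ(2) contained in χ(c) cancels the one from T(4). This is why the order involves σ(E) and
  -- the degree counts σ(2E).
  G≡ : G ≡ -1ℤ + χ E * T 1#
  G≡ = trans G-value (cong (λ s → -1ℤ + s) (begin
    χ (residue 2 ⊙ E) * (χ 2# * T 1#)    ≡⟨ cong (λ a → χ (a ⊙ E) * (χ 2# * T 1#)) residue-2 ⟩
    χ (2# ⊙ E) * (χ 2# * T 1#)           ≡⟨ cong (_* (χ 2# * T 1#)) (χ-⊙ 2# E) ⟩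
    χ 2# * χ E * (χ 2# * T 1#)           ≡⟨ lem (χ 2#) (χ E) (T 1#) ⟩
    χ 2# * χ 2# * (χ E * T 1#)           ≡⟨ cong (_* (χ E * T 1#)) (χ-square² 2≢0) ⟩
    1ℤ * (χ E * T 1#)                    ≡⟨ ℤP.*-identityˡ (χ E * T 1#) ⟩
    χ E * T 1# ∎))
    where
    lem : ∀ a b d → a * b * (a * d) ≡ a * a * (b * d)
    lem = solve-∀

  p≡4m+r : ∀ {r} → p % 4 ≡ r → P ≡ + 4 * + (p ℕ./ 4) + + r
  p≡4m+r {r} eq = trans (cong +_ (trans (m≡m%n+[m/n]*n p 4) (cong (ℕ._+ p ℕ./ 4 ℕ.* 4) eq)))
    (trans (ℤP.pos-+ r (p ℕ./ 4 ℕ.* 4)) (trans (cong (λ s → + r + s)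
        (trans (ℤP.pos-* (p ℕ./ 4) 4) (ℤP.*-comm (+ (p ℕ./ 4)) (+ 4))))
        (ℤP.+-comm (+ r) (+ 4 * + (p ℕ./ 4)))))

  η-±1 : η ≡ 1ℤ ⊎ η ≡ -1ℤ
  η-±1 with χ (⊖ 1#) | χ-view (⊖ 1#)
  ... | _ | zero ⊖1≡0 = ⊥-elim (⊖-nonzero 1≢0 ⊖1≡0)
  ... | _ | square _ _ _ = inj₁ refl
  ... | _ | nonsquare _ _ = inj₂ refl

  -- By `q-mod-4` the sign η is congruent to p modulo 4; the wrong sign would make 2 a multiple of
  -- 4.
  η-if-1 : p % 4 ≡ 1 → η ≡ 1ℤ
  η-if-1 p%4≡1 = [ (λ η≡1 → η≡1) , (λ η≡-1 → ⊥-elim (4*≢ (k - m) 2 (ℕ.s≤s (ℕ.s≤s (ℕ.s≤s ℕ.z≤n)))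
      (trans (lem k m) (trans (cong (λ s → + 4 * k + s - (+ 4 * m + 1ℤ) + + 2) (sym η≡-1))
        (trans (cong₂ (λ r s → r - s + + 2) (sym (proj₂ q-mod-4)) (sym (p≡4m+r p%4≡1)))
            (cancel P)))))) ]′ η-±1
    where
    k m : ℤ
    k = proj₁ q-mod-4
    m = + (p ℕ./ 4)
    lem : ∀ k m → + 4 * (k - m) ≡ + 4 * k + -1ℤ - (+ 4 * m + 1ℤ) + + 2
    lem = solve-∀
    cancel : ∀ n → n - n + + 2 ≡ + 2
    cancel = solve-∀

  η-if-3 : p % 4 ≡ 3 → η ≡ -1ℤ
  η-if-3 p%4≡3 = [ (λ η≡1 → ⊥-elim (4*≢ (k - m) 2 (ℕ.s≤s (ℕ.s≤s (ℕ.s≤s ℕ.z≤n)))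
      (trans (lem k m) (trans (cong (λ s → + 4 * k + s - (+ 4 * m + + 3) + + 2) (sym η≡1))
        (trans (cong₂ (λ r s → r - s + + 2) (sym (proj₂ q-mod-4)) (sym (p≡4m+r p%4≡3)))
            (cancel P)))))) , (λ η≡-1 → η≡-1) ]′ η-±1
    where
    k m : ℤ
    k = proj₁ q-mod-4
    m = + (p ℕ./ 4)
    lem : ∀ k m → + 4 * (k - m) ≡ + 4 * k + 1ℤ - (+ 4 * m + + 3) + + 2
    lem = solve-∀
    cancel : ∀ n → n - n + + 2 ≡ + 2
    cancel = solve-∀

  module _ (p%4≡3 : p % 4 ≡ 3) where
    private
      η≡-1 : η ≡ -1ℤ
      η≡-1 = η-if-3 p%4≡3
      R≡0 : R ≡ 0ℤ
      R≡0 = trans R≡[1+η]M (trans (cong (λ e → (1ℤ + e) * M) η≡-1) (ℤP.*-zeroˡ M))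
      F₁≡ : F₁ ≡ P * P - + 4 * P + + 4
      F₁≡ = trans ∑-fixed₁ (trans (cong₂ (λ w r → P * P - + 2 * (P - 1ℤ) + w + P * r)
              (trans W-value (cong₂ (λ e t → + 2 * P * e + + 2 + t * (χ c * T (⊖ 4#))) η≡-1
                  (T-odd η≡-1 1#))) R≡0)
            (lem P (χ c * T (⊖ 4#))))
        where
        lem : ∀ P t → P * P - + 2 * (P - 1ℤ) + (+ 2 * P * -1ℤ + + 2 + 0ℤ * t) + P * 0ℤ ≡ P * P - + 4
            * P + + 4
        lem = solve-∀
      F₂≡ : F₂ ≡ 1ℤ
      F₂≡ = trans ∑-fixed₂ (trans (cong₂ (λ e r → P + e * (P - 1ℤ) + (P - 1ℤ) * r) η≡-1 R≡0) (lem P))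
        where
        lem : ∀ P → P + -1ℤ * (P - 1ℤ) + (P - 1ℤ) * 0ℤ ≡ 1ℤ
        lem = solve-∀
      F₃≡ : F₃ ≡ 1ℤ
      F₃≡ = trans ∑-fixed₃ (cong (λ r → 1ℤ + + 2 * r) R≡0)
      G≡-1 : G ≡ -1ℤ
      G≡-1 = trans G≡ (trans (cong (λ t → -1ℤ + χ E * t) (T-odd η≡-1 1#))
          (cong (λ s → -1ℤ + s) (ℤP.*-zeroʳ (χ E))))

    order-3 : + order graph ≡ P ^ 3 + + 5 * P - 1ℤ
    order-3 = trans order≡∑ (trans ∑-solutions (trans
        (cong₂ (λ e g → P * P * P + (P - 1ℤ) - P * e + P * (e * (g + e * (g - 1ℤ))) + P * e
        * (+ 2 * (g - 1ℤ))) η≡-1 G≡-1) (lem P)))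
      where
      lem : ∀ P → P * P * P + (P - 1ℤ) - P * -1ℤ + P * (-1ℤ * (-1ℤ + -1ℤ * (-1ℤ - 1ℤ))) + P * -1ℤ
          * (+ 2 * (-1ℤ - 1ℤ)) ≡ P * (P * (P * 1ℤ)) + + 5 * P - 1ℤ
      lem = solve-∀

    degree₃-3 : + #ofDegree graph 3 ≡ + 4 * (P ^ 2 - + 4 * P + + 3)
    degree₃-3 = trans #degree₃ (trans (cong₂ (λ a b → + 4 * (a - + 3 * b + + 3 * F₃ - F₄)) F₁≡ F₂≡)
      (trans (cong₂ (λ a b → + 4 * (P * P - + 4 * P + + 4 - + 3 * 1ℤ + + 3 * a - b)) F₃≡ ∑-fixed₄)
          (lem P)))
      where
      lem : ∀ P → + 4 * (P * P - + 4 * P + + 4 - + 3 * 1ℤ + + 3 * 1ℤ - 1ℤ) ≡ + 4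
          * (P * (P * 1ℤ) - + 4 * P + + 3)
      lem = solve-∀

    degree₂-3 : #ofDegree graph 2 ≡ 0
    degree₂-3 = ℤP.+-injective (trans #degree₂ (trans
        (cong₂ (λ a b → + 6 * (a - + 2 * b + F₄)) F₂≡ F₃≡) (cong (λ a → + 6 * (1ℤ - + 2 * 1ℤ + a))
        ∑-fixed₄)))

    degree₁-3 : #ofDegree graph 1 ≡ 0
    degree₁-3 = ℤP.+-injective (trans #degree₁ (cong₂ (λ a b → + 4 * (a - b)) F₃≡ ∑-fixed₄))

  -- For a nonsquare n, the halves of T(1) and T(n) are the two entries of a representation of p as
  -- a sum of two squares, and `T1-mod-8` puts the half of T(1) into the residue class that singles
  -- out A.
  T1≡2A : p % 4 ≡ 1 → ∀ A → IsA₂ p A → T 1# ≡ + 2 * A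
  T1≡2A p%4≡1 A ((B , p≡A²+B²) , dividesℤ a A+1≡a4) =
    compare nonsquare-exists (T1-mod-8 η≡1)
    where
    η≡1 : η ≡ 1ℤ
    η≡1 = η-if-1 p%4≡1
    A≡4a-1 : A ≡ + 4 * a - 1ℤ
    A≡4a-1 = trans (lem A) (cong (_- 1ℤ) (trans A+1≡a4 (ℤP.*-comm a (+ 4))))
      where
      lem : ∀ A → A ≡ A - -1ℤ - 1ℤ
      lem = solve-∀
    halve : ∀ {t u x y} → t * t + u * u ≡ + 4 * P → t ≡ + 2 * x → u ≡ + 2 * y → P ≡ x * x + y * y
    halve {x = x} {y} eq refl refl = ℤP.*-cancelˡ-≡ (+ 4) P (x * x + y * y) (trans (sym eq) (lem x y))
      where
      lem : ∀ x y → + 2 * x * (+ 2 * x) + + 2 * y * (+ 2 * y) ≡ + 4 * (x * x + y * y)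
      lem = solve-∀
    compare : (∃ λ n → χ n ≡ -1ℤ) → (∃ λ k → T 1# ≡ + 2 * (+ 4 * k - 1ℤ)) → T 1# ≡ + 2 * A
    compare (n , χn≡-1) (a′ , T1≡) = trans T1≡ (cong (+ 2 *_) (sym (trans A≡4a-1
      (TwoSquares.unique p-prime {+ (p ℕ./ 4)} (p≡4m+r p%4≡1) a a′ B (proj₁ Tn)
          (trans p≡A²+B² (cong (λ x → x * x + B * B) A≡4a-1))
        (halve (T1²+Tn² η≡1 χn≡-1) T1≡ (proj₂ Tn))))))
      where
      Tn : ∃ λ k → T n ≡ + 2 * k
      Tn = T-even η≡1 n

  module _ (p%4≡1 : p % 4 ≡ 1) (A : ℤ) (isA₂ : IsA₂ p A) where
    private
      η≡1 : η ≡ 1ℤ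
      η≡1 = η-if-1 p%4≡1
      i = proj₁ (∃-sqrt-⊖1 η≡1)
      i²≡-1 = proj₂ (∃-sqrt-⊖1 η≡1)
      s : ℤ
      s = σ c

    private
      T1≡ : T 1# ≡ + 2 * A
      T1≡ = T1≡2A p%4≡1 A isA₂
      R≡ : R ≡ + 4 * (1ℤ + s)
      R≡ = trans R≡[1+η]M (trans (cong₂ (λ e m → (1ℤ + e) * m) η≡1 (M-value i i²≡-1))
        (trans (lem (χ c)) (cong (λ s → + 4 * (1ℤ + s)) (sym (σ≡χ c)))))
        where
        lem : ∀ s → (1ℤ + 1ℤ) * (+ 2 * (1ℤ + s)) ≡ + 4 * (1ℤ + s)
        lem = solve-∀
      W≡ : W ≡ + 2 * P + + 2 + + 4 * s * (A * A)
      -- The factors T(1) and T(-4) agree, and T(1)² = 4 A².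
      W≡ = trans W-value (trans (cong₂ (λ e t → + 2 * P * e + + 2 + T 1# * (χ c * t)) η≡1
          (T-⊖four i i²≡-1))
        (trans (cong₂ (λ s t → + 2 * P * 1ℤ + + 2 + t * (s * t)) (sym (σ≡χ c)) T1≡) (lem P s A)))
        where
        lem : ∀ P s A → + 2 * P * 1ℤ + + 2 + + 2 * A * (s * (+ 2 * A)) ≡ + 2 * P + + 2 + + 4 * s
            * (A * A)
        lem = solve-∀
      F₁≡ : F₁ ≡ P * P - + 2 * (P - 1ℤ) + (+ 2 * P + + 2 + + 4 * s * (A * A)) + P * (+ 4 * (1ℤ + s))
      F₁≡ = trans ∑-fixed₁ (cong₂ (λ w r → P * P - + 2 * (P - 1ℤ) + w + P * r) W≡ R≡)
      F₂≡ : F₂ ≡ P + 1ℤ * (P - 1ℤ) + (P - 1ℤ) * (+ 4 * (1ℤ + s))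
      F₂≡ = trans ∑-fixed₂ (cong₂ (λ e r → P + e * (P - 1ℤ) + (P - 1ℤ) * r) η≡1 R≡)
      F₃≡ : F₃ ≡ 1ℤ + + 2 * (+ 4 * (1ℤ + s))
      F₃≡ = trans ∑-fixed₃ (cong (λ r → 1ℤ + + 2 * r) R≡)

    order-1 : + order graph ≡ P ^ 3 - + 7 * P - 1ℤ + + 8 * σ E * A * P
    order-1 = trans order≡∑ (trans ∑-solutions (trans
        (cong₂ (λ e g → P * P * P + (P - 1ℤ) - P * e + P * (e * (g + e * (g - 1ℤ))) + P * e
        * (+ 2 * (g - 1ℤ))) η≡1
        (trans G≡ (cong₂ (λ s t → -1ℤ + s * t) (sym (σ≡χ E)) T1≡))) (lem P (σ E) A)))
      where
      lem : ∀ P s A → let g = -1ℤ + s * (+ 2 * A) in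
        P * P * P + (P - 1ℤ) - P * 1ℤ + P * (1ℤ * (g + 1ℤ * (g - 1ℤ))) + P * 1ℤ * (+ 2 * (g - 1ℤ)) ≡ P
            * (P * (P * 1ℤ)) - + 7 * P - 1ℤ + + 8 * s * A * P
      lem = solve-∀

    degree₃-1 : + #ofDegree graph 3 ≡ + 4 * (P ^ 2 - + 14 * P + + 45 + + 4 * s
        * (A ^ 2 - + 2 * P + + 9))
    degree₃-1 = trans #degree₃ (trans (cong₂ (λ a b → + 4 * (a - + 3 * b + + 3 * F₃ - F₄)) F₁≡ F₂≡)
      (trans (cong₂ (λ a b → + 4 * (F₁′ - + 3 * F₂′ + + 3 * a - b)) F₃≡ ∑-fixed₄) (lem P s A)))
      where
      F₁′ F₂′ : ℤ
      F₁′ = P * P - + 2 * (P - 1ℤ) + (+ 2 * P + + 2 + + 4 * s * (A * A)) + P * (+ 4 * (1ℤ + s))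
      F₂′ = P + 1ℤ * (P - 1ℤ) + (P - 1ℤ) * (+ 4 * (1ℤ + s))
      lem : ∀ P s A → + 4 * (P * P - + 2 * (P - 1ℤ) + (+ 2 * P + + 2 + + 4 * s * (A * A)) + P
          * (+ 4 * (1ℤ + s))
          - + 3 * (P + 1ℤ * (P - 1ℤ) + (P - 1ℤ) * (+ 4 * (1ℤ + s))) + + 3
              * (1ℤ + + 2 * (+ 4 * (1ℤ + s))) - 1ℤ)
        ≡ + 4 * (P * (P * 1ℤ) - + 14 * P + + 45 + + 4 * s * (A * (A * 1ℤ) - + 2 * P + + 9))
      lem = solve-∀

    degree₂-1 : + #ofDegree graph 2 ≡ + 6 * (+ 6 * P - + 22 + + 4 * s * (P - + 5))
    degree₂-1 = trans #degree₂ (trans (cong₂ (λ a b → + 6 * (a - + 2 * b + F₄)) F₂≡ F₃≡)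
      (trans (cong (λ a → + 6 * (P + 1ℤ * (P - 1ℤ) + (P - 1ℤ) * (+ 4 * (1ℤ + s)) - + 2
          * (1ℤ + + 2 * (+ 4 * (1ℤ + s))) + a)) ∑-fixed₄) (lem P s)))
      where
      lem : ∀ P s → + 6 * (P + 1ℤ * (P - 1ℤ) + (P - 1ℤ) * (+ 4 * (1ℤ + s)) - + 2
          * (1ℤ + + 2 * (+ 4 * (1ℤ + s))) + 1ℤ)
        ≡ + 6 * (+ 6 * P - + 22 + + 4 * s * (P - + 5))
      lem = solve-∀

    degree₁-1 : + #ofDegree graph 1 ≡ + 32 * (1ℤ + s)
    degree₁-1 = trans #degree₁ (trans (cong₂ (λ a b → + 4 * (a - b)) F₃≡ ∑-fixed₄) (lem s))
      where
      lem : ∀ s → + 4 * (1ℤ + + 2 * (+ 4 * (1ℤ + s)) - 1ℤ) ≡ + 32 * (1ℤ + s)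
      lem = solve-∀

theorem16p2 : ∀ (p : ℕ) .{{_ : NonZero p}} → Prime p → p ≥ 5 →
    ∀ (E : 𝔽 p) → E ≢ residue 0 →
    let G = vietaGraph E
        P = + p
        s = σ (residue 2 *ₚ E)
    in
    (p % 4 ≡ 3 →
       + order G ≡ P ^ 3 + + 5 * P - 1ℤ
     × + #ofDegree G 3 ≡ + 4 * (P ^ 2 - + 4 * P + + 3)
     × #ofDegree G 2 ≡ 0
     × #ofDegree G 1 ≡ 0
     × #ofDegree G 0 ≡ 1)
    ×
    (p % 4 ≡ 1 → ∀ (A : ℤ) → IsA₂ p A →
       + order G ≡ P ^ 3 - + 7 * P - 1ℤ + + 8 * σ E * A * P
     × + #ofDegree G 3 ≡ + 4 * (P ^ 2 - + 14 * P + + 45 + + 4 * s * (A ^ 2 - + 2 * P + + 9))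
     × + #ofDegree G 2 ≡ + 6 * (+ 6 * P - + 22 + + 4 * s * (P - + 5))
     × + #ofDegree G 1 ≡ + 32 * (1ℤ + s)
     × #ofDegree G 0 ≡ 1)
theorem16p2 p p-prime p≥5 E E≢0 =
    (λ p%4≡3 → order-3 p%4≡3 , degree₃-3 p%4≡3 , degree₂-3 p%4≡3 , degree₁-3 p%4≡3 , #degree₀)
  , (λ p%4≡1 A isA₂ → order-1 p%4≡1 A isA₂ , degree₃-1 p%4≡1 A isA₂ , degree₂-1 p%4≡1 A isA₂ ,
      degree₁-1 p%4≡1 A isA₂ , #degree₀)
  where open VietaCounts p p-prime p≥5 E E≢0
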